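{- Let $m\ge1$, $n\ge1$, and let $Q=A_m\square A_{2n-1}^{(1)}$ with initial cluster variables $x_v$ and bipartite mutation map $\mu=\mu_-\mu_+$ acting on $\mathbb F=\mathbb C(x_v:v\in Q)$. Let $q$ be the $j$-th vertex of $A_m$ counting from one of its ends ($1\le j\le m$), and let $q'$ be any vertex of $A_{2n-1}^{(1)}$. Then the sequence $(\mu^k(x_{(q,q')}))_{k\in\mathbb Z}$ is linearizable of order $n\binom{m+1}{j}$.
   Context: Quivers and mutation. A quiver is a directed graph without loops or directed 2-cycles; multiple arrows are allowed. Mutation $\mu_z$ at a vertex $z$ changes the quiver as follows. For each pair of arrows $y\to z\to y'$ an arrow $y\to y'$ is added. Then all arrows at $z$ are reversed. Then directed 2-cycles are cancelled. The variable at $z$ is replaced by $z'$ with $zz'=\prod_{y\to z}y+\prod_{z\to y}y$, arrows counted with multiplicity; other variables are unchanged. Box product. For bipartite graphs $Q=Q_0\sqcup Q_1$ and $Q'=Q_0'\sqcup Q_1'$, the box product $Q\square Q'$ has vertex set $Q\times Q'$. Each edge $q_1'q_2'$ of $Q'$ and each $q\in Q$ gives an edge between $(q,q_1')$ and $(q,q_2')$. Each edge $q_1q_2$ of $Q$ and each $q'\in Q'$ gives an edge between $(q_1,q')$ and $(q_2,q')$. Edges are oriented from $Q_0\times Q_0'$ to $Q_1\times Q_0'$, from $Q_1\times Q_0'$ to $Q_1\times Q_1'$, from $Q_1\times Q_1'$ to $Q_0\times Q_1'$, and from $Q_0\times Q_1'$ to $Q_0\times Q_0'$. The two factors. $A_m$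 is the path on $m$ vertices. $A_{2n-1}^{(1)}$ is the cycle on $2n$ vertices; for $n=1$ it is two vertices joined by a double edge. Both are bipartitioned by alternation. The map $\mu$. Black vertices are $Q_0\times Q_0'\cup Q_1\times Q_1'$; the others are white. $\mu_+$ mutates at all black vertices and $\mu_-$ at all white vertices. $\mu_-\mu_+$ (first $\mu_+$) returns the original quiver, so it defines a field automorphism $\mu$ of $\mathbb F$ sending $x_v$ to the new variable at $v$. Linearizability. A sequence $(a_k)_{k\in\mathbb Z}$ is linearizable of order $r$ if $a_k=c_1a_{k-1}+\dots+c_ra_{k-r}$ for all $k\in\mathbb Z$, for some constants $c_1,\dots,c_r\in\mathbb F$ independent of $k$. -}

module Defs where

open import Data.Bool using (Bool; true; false; if_then_else_; _∧_; not; _∨_)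
open import Data.Nat as ℕ using (ℕ; zero; suc)
open import Data.Integer as ℤ using (ℤ; +_; -[1+_]; 0ℤ; 1ℤ)
open import Data.Fin as Fin using (Fin; toℕ; combine; remQuot)
open import Data.Fin.Properties using () renaming (_≟_ to _≟F_)
open import Data.Vec as Vec using (Vec; replicate; zipWith; _[_]≔_)
open import Data.Vec.Properties using (≡-dec)
open import Data.List as List using (List; []; _∷_; _++_; map; concatMap; foldr; allFin; filterᵇ)
open import Data.Product using (_×_; _,_; proj₁; proj₂; Σ)
open import Relation.Binary.PropositionalEquality using (_≡_)
open import Relation.Nullary using (¬_; does)

ind : Bool → ℕ
ind true  = 1
ind false = 0

_==_ : ℕ → ℕ → Bool
a == b = does (a ℕ.≟ b)

evenᵇ : ℕ → Bool
evenᵇ zero          = true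
evenᵇ (suc zero)    = false
evenᵇ (suc (suc k)) = evenᵇ k

[_]₊ : ℤ → ℕ
[ + n ]₊     = n
[ -[1+ n ] ]₊ = 0

[_]₋ : ℤ → ℕ
[ + n ]₋     = 0
[ -[1+ n ] ]₋ = suc n

Mono : ℕ → Set
Mono N = Vec ℕ N

Poly : ℕ → Set
Poly N = List (ℤ × Mono N)

module _ {N : ℕ} where

  coeff : Poly N → Mono N → ℤ
  coeff []            e = 0ℤ
  coeff ((c , f) ∷ p) e with ≡-dec ℕ._≟_ f e
  ... | Relation.Nullary.yes _ = c ℤ.+ coeff p e
  ... | Relation.Nullary.no  _ = coeff p e

  _≈P_ : Poly N → Poly N → Set
  p ≈P q = ∀ e → coeff p e ≡ coeff q e

  NonZeroP : Poly N → Set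
  NonZeroP p = ¬ (∀ e → coeff p e ≡ 0ℤ)

  0P 1P : Poly N
  0P = []
  1P = (1ℤ , replicate N 0) ∷ []

  varP : Fin N → Poly N
  varP i = (1ℤ , (replicate N 0 [ i ]≔ 1)) ∷ []

  _+P_ : Poly N → Poly N → Poly N
  p +P q = p ++ q

  _*P_ : Poly N → Poly N → Poly N
  p *P q = concatMap (λ { (c , e) → map (λ { (d , f) → (c ℤ.* d , zipWith ℕ._+_ e f) }) q }) p

-- The field F = ℚ(x_0,…,x_{N-1}) as fractions num/den of integer
-- polynomials, with the usual equality  a/b ≈ c/d  iff  a·d = c·b.

Frac : ℕ → Set
Frac N = Poly N × Poly N

module _ {N : ℕ} where

  num den : Frac N → Poly N
  num = proj₁
  den = proj₂

  _≈F_ : Frac N → Frac N → Set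
  (a , b) ≈F (c , d) = (a *P d) ≈P (c *P b)

  0F 1F : Frac N
  0F = (0P , 1P)
  1F = (1P , 1P)

  varF : Fin N → Frac N
  varF i = (varP i , 1P)

  _+F_ : Frac N → Frac N → Frac N
  (a , b) +F (c , d) = ((a *P d) +P (c *P b) , b *P d)

  _*F_ : Frac N → Frac N → Frac N
  (a , b) *F (c , d) = (a *P c , b *P d)

  _/F_ : Frac N → Frac N → Frac N
  (a , b) /F (c , d) = (a *P d , b *P c)

  _^F_ : Frac N → ℕ → Frac N
  x ^F zero  = 1F
  x ^F suc k = x *F (x ^F k)

  ∏F : List (Frac N) → Frac N
  ∏F = foldr _*F_ 1F

  ΣF : (r : ℕ) → (Fin r → Frac N) → Frac N
  ΣF zero    f = 0F
  ΣF (suc r) f = f Fin.zero +F ΣF r (λ i → f (Fin.suc i))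

-- Seeds and mutation.  A quiver on vertex set Fin N is encoded by its
-- skew-symmetric exchange matrix  B y z = #(arrows y→z) − #(arrows z→y).

record Seed (N : ℕ) : Set where
  constructor seed
  field
    B : Fin N → Fin N → ℤ
    x : Fin N → Frac N
open Seed public

module _ {N : ℕ} where

  mutate : Fin N → Seed N → Seed N
  mutate z (seed B x) = seed B' x'
    where
      B' : Fin N → Fin N → ℤ
      B' i j = if does (i ≟F z) ∨ does (j ≟F z)
               then ℤ.- B i j
               else (B i j ℤ.+ (+ ([ B i z ]₊ ℕ.* [ B z j ]₊)))
                           ℤ.- (+ ([ B i z ]₋ ℕ.* [ B z j ]₋))
      x' : Fin N → Frac N
      x' j = if does (j ≟F z)
             then ((∏F (map (λ y → x y ^F [ B y z ]₊) (allFin N)))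
                    +F (∏F (map (λ y → x y ^F [ B y z ]₋) (allFin N)))) /F x z
             else x j

  mutateAll : List (Fin N) → Seed N → Seed N
  mutateAll []       s = s
  mutateAll (z ∷ zs) s = mutateAll zs (mutate z s)

  iterate : ℕ → (Seed N → Seed N) → Seed N → Seed N
  iterate zero    f s = s
  iterate (suc k) f s = f (iterate k f s)

-- Bipartite graphs: vertices Fin size, symmetric edge multiplicities,
-- and the bipartition (part v = true  iff  v ∈ Q₀).

record BipGraph : Set where
  field
    size : ℕ
    mult : Fin size → Fin size → ℕ
    part : Fin size → Bool
open BipGraph public

pathA : ℕ → BipGraph
pathA m = record
  { size = m
  ; mult = λ a b → ind (toℕ b == suc (toℕ a)) ℕ.+ ind (toℕ a == suc (toℕ b))
  ; part = λ a → evenᵇ (toℕ a)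
  }

-- A^{(1)}_{2n-1} : cycle on 2n vertices, with edges {i, i+1 mod 2n}
-- for i = 0 … 2n-1 (for n = 1 this is a double edge between 0 and 1).
cycleA : ℕ → BipGraph
cycleA n = record
  { size = 2 ℕ.* n
  ; mult = λ a b →
      ind (toℕ b == suc (toℕ a)) ℕ.+ ind (toℕ a == suc (toℕ b))
      ℕ.+ ind ((toℕ a == 0) ∧ (toℕ b == (2 ℕ.* n ℕ.∸ 1)))
      ℕ.+ ind ((toℕ b == 0) ∧ (toℕ a == (2 ℕ.* n ℕ.∸ 1)))
  ; part = λ a → evenᵇ (toℕ a)
  }

-- Box product Q □ Q' : number of arrows from (q₁,q₁') to (q₂,q₂').
-- Orientation: Q₀×Q₀' → Q₁×Q₀' → Q₁×Q₁' → Q₀×Q₁' → Q₀×Q₀'.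
boxArrows : (Q Q' : BipGraph) →
            Fin (size Q) × Fin (size Q') → Fin (size Q) × Fin (size Q') → ℕ
boxArrows Q Q' (q₁ , a₁) (q₂ , a₂) =
    ind (does (q₁ ≟F q₂)) ℕ.* mult Q' a₁ a₂ ℕ.* ind orient'
  ℕ.+ ind (does (a₁ ≟F a₂)) ℕ.* mult Q q₁ q₂ ℕ.* ind orient
  where
    orient' : Bool
    orient' = if part Q q₁
              then not (part Q' a₁) ∧ part Q' a₂
              else part Q' a₁ ∧ not (part Q' a₂)
    orient : Bool
    orient = if part Q' a₁
             then part Q q₁ ∧ not (part Q q₂)
             else not (part Q q₁) ∧ part Q q₂

-- Vertices of Q □ Q' are encoded in Fin (size Q * size Q')
-- via combine / remQuot.
BoxN : BipGraph → BipGraph → ℕ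
BoxN Q Q' = size Q ℕ.* size Q'

boxB : (Q Q' : BipGraph) → Fin (BoxN Q Q') → Fin (BoxN Q Q') → ℤ
boxB Q Q' u w =
  (+ boxArrows Q Q' (remQuot (size Q') u) (remQuot (size Q') w))
  ℤ.- (+ boxArrows Q Q' (remQuot (size Q') w) (remQuot (size Q') u))

isBlack : (Q Q' : BipGraph) → Fin (BoxN Q Q') → Bool
isBlack Q Q' u with remQuot {size Q} (size Q') u
... | (q , a) = (part Q q ∧ part Q' a) ∨ (not (part Q q) ∧ not (part Q' a))

initialSeed : (Q Q' : BipGraph) → Seed (BoxN Q Q')
initialSeed Q Q' = seed (boxB Q Q') varF

μ₊ μ₋ : (Q Q' : BipGraph) → Seed (BoxN Q Q') → Seed (BoxN Q Q')
μ₊ Q Q' = mutateAll (filterᵇ (isBlack Q Q') (allFin _))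
μ₋ Q Q' = mutateAll (filterᵇ (λ u → not (isBlack Q Q' u)) (allFin _))

-- μ^k(x_v), k ∈ ℤ.  For k ≥ 0: the cluster variable at v after k rounds of
-- μ₋μ₊ (first μ₊) from the initial seed; for k < 0: after |k| rounds of
-- the inverse μ₊μ₋ (first μ₋).  (Since μ₋μ₊ returns the quiver, this is
-- the k-th power of the field automorphism μ applied to x_v.)
μPow : (Q Q' : BipGraph) → ℤ → Fin (BoxN Q Q') → Frac (BoxN Q Q')
μPow Q Q' (+ k) v =
  x (iterate k (λ s → μ₋ Q Q' (μ₊ Q Q' s)) (initialSeed Q Q')) v
μPow Q Q' -[1+ k ] v =
  x (iterate (suc k) (λ s → μ₊ Q Q' (μ₋ Q Q' s)) (initialSeed Q Q')) v

-- Linearizability of order r: a_k = c₁ a_{k-1} + … + c_r a_{k-r} for all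
-- k ∈ ℤ, with constants c_i ∈ F (genuine fractions: nonzero denominators).

Linearizable : {N : ℕ} → (ℤ → Frac N) → ℕ → Set
Linearizable {N} a r =
  Σ (Fin r → Frac N) λ c →
    (∀ i → NonZeroP (den (c i))) ×
    (∀ k → a k ≈F ΣF r (λ i → c i *F a (k ℤ.- (+ suc (toℕ i)))))

-- The cluster variables satisfy the T-system
--   T_j(α,β) T_j(α+1,β+1) = T_j(α+1,β) T_j(α,β+1) + T_{j+1}(α,β) T_{j-1}(α+1,β+1),   T_0 = T_{m+1} = 1,
-- which is Dodgson condensation: T_j(α,β) is the contiguous j × j minor of the matrix M(α,β) = T_1(α,β), and all
-- contiguous minors of size m+2 vanish. Since those of size m+1 equal 1, the columns of M span a space of dimension m+1,
-- so the j × j minors, as functions of the rows, lie in a space of dimension C(m+1,j). Shifting all rows by 2n shifts the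
-- columns by 2n, because M(α+2n,β) = M(α,β+2n), so this space is stable under the row shift. By Cayley–Hamilton the shift
-- is annihilated by a monic polynomial of degree C(m+1,j), and on T_j it acts as the n-th power of μ. The two ends of A_m
-- give the same order because C(m+1,j) = C(m+1,m+1-j).

module Submission where

open import Defs
open import Algebra using (CommutativeRing)
open import Data.Bool using (Bool; true; false; if_then_else_; not)
import Data.Bool.Properties as Boolₚ
open import Data.Empty using (⊥; ⊥-elim)
open import Data.Fin as Fin using (Fin; toℕ; fromℕ; fromℕ<; inject₁; combine; remQuot)
import Data.Fin.Properties as Finₚ
open import Data.Fin.Properties using () renaming (_≟_ to _≟F_)
open import Data.Integer as ℤ using (ℤ; +_; -[1+_]; 0ℤ; 1ℤ)
import Data.Integer.Properties as ℤₚ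
import Data.Integer.Solver as ℤSolver
open import Data.List as List using (List; []; _∷_; _++_; _∷ʳ_; map; foldr; length; allFin; filterᵇ)
open import Data.List.Membership.Propositional using (_∈_; _∉_)
open import Data.List.Membership.Propositional.Properties
  using (∈-++⁻; ∈-++⁺ˡ; ∈-++⁺ʳ; ∈-map⁻; ∈-map⁺; ∈-allFin; ∈-filter⁺; ∈-filter⁻)
import Data.List.Properties as Listₚ
open import Data.List.Relation.Unary.All as All using (All; []; _∷_)
import Data.List.Relation.Unary.All.Properties as Allₚ
open import Data.List.Relation.Unary.AllPairs using ([]; _∷_)
open import Data.List.Relation.Unary.Any using (here; there)
open import Data.List.Relation.Unary.Unique.Propositional using (Unique)
open import Data.List.Relation.Unary.Unique.Propositional.Properties using (allFin⁺; filter⁺)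
open import Data.Maybe using (Maybe; just; nothing)
open import Data.Nat as ℕ using (ℕ; zero; suc; _≤_; _<_; s≤s)
open import Data.Nat.Combinatorics using (_C_; nCk≡nC[n∸k]; nCk+nC[k+1]≡[n+1]C[k+1])
open import Data.Nat.ListAction using (sum)
import Data.Nat.Properties as ℕₚ
import Data.Nat.Solver as ℕSolver
open import Data.Product using (Σ; ∃; _×_; _,_; proj₁; proj₂)
open import Data.Sum as Sum using (_⊎_; inj₁; inj₂)
open import Data.Vec as Vec using (Vec; []; _∷_; zipWith)
import Data.Vec.Properties as Vecₚ
open import Function using (_∘_; Equivalence)
open import Level using (0ℓ)
open import Relation.Binary using (Tri; tri<; tri≈; tri>)
open import Relation.Binary.PropositionalEquality as ≡ using (_≡_; _≢_)
open import Relation.Nullary using (¬_; Dec; yes; no; does)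
open import Relation.Nullary.Decidable using (dec-true; dec-false; map′; T?)

-- Dodgson condensation determines a minor only after division by a smaller one, so everything rests
-- on the cluster variables being nonzero. That comes from positivity: mutation uses no subtraction,
-- hence numerators and denominators keep positive integer coefficients, where nothing can cancel.
-- The same divisions call for an honest field: equality of fractions by cross-multiplication is
-- transitive only for nonzero denominators, and the exchange steps of linear algebra must decide
-- whether a scalar vanishes, which leading monomials make possible. The matrix M is infinite in
-- both directions and only its contiguous minors are known. That N = m+1 consecutive columns span
-- all the others uses more than the vanishing of the minors of size N+1: those of size N equal 1 in
-- every window of rows, so that eliminations in overlapping windows agree. The order has to come
-- out exactly. No dimension is ever computed: the annihilating polynomial gets as many coefficients
-- as there are spanning vectors, dependent or not.

-- Ring solver with integer coefficients over an arbitrary commutative ring.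

module IntegerCoefficients (R : CommutativeRing 0ℓ 0ℓ) where
  open CommutativeRing R
  open import Algebra.Properties.Ring ring
  open import Algebra.Properties.Semiring.Mult.TCOptimised semiring renaming (_×_ to _·_)
  open import Algebra.Solver.Ring.AlmostCommutativeRing
  open import Relation.Binary.Reasoning.Setoid setoid

  -- The optimised multiple makes `1 · 1#` compute to `1#` and `0 · 1#` to `0#`, so `con (+ 1)` and
  -- `con (+ 0)` stand literally for these elements in the goals handed to the solver.
  ⟦_⟧ : ℤ → Carrier
  ⟦ + n ⟧ = n · 1#
  ⟦ -[1+ n ] ⟧ = - (suc n · 1#)

  -‿homo : ∀ i → ⟦ ℤ.- i ⟧ ≈ - ⟦ i ⟧
  -‿homo (+ zero) = sym -0#≈0#
  -‿homo (+ suc n) = refl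
  -‿homo -[1+ n ] = sym (-‿involutive _)

  1+‿homo : ∀ n → suc n · 1# ≈ 1# + n · 1#
  1+‿homo n = ×-homo-+ 1# 1 n

  cancel-1 : ∀ x y → x - y ≈ (1# + x) - (1# + y)
  cancel-1 x y = begin
    x - y                       ≈⟨ +-identityˡ _ ⟨
    0# + (x - y)                ≈⟨ +-congʳ (-‿inverseʳ 1#) ⟨
    (1# - 1#) + (x - y)         ≈⟨ +-assoc _ _ _ ⟩
    1# + (- 1# + (x - y))       ≈⟨ +-congˡ (+-assoc _ _ _) ⟨
    1# + ((- 1# + x) - y)       ≈⟨ +-congˡ (+-congʳ (+-comm _ _)) ⟩
    1# + ((x + - 1#) - y)       ≈⟨ +-congˡ (+-assoc _ _ _) ⟩
    1# + (x + (- 1# - y))       ≈⟨ +-assoc _ _ _ ⟨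
    (1# + x) + (- 1# - y)       ≈⟨ +-congˡ (-‿+-comm 1# y) ⟩
    (1# + x) - (1# + y)         ∎

  ⊖-homo : ∀ m n → ⟦ m ℤ.⊖ n ⟧ ≈ m · 1# - n · 1#
  ⊖-homo zero zero = sym (-‿inverseʳ 0#)
  ⊖-homo (suc m) zero = sym (trans (+-congˡ -0#≈0#) (+-identityʳ _))
  ⊖-homo zero (suc n) = sym (+-identityˡ _)
  ⊖-homo (suc m) (suc n) = begin
    ⟦ suc m ℤ.⊖ suc n ⟧               ≡⟨ ≡.cong ⟦_⟧ (ℤₚ.[1+m]⊖[1+n]≡m⊖n m n) ⟩
    ⟦ m ℤ.⊖ n ⟧                       ≈⟨ ⊖-homo m n ⟩
    m · 1# - n · 1#                   ≈⟨ cancel-1 _ _ ⟩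
    (1# + m · 1#) - (1# + n · 1#)     ≈⟨ +-cong (1+‿homo m) (-‿cong (1+‿homo n)) ⟨
    suc m · 1# - suc n · 1#           ∎

  +-homo : ∀ i j → ⟦ i ℤ.+ j ⟧ ≈ ⟦ i ⟧ + ⟦ j ⟧
  +-homo (+ m) (+ n) = ×-homo-+ 1# m n
  +-homo (+ m) -[1+ n ] = ⊖-homo m (suc n)
  +-homo -[1+ m ] (+ n) = trans (⊖-homo n (suc m)) (+-comm _ _)
  +-homo -[1+ m ] -[1+ n ] = begin
    - (suc (suc (m ℕ.+ n)) · 1#)          ≡⟨ ≡.cong (λ k → - (suc k · 1#)) (ℕₚ.+-suc m n) ⟨
    - ((suc m ℕ.+ suc n) · 1#)            ≈⟨ -‿cong (×-homo-+ 1# (suc m) (suc n)) ⟩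
    - (suc m · 1# + suc n · 1#)           ≈⟨ -‿+-comm _ _ ⟨
    - (suc m · 1#) - suc n · 1#           ∎

  *-homo⁺ : ∀ m j → ⟦ + m ℤ.* j ⟧ ≈ ⟦ + m ⟧ * ⟦ j ⟧
  *-homo⁺ m (+ n) = trans (reflexive (≡.cong ⟦_⟧ (≡.sym (ℤₚ.pos-* m n)))) (×1-homo-* m n)
  *-homo⁺ m -[1+ n ] = begin
    ⟦ + m ℤ.* -[1+ n ] ⟧        ≡⟨ ≡.cong ⟦_⟧ (ℤₚ.neg-distribʳ-* (+ m) (+ suc n)) ⟨
    ⟦ ℤ.- (+ m ℤ.* + suc n) ⟧   ≈⟨ -‿homo (+ m ℤ.* + suc n) ⟩
    - ⟦ + m ℤ.* + suc n ⟧       ≈⟨ -‿cong (*-homo⁺ m (+ suc n)) ⟩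
    - (m · 1# * (suc n · 1#))   ≈⟨ -‿distribʳ-* _ _ ⟩
    m · 1# * - (suc n · 1#)     ∎
  *-homo : ∀ i j → ⟦ i ℤ.* j ⟧ ≈ ⟦ i ⟧ * ⟦ j ⟧
  *-homo (+ m) j = *-homo⁺ m j
  *-homo -[1+ m ] j = begin
    ⟦ -[1+ m ] ℤ.* j ⟧          ≡⟨ ≡.cong ⟦_⟧ (ℤₚ.neg-distribˡ-* (+ suc m) j) ⟨
    ⟦ ℤ.- (+ suc m ℤ.* j) ⟧     ≈⟨ -‿homo (+ suc m ℤ.* j) ⟩
    - ⟦ + suc m ℤ.* j ⟧         ≈⟨ -‿cong (*-homo⁺ (suc m) j) ⟩
    - (suc m · 1# * ⟦ j ⟧)      ≈⟨ -‿distribˡ-* _ _ ⟩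
    - (suc m · 1#) * ⟦ j ⟧      ∎

  morphism : CommutativeRing.rawRing ℤₚ.+-*-commutativeRing -Raw-AlmostCommutative⟶ fromCommutativeRing R
  morphism = record
    { ⟦_⟧ = ⟦_⟧ ; +-homo = +-homo ; *-homo = *-homo ; -‿homo = -‿homo
    ; 0-homo = refl ; 1-homo = refl }

  ≟-coeff : ∀ i j → Maybe (⟦ i ⟧ ≈ ⟦ j ⟧)
  ≟-coeff i j with i ℤ.≟ j
  ... | yes ≡.refl = just refl
  ... | no _ = nothing

  open import Algebra.Solver.Ring _ _ morphism ≟-coeff public
    using (solve; _:=_; _:+_; _:*_; _:-_; :-_; con)

-- Linear algebra over a discrete field

-- Pivoting in `exchange` has to decide whether a coefficient is zero; hence the decidable equality
-- next to the inverses.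
record DiscreteField : Set₁ where
  field
    commutativeRing : CommutativeRing 0ℓ 0ℓ
  open CommutativeRing commutativeRing public
  field
    _≟_     : ∀ x y → Dec (x ≈ y)
    inverse : ∀ x → ¬ x ≈ 0# → ∃ λ y → y * x ≈ 1#

module Subspaces (𝕂 : DiscreteField) (A : Set) where
  open DiscreteField 𝕂 renaming (Carrier to K) hiding (zero)
  open IntegerCoefficients commutativeRing
  open import Relation.Binary.Reasoning.Setoid setoid

  V : Set
  V = A → K

  _≐_ : V → V → Set
  g ≐ h = ∀ a → g a ≈ h a

  _⊆_ : (V → Set) → (V → Set) → Set
  Z ⊆ W = ∀ {h} → Z h → W h

  record IsSubspace (Z : V → Set) : Set where
    field
      resp : ∀ {g h} → g ≐ h → Z g → Z h
      null : Z (λ _ → 0#)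
      comb : ∀ {g h} c → Z g → Z h → Z (λ a → g a + c * h a)

    scale : ∀ {h} c → Z h → Z (λ a → c * h a)
    scale c z = resp (λ _ → +-identityˡ _) (comb c null z)

    minus : ∀ {g h} → Z g → Z h → Z (λ a → g a - h a)
    minus {g} {h} z w = resp (λ a → solve 2 (λ x y → x :+ (:- con (+ 1)) :* y := x :- y) refl (g a) (h a))
                             (comb (- 1#) z w)

  open IsSubspace

  Null : V → Set
  Null h = ∀ a → h a ≈ 0#

  Null-sub : IsSubspace Null
  Null-sub = record
    { resp = λ g≐h n a → trans (sym (g≐h a)) (n a)
    ; null = λ _ → refl
    ; comb = λ c m n a → trans (+-cong (m a) (trans (*-congˡ (n a)) (zeroʳ c))) (+-identityʳ 0#)
    }

  Null⊆ : ∀ {Z} → IsSubspace Z → Null ⊆ Z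
  Null⊆ s n = resp s (λ a → sym (n a)) (null s)

  -- This is Z + K y, with the coefficient of y as data. The general base Z replaces a quotient:
  -- `AdjoinAll ys Z` is the preimage of the span of `ys` in V/Z, which never has to be formed.
  record Adjoin (y : V) (Z : V → Set) (h : V) : Set where
    constructor _,_
    field
      coefficient : K
      remainder   : Z (λ a → h a - coefficient * y a)

  AdjoinAll : List V → (V → Set) → V → Set
  AdjoinAll ys Z = foldr Adjoin Z ys

  Span : List V → V → Set
  Span ys = AdjoinAll ys Null

  Adjoin-sub : ∀ {Z} y → IsSubspace Z → IsSubspace (Adjoin y Z)
  Adjoin-sub y s = record
    { resp = λ g≐h (β , z) → β , resp s (λ a → +-congʳ (g≐h a)) z
    ; null = 0# , resp s (λ a → sym (trans (+-congˡ (-‿cong (zeroˡ _))) (-‿inverseʳ 0#))) (null s)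
    ; comb = λ {g} {h} c (β , z) (γ , w) → β + c * γ ,
        resp s (λ a → solve 6 (λ g h y c β γ → (g :- β :* y) :+ c :* (h :- γ :* y)
                                          := (g :+ c :* h) :- (β :+ c :* γ) :* y)
                        refl (g a) (h a) (y a) c β γ)
             (comb s c z w)
    }

  AdjoinAll-sub : ∀ {Z} ys → IsSubspace Z → IsSubspace (AdjoinAll ys Z)
  AdjoinAll-sub []       s = s
  AdjoinAll-sub (y ∷ ys) s = Adjoin-sub y (AdjoinAll-sub ys s)

  Span-sub : ∀ ys → IsSubspace (Span ys)
  Span-sub ys = AdjoinAll-sub ys Null-sub

  ⊆Adjoin : ∀ {Z} y → IsSubspace Z → Z ⊆ Adjoin y Z
  ⊆Adjoin y s {h} z =
    0# , resp s (λ a → solve 2 (λ h y → h := h :- con (+ 0) :* y) refl (h a) (y a)) z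

  ∈Adjoin : ∀ {Z} y → IsSubspace Z → Adjoin y Z y
  ∈Adjoin y s =
    1# , resp s (λ a → solve 1 (λ y → con (+ 0) := y :- con (+ 1) :* y) refl (y a)) (null s)

  Adjoin-min : ∀ {Z W} y → IsSubspace W → Z ⊆ W → W y → Adjoin y Z ⊆ W
  Adjoin-min y s i w {h} (β , z) =
    resp s (λ a → solve 3 (λ h y β → (h :- β :* y) :+ β :* y := h) refl (h a) (y a) β)
         (comb s β (i z) w)

  ⊆AdjoinAll : ∀ {Z} ys → IsSubspace Z → Z ⊆ AdjoinAll ys Z
  ⊆AdjoinAll []       s z = z
  ⊆AdjoinAll (y ∷ ys) s z = ⊆Adjoin y (AdjoinAll-sub ys s) (⊆AdjoinAll ys s z)

  ∈AdjoinAll : ∀ {Z} ys → IsSubspace Z → ∀ {y} → y ∈ ys → AdjoinAll ys Z y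
  ∈AdjoinAll (y ∷ ys) s (here ≡.refl) = ∈Adjoin y (AdjoinAll-sub ys s)
  ∈AdjoinAll (y ∷ ys) s (there i)     = ⊆Adjoin y (AdjoinAll-sub ys s) (∈AdjoinAll ys s i)

  AdjoinAll-min : ∀ {Z W} ys → IsSubspace W → Z ⊆ W → (∀ {y} → y ∈ ys → W y) → AdjoinAll ys Z ⊆ W
  AdjoinAll-min []       s i w z = i z
  AdjoinAll-min (y ∷ ys) s i w z =
    Adjoin-min y s (AdjoinAll-min ys s i (λ m → w (there m))) (w (here ≡.refl)) z

  ∈Span : ∀ {ys y} → y ∈ ys → Span ys y
  ∈Span {ys} = ∈AdjoinAll ys Null-sub

  Span-min : ∀ {W} ys → IsSubspace W → (∀ {y} → y ∈ ys → W y) → Span ys ⊆ W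
  Span-min ys s = AdjoinAll-min ys s (Null⊆ s)

  Adjoin-mono : ∀ {Z W} y → Z ⊆ W → Adjoin y Z ⊆ Adjoin y W
  Adjoin-mono y i (β , z) = β , i z

  AdjoinAll-mono : ∀ {Z W} ys → Z ⊆ W → AdjoinAll ys Z ⊆ AdjoinAll ys W
  AdjoinAll-mono []       i z = i z
  AdjoinAll-mono (y ∷ ys) i z = Adjoin-mono y (AdjoinAll-mono ys i) z

  Adjoin-swap : ∀ {Z} x y → IsSubspace Z → Adjoin x (Adjoin y Z) ⊆ Adjoin y (Adjoin x Z)
  Adjoin-swap x y s {h} (β , γ , z) = γ , β ,
    resp s (λ a → solve 3 (λ h u v → (h :- u) :- v := (h :- v) :- u) refl (h a) (β * x a) (γ * y a)) z

  AdjoinAll-swap⇒ : ∀ {Z} y ys → IsSubspace Z → Adjoin y (AdjoinAll ys Z) ⊆ AdjoinAll ys (Adjoin y Z)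
  AdjoinAll-swap⇒ y ys s = Adjoin-min y (AdjoinAll-sub ys (Adjoin-sub y s))
    (AdjoinAll-mono ys (⊆Adjoin y s)) (⊆AdjoinAll ys (Adjoin-sub y s) (∈Adjoin y s))

  AdjoinAll-swap⇐ : ∀ {Z} y ys → IsSubspace Z → AdjoinAll ys (Adjoin y Z) ⊆ Adjoin y (AdjoinAll ys Z)
  AdjoinAll-swap⇐ {Z} y ys s = AdjoinAll-min ys sub
    (Adjoin-mono y (⊆AdjoinAll ys s)) (λ i → ⊆Adjoin y (AdjoinAll-sub ys s) (∈AdjoinAll ys s i))
    where
    sub : IsSubspace (Adjoin y (AdjoinAll ys Z))
    sub = Adjoin-sub y (AdjoinAll-sub ys s)

  Exchange : (V → Set) → List V → V → Set
  Exchange W ys u = W u ⊎ ∃ λ ys′ → length ys ≡ suc (length ys′)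
                                  × AdjoinAll ys W ⊆ AdjoinAll ys′ (Adjoin u W)
                                  × AdjoinAll ys′ (Adjoin u W) ⊆ AdjoinAll ys W

  -- Steinitz exchange modulo W. The first generator with a nonzero coefficient in the expression of
  -- u is solved for and gives up its place to u; if there is none, u lies in W.
  exchange : ∀ {W} ys → IsSubspace W → ∀ u → AdjoinAll ys W u →
    Exchange W ys u
  exchange []       s u z = inj₁ z
  exchange {W} (y ∷ ys) s u (β , z) with β ≟ 0#
  ... | no β≉0 = inj₂ (ys , ≡.refl
        , Adjoin-min y sub (AdjoinAll-mono ys (⊆Adjoin u s)) y∈
        , AdjoinAll-min ys sub′ (Adjoin-min u sub′ (λ w → ⊆Adjoin y subW (⊆AdjoinAll ys s w)) (β , z))
                        (λ i → ⊆Adjoin y subW (∈AdjoinAll ys s i)))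
    where
    subW : IsSubspace (AdjoinAll ys W)
    subW = AdjoinAll-sub ys s
    sub : IsSubspace (AdjoinAll ys (Adjoin u W))
    sub = AdjoinAll-sub ys (Adjoin-sub u s)
    sub′ : IsSubspace (Adjoin y (AdjoinAll ys W))
    sub′ = Adjoin-sub y subW
    β⁻¹ : K
    β⁻¹ = proj₁ (inverse β β≉0)
    y∈ : AdjoinAll ys (Adjoin u W) y
    y∈ = resp sub
      (λ a → begin
        β⁻¹ * (u a - (u a - β * y a)) ≈⟨ solve 4 (λ u y β i → i :* (u :- (u :- β :* y)) := (i :* β) :* y)
                                              refl (u a) (y a) β β⁻¹ ⟩
        (β⁻¹ * β) * y a               ≈⟨ *-congʳ (proj₂ (inverse β β≉0)) ⟩
        1# * y a                      ≈⟨ *-identityˡ _ ⟩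
        y a                           ∎)
      (scale sub β⁻¹ (minus sub (⊆AdjoinAll ys (Adjoin-sub u s) (∈Adjoin u s))
                                (AdjoinAll-mono ys (⊆Adjoin u s) z)))
  ... | yes β≈0 with exchange ys s u
          (resp (AdjoinAll-sub ys s)
            (λ a → trans (+-congˡ (-‿cong (trans (*-congʳ β≈0) (zeroˡ _))))
                         (solve 1 (λ u → u :- con (+ 0) := u) refl (u a))) z)
  ...   | inj₁ w = inj₁ w
  ...   | inj₂ (ys′ , l , i , j) =
          inj₂ (y ∷ ys′ , ≡.cong suc l , Adjoin-mono y i , Adjoin-mono y j)

module AnnihilatingPolynomial (𝕂 : DiscreteField) {A : Set} (σ : A → A) where
  open DiscreteField 𝕂 renaming (Carrier to K) hiding (zero)
  open Subspaces 𝕂 A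
  open IsSubspace
  open IntegerCoefficients commutativeRing
  open import Relation.Binary.Reasoning.Setoid setoid

  shift : V → V
  shift h a = h (σ a)

  Stable : (V → Set) → Set
  Stable Z = ∀ {h} → Z h → Z (shift h)

  -- The list c₀ … c_{d-1} stands for the monic polynomial c₀ + … + c_{d-1} S^{d-1} + S^d in the shift S.
  eval : List K → V → V
  eval []       h = h
  eval (c ∷ cs) h a = eval cs (shift h) a + c * h a

  eval-cong : ∀ cs {g h} → g ≐ h → eval cs g ≐ eval cs h
  eval-cong []       e a = e a
  eval-cong (c ∷ cs) e a = +-cong (eval-cong cs (λ b → e (σ b)) a) (*-congˡ (e a))

  eval-shift : ∀ cs h → eval cs (shift h) ≐ shift (eval cs h)
  eval-shift []       h a = refl
  eval-shift (c ∷ cs) h a = +-congʳ (eval-shift cs (shift h) a)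

  eval-comb : ∀ cs g h c a → eval cs (λ b → g b + c * h b) a ≈ eval cs g a + c * eval cs h a
  eval-comb []       g h c a = refl
  eval-comb (d ∷ cs) g h c a = begin
    eval cs (shift (λ b → g b + c * h b)) a + d * (g a + c * h a)
      ≈⟨ +-congʳ (eval-comb cs (shift g) (shift h) c a) ⟩
    (eval cs (shift g) a + c * eval cs (shift h) a) + d * (g a + c * h a)
      ≈⟨ solve 6 (λ x y g h c d → (x :+ c :* y) :+ d :* (g :+ c :* h) := (x :+ d :* g) :+ c :* (y :+ d :* h))
               refl (eval cs (shift g) a) (eval cs (shift h) a) (g a) (h a) c d ⟩
    eval (d ∷ cs) g a + c * eval (d ∷ cs) h a ∎

  eval-stable : ∀ {Z} → IsSubspace Z → Stable Z → ∀ cs {h} → Z h → Z (eval cs h)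
  eval-stable s t []       z = z
  eval-stable s t (c ∷ cs) z = comb s c (eval-stable s t cs (t z)) z

  -- The leading coefficient 1 of `qs` is not listed, so c still has to be added in degree
  -- `length qs` after `qs` runs out. The bound in `eval-addScaled` guarantees that `xs` lists this
  -- degree.
  addScaled : K → List K → List K → List K
  addScaled c _        []       = []
  addScaled c []       (x ∷ xs) = x + c ∷ xs
  addScaled c (q ∷ qs) (x ∷ xs) = x + c * q ∷ addScaled c qs xs

  length-addScaled : ∀ c qs xs → length (addScaled c qs xs) ≡ length xs
  length-addScaled c []       []       = ≡.refl
  length-addScaled c (_ ∷ _)  []       = ≡.refl
  length-addScaled c []       (_ ∷ _)  = ≡.refl
  length-addScaled c (_ ∷ qs) (_ ∷ xs) = ≡.cong suc (length-addScaled c qs xs)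

  eval-addScaled : ∀ c qs xs → length qs ℕ.< length xs → ∀ h a →
    eval (addScaled c qs xs) h a ≈ eval xs h a + c * eval qs h a
  eval-addScaled c []       (x ∷ xs) _ h a =
    solve 4 (λ e x c h → e :+ (x :+ c) :* h := (e :+ x :* h) :+ c :* h) refl (eval xs (shift h) a) x c (h a)
  eval-addScaled c (q ∷ qs) (x ∷ xs) (ℕ.s≤s l) h a = begin
    eval (addScaled c qs xs) (shift h) a + (x + c * q) * h a
      ≈⟨ +-congʳ (eval-addScaled c qs xs l (shift h) a) ⟩
    (eval xs (shift h) a + c * eval qs (shift h) a) + (x + c * q) * h a
      ≈⟨ solve 6 (λ e f x c q h → (e :+ c :* f) :+ (x :+ c :* q) :* h := (e :+ x :* h) :+ c :* (f :+ q :* h))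
               refl (eval xs (shift h) a) (eval qs (shift h) a) x c q (h a) ⟩
    (eval xs (shift h) a + x * h a) + c * (eval qs (shift h) a + q * h a) ∎

  -- Product of monic polynomials: `p ∷ ps` stands for p + S·ps, and prefixing `0#` multiplies by S.
  _⊛_ : List K → List K → List K
  []       ⊛ qs = qs
  (p ∷ ps) ⊛ qs = addScaled p qs (0# ∷ (ps ⊛ qs))

  length-⊛ : ∀ ps qs → length (ps ⊛ qs) ≡ length ps ℕ.+ length qs
  length-⊛ []       qs = ≡.refl
  length-⊛ (p ∷ ps) qs = ≡.trans (length-addScaled p qs (0# ∷ (ps ⊛ qs))) (≡.cong suc (length-⊛ ps qs))

  eval-⊛ : ∀ ps qs h a → eval (ps ⊛ qs) h a ≈ eval ps (eval qs h) a
  eval-⊛ []       qs h a = refl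
  eval-⊛ (p ∷ ps) qs h a = begin
    eval (addScaled p qs (0# ∷ (ps ⊛ qs))) h a
      ≈⟨ eval-addScaled p qs (0# ∷ (ps ⊛ qs)) (ℕ.s≤s (≡.subst (length qs ℕ.≤_) (≡.sym (length-⊛ ps qs)) (ℕₚ.m≤n+m _ _))) h a ⟩
    (eval (ps ⊛ qs) (shift h) a + 0# * h a) + p * eval qs h a
      ≈⟨ +-congʳ (trans (+-congˡ (zeroˡ _)) (+-identityʳ _)) ⟩
    eval (ps ⊛ qs) (shift h) a + p * eval qs h a
      ≈⟨ +-congʳ (eval-⊛ ps qs (shift h) a) ⟩
    eval ps (eval qs (shift h)) a + p * eval qs h a
      ≈⟨ +-congʳ (eval-cong ps (eval-shift qs h) a) ⟩
    eval ps (shift (eval qs h)) a + p * eval qs h a ∎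

  shifts : ℕ → V → V
  shifts zero    v = v
  shifts (suc k) v = shifts k (shift v)

  -- Z together with the Krylov vectors v, Sv, ..., S^(k-1) v.
  Chain : (V → Set) → V → ℕ → V → Set
  Chain Z v zero    = Z
  Chain Z v (suc k) = Adjoin v (Chain Z (shift v) k)

  Chain-sub : ∀ {Z} v k → IsSubspace Z → IsSubspace (Chain Z v k)
  Chain-sub v zero    s = s
  Chain-sub v (suc k) s = Adjoin-sub v (Chain-sub (shift v) k s)

  -- The chain is built from its front, while a new Krylov vector arrives at its end. This inclusion
  -- and its converse below pass between the two views.
  Chain-last⇒ : ∀ {Z} v k → IsSubspace Z → Chain Z v (suc k) ⊆ Adjoin (shifts k v) (Chain Z v k)
  Chain-last⇒ v zero    s z = z
  Chain-last⇒ v (suc k) s z =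
    Adjoin-swap v (shifts k (shift v)) (Chain-sub (shift v) k s) (Adjoin-mono v (Chain-last⇒ (shift v) k s) z)

  Chain-last⇐ : ∀ {Z} v k → IsSubspace Z → Adjoin (shifts k v) (Chain Z v k) ⊆ Chain Z v (suc k)
  Chain-last⇐ v zero    s z = z
  Chain-last⇐ v (suc k) s z =
    Adjoin-mono v (Chain-last⇐ (shift v) k s) (Adjoin-swap (shifts k (shift v)) v (Chain-sub (shift v) k s) z)

  Chain-shift : ∀ {Z} v k → Stable Z → ∀ {h} → Chain Z v k h → Chain Z (shift v) k (shift h)
  Chain-shift v zero    t z       = t z
  Chain-shift v (suc k) t (β , z) = β , Chain-shift (shift v) k t z

  -- The shift carries the generators to Sv, ..., S^k v, and only the last of these is not a
  -- generator already.
  Chain-stable : ∀ {Z} v k → IsSubspace Z → Stable Z → Chain Z v k (shifts k v) → Stable (Chain Z v k)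
  Chain-stable v k s t c z =
    Adjoin-min (shifts k v) (Chain-sub v k s) (λ w → w) c
      (Chain-last⇒ v k s (⊆Adjoin v (Chain-sub (shift v) k s) (Chain-shift v k t z)))

  -- Membership of h is a relation h = Σ β_i S^i v modulo Z, and the list consists of the negatives
  -- of the β_i. A general h makes the induction work; for h = S^k v the bracket vanishes, and the
  -- polynomial annihilates v modulo Z.
  Chain-polynomial : ∀ {Z} v k → IsSubspace Z → ∀ {h} → Chain Z v k h →
    ∃ λ cs → length cs ≡ k × Z (λ a → (h a - shifts k v a) + eval cs v a)
  Chain-polynomial v zero    s {h} z =
    [] , ≡.refl , resp s (λ a → solve 2 (λ h v → h := (h :- v) :+ v) refl (h a) (v a)) z
  Chain-polynomial v (suc k) s {h} (β , z) with Chain-polynomial (shift v) k s z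
  ... | cs , l , w = - β ∷ cs , ≡.cong suc l ,
    resp s (λ a → solve 5 (λ h v β x e → ((h :- β :* v) :- x) :+ e := (h :- x) :+ (e :+ (:- β) :* v))
                    refl (h a) (v a) β (shifts k (shift v) a) (eval cs (shift v) a)) w

  -- A polynomial in S commutes with S, so what sends v into the stable subspace Z does the same to
  -- every S^i v.
  Chain-annihilated : ∀ {Z} v k → IsSubspace Z → Stable Z → ∀ cs → Z (eval cs v) →
    ∀ {h} → Chain Z v k h → Z (eval cs h)
  Chain-annihilated v zero    s t cs e z = eval-stable s t cs z
  Chain-annihilated v (suc k) s t cs e {h} (β , z) =
    resp s (λ a → begin
        eval cs (λ b → h b - β * v b) a + β * eval cs v a
          ≈⟨ eval-comb cs (λ b → h b - β * v b) v β a ⟨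
        eval cs (λ b → (h b - β * v b) + β * v b) a
          ≈⟨ eval-cong cs (λ b → solve 2 (λ h y → (h :- y) :+ y := h) refl (h b) (β * v b)) a ⟩
        eval cs h a ∎)
      (comb s β (Chain-annihilated (shift v) k s t cs (resp s (λ a → sym (eval-shift cs v a)) (t e)) z) e)

  Annihilator : ℕ → (V → Set) → (V → Set) → Set
  Annihilator d W Z = ∃ λ ps → length ps ≡ d × (∀ {h} → W h → Z (eval ps h))

  -- A determinant-free Cayley–Hamilton theorem: split off the cyclic subspace generated by one vector, then pass to the quotient.
  annihilate : ∀ d ys → length ys ≡ d → ∀ {Z} → IsSubspace Z → Stable Z →
    Stable (AdjoinAll ys Z) → Annihilator d (AdjoinAll ys Z) Z

  -- Generators are traded for vectors of one cyclic chain. The total k + d does not change in a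
  -- trade, so it is known to be the degree before the length of the chain is.
  annihilate-chain : ∀ d ys → length ys ≡ d → ∀ {Z} → IsSubspace Z → Stable Z → ∀ v k →
    AdjoinAll ys (Chain Z v k) v → Stable (AdjoinAll ys (Chain Z v k)) →
    Annihilator (k ℕ.+ d) (AdjoinAll ys (Chain Z v k)) Z

  -- If S^k v depends on the chain, the chain is stable and contributes a factor of degree k, and
  -- the d remaining generators are treated modulo the chain. Otherwise S^k v displaces one of them:
  -- k grows and d drops.
  resolve : ∀ d ys → length ys ≡ d → ∀ {Z} → IsSubspace Z → Stable Z → ∀ v k →
    AdjoinAll ys (Chain Z v k) v → Stable (AdjoinAll ys (Chain Z v k)) →
    Exchange (Chain Z v k) ys (shifts k v) →
    Annihilator (k ℕ.+ d) (AdjoinAll ys (Chain Z v k)) Z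

  annihilate zero    []       _ s t _ = [] , ≡.refl , λ z → z
  annihilate (suc d) (y ∷ ys) l {Z} s t u =
    proj₁ ann , proj₁ (proj₂ ann) , λ z → proj₂ (proj₂ ann) (AdjoinAll-swap⇒ y ys s z)
    where
    ann : Annihilator (suc d) (AdjoinAll ys (Chain Z y 1)) Z
    ann = annihilate-chain d ys (ℕₚ.suc-injective l) s t y 1
           (AdjoinAll-swap⇒ y ys s (∈Adjoin y (AdjoinAll-sub ys s)))
           (λ z → AdjoinAll-swap⇒ y ys s (u (AdjoinAll-swap⇐ y ys s z)))

  annihilate-chain d ys l {Z} s t v k v∈ u =
    resolve d ys l s t v k v∈ u (exchange ys (Chain-sub v k s) (shifts k v) (shifts∈ k v∈))
    where
    shifts∈ : ∀ i {w} → AdjoinAll ys (Chain Z v k) w → AdjoinAll ys (Chain Z v k) (shifts i w)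
    shifts∈ zero    z = z
    shifts∈ (suc i) z = shifts∈ i (u z)

  resolve d ys l {Z} s t v k v∈ u (inj₁ c) =
    -- The right factor acts first: it carries everything into the chain, which the left factor
    -- carries into Z.
    proj₁ poly ⊛ proj₁ ann
    , ≡.trans (length-⊛ (proj₁ poly) (proj₁ ann)) (≡.cong₂ ℕ._+_ (proj₁ (proj₂ poly)) (proj₁ (proj₂ ann)))
    , λ {h} z → resp s (λ a → sym (eval-⊛ (proj₁ poly) (proj₁ ann) h a))
                  (Chain-annihilated v k s t (proj₁ poly) poly-v (proj₂ (proj₂ ann) z))
    where
    poly : ∃ λ cs → length cs ≡ k × Z (λ a → (shifts k v a - shifts k v a) + eval cs v a)
    poly = Chain-polynomial v k s c
    ann : Annihilator d (AdjoinAll ys (Chain Z v k)) (Chain Z v k)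
    ann = annihilate d ys l (Chain-sub v k s) (Chain-stable v k s t c) u
    poly-v : Z (eval (proj₁ poly) v)
    poly-v = resp s (λ a → trans (+-congʳ (-‿inverseʳ _)) (+-identityˡ _)) (proj₂ (proj₂ poly))
  resolve zero [] l s t v k v∈ u (inj₂ (_ , () , _))
  resolve (suc d) ys l {Z} s t v k v∈ u (inj₂ (ys′ , l′ , i , j)) =
    proj₁ ann , ≡.trans (proj₁ (proj₂ ann)) (≡.sym (ℕₚ.+-suc k d)) , λ z → proj₂ (proj₂ ann) (to z)
    where
    to : AdjoinAll ys (Chain Z v k) ⊆ AdjoinAll ys′ (Chain Z v (suc k))
    to z = AdjoinAll-mono ys′ (Chain-last⇐ v k s) (i z)
    from : AdjoinAll ys′ (Chain Z v (suc k)) ⊆ AdjoinAll ys (Chain Z v k)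
    from z = j (AdjoinAll-mono ys′ (Chain-last⇒ v k s) z)
    ann : Annihilator (suc k ℕ.+ d) (AdjoinAll ys′ (Chain Z v (suc k))) Z
    ann = annihilate-chain d ys′ (ℕₚ.suc-injective (≡.trans (≡.sym l′) l)) s t v (suc k)
            (to v∈) (λ z → to (u (from z)))

-- Exterior algebra and determinants

module Exterior (𝕂 : DiscreteField) (I : Set) where
  open DiscreteField 𝕂 renaming (Carrier to K) hiding (zero)
  open IntegerCoefficients commutativeRing
  open import Relation.Binary.Reasoning.Setoid setoid
  module X = Subspaces 𝕂 I
  module Λ = Subspaces 𝕂 (List I)
  open X using (_,_) renaming (V to X)
  open Λ using (_≐_) renaming (V to Λ)

  -- Interior product with the evaluation at row a. The recursive clause of `_∧_` is the Leibniz
  -- rule ι_a (f ∧ ω) = f(a) ω - f ∧ ι_a ω.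
  contract : I → Λ → Λ
  contract a ω as = ω (a ∷ as)

  -- Expansion along the first row, so that wedge (f₁ ∷ … ∷ f_j ∷ []) sends a list of j rows a_r to det (f_s a_r).
  infixr 7 _∧_
  _∧_ : X → Λ → Λ
  (f ∧ ω) []       = 0#
  (f ∧ ω) (a ∷ as) = f a * ω as - (f ∧ contract a ω) as

  ∧-cong : ∀ {f g ω ψ} → f X.≐ g → ω ≐ ψ → (f ∧ ω) ≐ (g ∧ ψ)
  ∧-cong e e′ []       = refl
  ∧-cong e e′ (a ∷ as) = +-cong (*-cong (e a) (e′ as)) (-‿cong (∧-cong e (e′ ∘ (a ∷_)) as))

  ∧-congʳ : ∀ f {ω ψ} → ω ≐ ψ → (f ∧ ω) ≐ (f ∧ ψ)
  ∧-congʳ f = ∧-cong (λ _ → refl)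

  ∧-combʳ : ∀ f ω c ψ → (f ∧ (λ as → ω as + c * ψ as)) ≐ (λ as → (f ∧ ω) as + c * (f ∧ ψ) as)
  ∧-combʳ f ω c ψ []       = solve 1 (λ c → con (+ 0) := con (+ 0) :+ c :* con (+ 0)) refl c
  ∧-combʳ f ω c ψ (a ∷ as) = trans (+-congˡ (-‿cong (∧-combʳ f (contract a ω) c (contract a ψ) as)))
    (solve 6 (λ x w c p y z → x :* (w :+ c :* p) :- (y :+ c :* z) := (x :* w :- y) :+ c :* (x :* p :- z))
      refl (f a) (ω as) c (ψ as) _ _)

  ∧-combˡ : ∀ f c g ω → ((λ a → f a + c * g a) ∧ ω) ≐ (λ as → (f ∧ ω) as + c * (g ∧ ω) as)
  ∧-combˡ f c g ω []       = solve 1 (λ c → con (+ 0) := con (+ 0) :+ c :* con (+ 0)) refl c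
  ∧-combˡ f c g ω (a ∷ as) = trans (+-congˡ (-‿cong (∧-combˡ f c g (contract a ω) as)))
    (solve 6 (λ x g c w y z → (x :+ c :* g) :* w :- (y :+ c :* z) := (x :* w :- y) :+ c :* (g :* w :- z))
      refl (f a) (g a) c (ω as) _ _)

  ∧-zeroʳ : ∀ f → (f ∧ (λ _ → 0#)) ≐ (λ _ → 0#)
  ∧-zeroʳ f []       = refl
  ∧-zeroʳ f (a ∷ as) = trans (+-cong (zeroʳ _) (-‿cong (∧-zeroʳ f as))) (-‿inverseʳ 0#)

  ∧-zeroˡ : ∀ ω → ((λ _ → 0#) ∧ ω) ≐ (λ _ → 0#)
  ∧-zeroˡ ω []       = refl
  ∧-zeroˡ ω (a ∷ as) = trans (+-cong (zeroˡ _) (-‿cong (∧-zeroˡ (contract a ω) as))) (-‿inverseʳ 0#)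

  ∧-scaleʳ : ∀ f c ω → (f ∧ (λ as → c * ω as)) ≐ (λ as → c * (f ∧ ω) as)
  ∧-scaleʳ f c ω as = begin
    (f ∧ (λ bs → c * ω bs)) as        ≈⟨ ∧-cong (λ _ → refl) (λ bs → sym (+-identityˡ (c * ω bs))) as ⟩
    (f ∧ (λ bs → 0# + c * ω bs)) as   ≈⟨ ∧-combʳ f _ c ω as ⟩
    (f ∧ (λ _ → 0#)) as + c * (f ∧ ω) as ≈⟨ trans (+-congʳ (∧-zeroʳ f as)) (+-identityˡ _) ⟩
    c * (f ∧ ω) as                    ∎

  ∧-contract : ∀ f g a ω as → (f ∧ contract a (g ∧ ω)) as ≈ g a * (f ∧ ω) as - (f ∧ g ∧ contract a ω) as
  ∧-contract f g a ω as = begin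
    (f ∧ contract a (g ∧ ω)) as
      ≈⟨ ∧-cong (λ _ → refl) (λ bs → solve 2 (λ x y → x :- y := con (+ 0) :+ con (+ 1) :* (x :+ (:- con (+ 1)) :* y)) refl _ _) as ⟩
    (f ∧ (λ bs → 0# + 1# * (g a * ω bs + (- 1#) * (g ∧ contract a ω) bs))) as
      ≈⟨ ∧-combʳ f _ 1# _ as ⟩
    (f ∧ (λ _ → 0#)) as + 1# * (f ∧ (λ bs → g a * ω bs + (- 1#) * (g ∧ contract a ω) bs)) as
      ≈⟨ +-cong (∧-zeroʳ f as) (*-congˡ (trans (∧-combʳ f _ (- 1#) _ as) (+-congʳ (∧-scaleʳ f (g a) ω as)))) ⟩
    0# + 1# * (g a * (f ∧ ω) as + (- 1#) * (f ∧ g ∧ contract a ω) as)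
      ≈⟨ solve 2 (λ x y → con (+ 0) :+ con (+ 1) :* (x :+ (:- con (+ 1)) :* y) := x :- y) refl _ _ ⟩
    g a * (f ∧ ω) as - (f ∧ g ∧ contract a ω) as ∎

  ∧-anticomm : ∀ f g ω → (f ∧ g ∧ ω) ≐ (λ as → - (g ∧ f ∧ ω) as)
  ∧-anticomm f g ω []       = solve 0 (con (+ 0) := :- con (+ 0)) refl
  ∧-anticomm f g ω (a ∷ as) = begin
    f a * (g ∧ ω) as - (f ∧ contract a (g ∧ ω)) as
      ≈⟨ +-congˡ (-‿cong (trans (∧-contract f g a ω as) (+-congˡ (-‿cong (∧-anticomm f g (contract a ω) as))))) ⟩
    f a * (g ∧ ω) as - (g a * (f ∧ ω) as - - (g ∧ f ∧ contract a ω) as)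
      ≈⟨ solve 3 (λ x y z → x :- (y :- :- z) := :- (y :- (x :- z))) refl _ _ _ ⟩
    - (g a * (f ∧ ω) as - (f a * (g ∧ ω) as - (g ∧ f ∧ contract a ω) as))
      ≈⟨ -‿cong (+-congˡ (-‿cong (∧-contract g f a ω as))) ⟨
    - (g a * (f ∧ ω) as - (g ∧ contract a (f ∧ ω)) as) ∎

  -- In characteristic 2 this does not follow from `∧-anticomm`, so the induction through the
  -- Leibniz rule is repeated.
  ∧-square : ∀ f ω → (f ∧ f ∧ ω) ≐ (λ _ → 0#)
  ∧-square f ω []       = refl
  ∧-square f ω (a ∷ as) = begin
    f a * (f ∧ ω) as - (f ∧ contract a (f ∧ ω)) as
      ≈⟨ +-congˡ (-‿cong (trans (∧-contract f f a ω as) (+-congˡ (-‿cong (∧-square f (contract a ω) as))))) ⟩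
    f a * (f ∧ ω) as - (f a * (f ∧ ω) as - 0#)
      ≈⟨ solve 1 (λ x → x :- (x :- con (+ 0)) := con (+ 0)) refl _ ⟩
    0# ∎

  unit : Λ
  unit []      = 1#
  unit (_ ∷ _) = 0#

  wedge : List X → Λ
  wedge = foldr _∧_ unit

  ∧-subspace : ∀ {Z} f → Λ.IsSubspace Z → Λ.IsSubspace (λ ω → Z (f ∧ ω))
  ∧-subspace f s = record
    { resp = λ e z → resp s (∧-cong (λ _ → refl) e) z
    ; null = resp s (λ as → sym (∧-zeroʳ f as)) (null s)
    ; comb = λ {ω} {ψ} c z w → resp s (λ as → sym (∧-combʳ f ω c ψ as)) (comb s c z w)
    } where open Λ.IsSubspace

  ∧-subspaceˡ : ∀ {Z} ω → Λ.IsSubspace Z → X.IsSubspace (λ f → Z (f ∧ ω))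
  ∧-subspaceˡ ω s = record
    { resp = λ e z → resp s (∧-cong e (λ _ → refl)) z
    ; null = resp s (λ as → sym (∧-zeroˡ ω as)) (null s)
    ; comb = λ {f} {g} c z w → resp s (λ as → sym (∧-combˡ f c g ω as)) (comb s c z w)
    } where open Λ.IsSubspace

  ∈-∧-wedge : ∀ fs {f} → f ∈ fs → Λ.Null (f ∧ wedge fs)
  ∈-∧-wedge (f ∷ fs) (here ≡.refl) = ∧-square f (wedge fs)
  ∈-∧-wedge (g ∷ fs) {f} (there i) as = begin
    (f ∧ g ∧ wedge fs) as       ≈⟨ ∧-anticomm f g (wedge fs) as ⟩
    - (g ∧ f ∧ wedge fs) as     ≈⟨ -‿cong (∧-cong (λ _ → refl) (∈-∧-wedge fs i) as) ⟩
    - (g ∧ (λ _ → 0#)) as       ≈⟨ -‿cong (∧-zeroʳ g as) ⟩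
    - 0#                        ≈⟨ solve 0 (:- con (+ 0) := con (+ 0)) refl ⟩
    0#                          ∎

  Span-∧-wedge : ∀ fs {f} → X.Span fs f → Λ.Null (f ∧ wedge fs)
  Span-∧-wedge fs = X.Span-min fs (∧-subspaceˡ (wedge fs) Λ.Null-sub) (∈-∧-wedge fs)

  -- This concerns the rows, whereas `∧-anticomm` and `∧-square` concern the columns. The prefix
  -- `ps` lets the property pass to contractions.
  record Alternating (ω : Λ) : Set where
    field
      swap : ∀ ps a b as → ω (ps ++ a ∷ b ∷ as) ≈ - ω (ps ++ b ∷ a ∷ as)
      dup  : ∀ ps a as → ω (ps ++ a ∷ a ∷ as) ≈ 0#
  open Alternating

  contract-alternating : ∀ a {ω} → Alternating ω → Alternating (contract a ω)
  contract-alternating a alt = record { swap = λ ps → swap alt (a ∷ ps) ; dup = λ ps → dup alt (a ∷ ps) }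

  unit-alternating : Alternating unit
  unit-alternating = record
    { swap = λ { [] _ _ _ → neg-zero ; (_ ∷ _) _ _ _ → neg-zero }
    ; dup  = λ { [] _ _ → refl ; (_ ∷ _) _ _ → refl } }
    where
    neg-zero : 0# ≈ - 0#
    neg-zero = solve 0 (con (+ 0) := :- con (+ 0)) refl

  ∧-neg : ∀ f ω ψ → ω ≐ (λ as → - ψ as) → (f ∧ ω) ≐ (λ as → - (f ∧ ψ) as)
  ∧-neg f ω ψ e as = begin
    (f ∧ ω) as                      ≈⟨ ∧-cong (λ _ → refl) (λ bs → trans (e bs) (solve 1 (λ x → :- x := (:- con (+ 1)) :* x) refl _)) as ⟩
    (f ∧ (λ bs → (- 1#) * ψ bs)) as ≈⟨ ∧-scaleʳ f (- 1#) ψ as ⟩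
    (- 1#) * (f ∧ ψ) as             ≈⟨ solve 1 (λ x → (:- con (+ 1)) :* x := :- x) refl _ ⟩
    - (f ∧ ψ) as                    ∎

  ∧-alternating : ∀ f {ω} → Alternating ω → Alternating (f ∧ ω)
  ∧-alternating f {ω} alt = record { swap = sw ω alt ; dup = du ω alt }
    where
    sw : ∀ ω → Alternating ω → ∀ ps a b as → (f ∧ ω) (ps ++ a ∷ b ∷ as) ≈ - (f ∧ ω) (ps ++ b ∷ a ∷ as)
    sw ω alt (p ∷ ps) a b as =
      trans (+-cong (*-congˡ (swap alt ps a b as)) (-‿cong (sw (contract p ω) (contract-alternating p alt) ps a b as)))
            (solve 3 (λ x y z → x :* (:- y) :- (:- z) := :- (x :* y :- z)) refl (f p) _ _)
    sw ω alt [] a b as =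
      trans (+-congˡ (-‿cong (+-congˡ (-‿cong (∧-neg f _ _ (λ bs → swap alt [] a b bs) as)))))
            (solve 3 (λ x y z → x :- (y :- (:- z)) := :- (y :- (x :- z))) refl _ _ _)
    du : ∀ ω → Alternating ω → ∀ ps a as → (f ∧ ω) (ps ++ a ∷ a ∷ as) ≈ 0#
    du ω alt (p ∷ ps) a as =
      trans (+-cong (*-congˡ (dup alt ps a as)) (-‿cong (du (contract p ω) (contract-alternating p alt) ps a as)))
            (solve 1 (λ x → x :* con (+ 0) :- con (+ 0) := con (+ 0)) refl (f p))
    du ω alt [] a as =
      trans (+-congˡ (-‿cong (+-congˡ (-‿cong (trans (∧-cong (λ _ → refl) (λ bs → dup alt [] a bs) as) (∧-zeroʳ f as))))))
            (solve 1 (λ x → x :- (x :- con (+ 0)) := con (+ 0)) refl _)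

  wedge-alternating : ∀ fs → Alternating (wedge fs)
  wedge-alternating []       = unit-alternating
  wedge-alternating (f ∷ fs) = ∧-alternating f (wedge-alternating fs)

  alternating-repeat : ∀ {ω} → Alternating ω → ∀ {a as} → a ∈ as → ω (a ∷ as) ≈ 0#
  alternating-repeat alt {a} (here ≡.refl) = dup alt [] a _
  alternating-repeat alt {a} {b ∷ as} (there i) =
    trans (swap alt [] a b as)
      (trans (-‿cong (alternating-repeat (contract-alternating b alt) i)) (solve 0 (:- con (+ 0) := con (+ 0)) refl))

  sign : ℕ → K
  sign zero    = 1#
  sign (suc k) = - sign k

  sign-square : ∀ k → sign k * sign k ≈ 1#
  sign-square zero    = *-identityˡ 1#
  sign-square (suc k) = trans (solve 1 (λ x → (:- x) :* (:- x) := x :* x) refl (sign k)) (sign-square k)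

  -- The last row travels to the front by `length as` adjacent transpositions.
  alternating-∷ʳ : ∀ {ω} → Alternating ω → ∀ as b → ω (as ∷ʳ b) ≈ sign (length as) * ω (b ∷ as)
  alternating-∷ʳ alt []       b = sym (*-identityˡ _)
  alternating-∷ʳ {ω} alt (a ∷ as) b = begin
    ω (a ∷ as ∷ʳ b)                        ≈⟨ alternating-∷ʳ (contract-alternating a alt) as b ⟩
    sign (length as) * ω (a ∷ b ∷ as)      ≈⟨ *-congˡ (swap alt [] a b as) ⟩
    sign (length as) * - ω (b ∷ a ∷ as)    ≈⟨ solve 2 (λ x y → x :* (:- y) := (:- x) :* y) refl _ _ ⟩
    (- sign (length as)) * ω (b ∷ a ∷ as)  ∎

  wedge-∷ʳ : ∀ fs g → wedge (fs ∷ʳ g) ≐ (λ as → sign (length fs) * (g ∧ wedge fs) as)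
  wedge-∷ʳ []       g as = sym (*-identityˡ _)
  wedge-∷ʳ (f ∷ fs) g as = begin
    (f ∧ wedge (fs ∷ʳ g)) as                             ≈⟨ ∧-cong (λ _ → refl) (wedge-∷ʳ fs g) as ⟩
    (f ∧ (λ bs → sign (length fs) * (g ∧ wedge fs) bs)) as ≈⟨ ∧-scaleʳ f _ _ as ⟩
    sign (length fs) * (f ∧ g ∧ wedge fs) as             ≈⟨ *-congˡ (∧-anticomm f g (wedge fs) as) ⟩
    sign (length fs) * - (g ∧ f ∧ wedge fs) as           ≈⟨ solve 2 (λ x y → x :* (:- y) := (:- x) :* y) refl _ _ ⟩
    (- sign (length fs)) * (g ∧ f ∧ wedge fs) as         ∎

  record Linear (Ψ : Λ → K) : Set where
    field
      Ψ-cong : ∀ {ω ψ} → ω ≐ ψ → Ψ ω ≈ Ψ ψ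
      Ψ-comb : ∀ ω c ψ → Ψ (λ as → ω as + c * ψ as) ≈ Ψ ω + c * Ψ ψ

    Ψ-zero : Ψ (λ _ → 0#) ≈ 0#
    Ψ-zero = begin
      Ψ (λ _ → 0#)                                     ≈⟨ Ψ-cong (λ _ → solve 0 (con (+ 0) := con (+ 0) :+ (:- con (+ 1)) :* con (+ 0)) refl) ⟩
      Ψ (λ _ → 0# + (- 1#) * 0#)                       ≈⟨ Ψ-comb _ (- 1#) _ ⟩
      Ψ (λ _ → 0#) + (- 1#) * Ψ (λ _ → 0#)             ≈⟨ solve 1 (λ x → x :+ (:- con (+ 1)) :* x := con (+ 0)) refl _ ⟩
      0#                                               ∎

    Ψ-scale : ∀ c ω → Ψ (λ as → c * ω as) ≈ c * Ψ ω
    Ψ-scale c ω = begin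
      Ψ (λ as → c * ω as)         ≈⟨ Ψ-cong (λ as → sym (+-identityˡ _)) ⟩
      Ψ (λ as → 0# + c * ω as)    ≈⟨ Ψ-comb _ c ω ⟩
      Ψ (λ _ → 0#) + c * Ψ ω      ≈⟨ trans (+-congʳ Ψ-zero) (+-identityˡ _) ⟩
      c * Ψ ω                     ∎
  open Linear

  at : List I → Λ → K
  at as ω = ω as

  ∧-linear : ∀ f {Ψ} → Linear Ψ → Linear (λ ω → Ψ (f ∧ ω))
  ∧-linear f l = record
    { Ψ-cong = λ e → Ψ-cong l (∧-cong (λ _ → refl) e)
    ; Ψ-comb = λ ω c ψ → trans (Ψ-cong l (∧-combʳ f ω c ψ)) (Ψ-comb l _ c _)
    }

  at-linear : ∀ as → Linear (at as)
  at-linear as = record { Ψ-cong = λ e → e as ; Ψ-comb = λ _ _ _ → refl }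

  -- This is cofactor expansion along row a: the entries of that row are multiplied by numbers
  -- independent of a. The functional Ψ is arbitrary because the induction replaces it by ω ↦ Ψ (f ∧
  -- ω).
  contract-Span : ∀ fs {Ψ} → Linear Ψ → X.Span fs (λ a → Ψ (contract a (wedge fs)))
  contract-Span []       l a = Ψ-zero l
  contract-Span (f ∷ fs) {Ψ} l = Ψ (wedge fs) ,
    resp (X.Span-sub fs)
      (λ a → sym (begin
        Ψ (contract a (f ∧ wedge fs)) - Ψ (wedge fs) * f a
          ≈⟨ +-congʳ (trans (Ψ-cong l (λ bs → solve 2 (λ x y → x :- y := x :+ (:- con (+ 1)) :* y) refl _ _)) (Ψ-comb l _ _ _)) ⟩
        (Ψ (λ bs → f a * wedge fs bs) + (- 1#) * Ψ (f ∧ contract a (wedge fs))) - Ψ (wedge fs) * f a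
          ≈⟨ +-congʳ (+-congʳ (Ψ-scale l _ _)) ⟩
        (f a * Ψ (wedge fs) + (- 1#) * Ψ (f ∧ contract a (wedge fs))) - Ψ (wedge fs) * f a
          ≈⟨ solve 3 (λ x y z → (x :* y :+ (:- con (+ 1)) :* z) :- y :* x := (:- con (+ 1)) :* z) refl (f a) (Ψ (wedge fs)) _ ⟩
        (- 1#) * Ψ (f ∧ contract a (wedge fs)) ∎))
      (scale (X.Span-sub fs) (- 1#) (contract-Span fs (∧-linear f l)))
    where open X.IsSubspace

  -- Subtracting from det·f the right combination of the columns fs gives a column vanishing on the rows as:
  -- its entry in row a is the determinant of the matrix bordered by f and a.
  border : X → List X → List I → X
  border f fs as a = (f ∧ wedge fs) (a ∷ as)

  border-Span : ∀ f fs as → X.Span fs (λ a → border f fs as a - wedge fs as * f a)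
  border-Span f fs as =
    resp (X.Span-sub fs)
      (λ a → solve 3 (λ x y z → (:- con (+ 1)) :* z := (x :* y :- z) :- y :* x) refl (f a) (wedge fs as) _)
      (scale (X.Span-sub fs) (- 1#) (contract-Span fs (∧-linear f (at-linear as))))
    where open X.IsSubspace

  border-vanish : ∀ f fs as {a} → a ∈ as → border f fs as a ≈ 0#
  border-vanish f fs as = alternating-repeat (wedge-alternating (f ∷ fs))

  -- The bordered column differs from a multiple of f by a combination of `fs`, which is killed by
  -- `wedge fs`.
  border-∧ : ∀ f fs as → (border f fs as ∧ wedge fs) ≐ (λ bs → wedge fs as * (f ∧ wedge fs) bs)
  border-∧ f fs as bs = begin
    (b ∧ wedge fs) bs
      ≈⟨ ∧-cong (λ a → solve 2 (λ x y → x := (x :- y) :+ con (+ 1) :* y) refl (b a) (w * f a)) (λ _ → refl) bs ⟩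
    ((λ a → (b a - w * f a) + 1# * (w * f a)) ∧ wedge fs) bs
      ≈⟨ ∧-combˡ _ 1# _ (wedge fs) bs ⟩
    ((λ a → b a - w * f a) ∧ wedge fs) bs + 1# * ((λ a → w * f a) ∧ wedge fs) bs
      ≈⟨ +-cong (Span-∧-wedge fs (border-Span f fs as) bs)
                (*-congˡ (trans (∧-cong (λ a → sym (+-identityˡ _)) (λ _ → refl) bs)
                   (trans (∧-combˡ _ w f (wedge fs) bs) (+-congʳ (∧-zeroˡ _ bs))))) ⟩
    0# + 1# * (0# + w * (f ∧ wedge fs) bs)
      ≈⟨ solve 1 (λ x → con (+ 0) :+ con (+ 1) :* (con (+ 0) :+ x) := x) refl _ ⟩
    w * (f ∧ wedge fs) bs ∎
    where
    b : X
    b = border f fs as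
    w : K
    w = wedge fs as

  ∧-vanish : ∀ f ω as → (∀ {a} → a ∈ as → f a ≈ 0#) → (f ∧ ω) as ≈ 0#
  ∧-vanish f ω []       v = refl
  ∧-vanish f ω (a ∷ as) v = begin
    f a * ω as - (f ∧ contract a ω) as ≈⟨ +-cong (*-congʳ (v (here ≡.refl))) (-‿cong (∧-vanish f _ as (v ∘ there))) ⟩
    0# * ω as - 0#                     ≈⟨ solve 1 (λ x → con (+ 0) :* x :- con (+ 0) := con (+ 0)) refl _ ⟩
    0#                                 ∎

  ∧-vanish-∷ : ∀ f ω a as → (∀ {a} → a ∈ as → f a ≈ 0#) → (f ∧ ω) (a ∷ as) ≈ f a * ω as
  ∧-vanish-∷ f ω a as v =
    trans (+-congˡ (-‿cong (∧-vanish f _ as v))) (solve 1 (λ x → x :- con (+ 0) := x) refl _)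

  *-cancelˡ : ∀ w {x y} → ¬ w ≈ 0# → w * x ≈ w * y → x ≈ y
  *-cancelˡ w {x} {y} w≉0 e = begin
    x              ≈⟨ *-identityˡ x ⟨
    1# * x         ≈⟨ *-congʳ (proj₂ (inverse w w≉0)) ⟨
    (i * w) * x    ≈⟨ *-assoc i w x ⟩
    i * (w * x)    ≈⟨ *-congˡ e ⟩
    i * (w * y)    ≈⟨ *-assoc i w y ⟨
    (i * w) * y    ≈⟨ *-congʳ (proj₂ (inverse w w≉0)) ⟩
    1# * y         ≈⟨ *-identityˡ y ⟩
    y              ∎
    where
    i : K
    i = proj₁ (inverse w w≉0)

  -- Replace f and g by their bordered columns, at the cost of one factor `wedge fs as` each. These
  -- columns vanish on the rows `as`, so the determinant splits into a 2 × 2 determinant in the rows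
  -- a, b and the factor `wedge fs as`; one such factor is cancelled from both sides.
  desnanot-jacobi : ∀ f g fs a b as → ¬ wedge fs as ≈ 0# →
    wedge fs as * (f ∧ g ∧ wedge fs) (a ∷ b ∷ as)
      ≈ (f ∧ wedge fs) (a ∷ as) * (g ∧ wedge fs) (b ∷ as) - (f ∧ wedge fs) (b ∷ as) * (g ∧ wedge fs) (a ∷ as)
  desnanot-jacobi f g fs a b as w≉0 = *-cancelˡ w w≉0 (begin
    w * (w * (f ∧ g ∧ ω) (a ∷ b ∷ as))
      ≈⟨ *-congˡ (*-congˡ (∧-anticomm f g ω ab)) ⟩
    w * (w * - (g ∧ f ∧ ω) (a ∷ b ∷ as))
      ≈⟨ solve 2 (λ w x → w :* (w :* (:- x)) := :- (w :* (w :* x))) refl w _ ⟩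
    - (w * (w * (g ∧ f ∧ ω) (a ∷ b ∷ as)))
      ≈⟨ -‿cong (*-congˡ (trans (∧-congʳ g (border-∧ f fs as) ab) (∧-scaleʳ g w (f ∧ ω) ab))) ⟨
    - (w * (g ∧ f̂ ∧ ω) (a ∷ b ∷ as))
      ≈⟨ -‿cong (*-congˡ (∧-anticomm g f̂ ω ab)) ⟩
    - (w * - (f̂ ∧ g ∧ ω) (a ∷ b ∷ as))
      ≈⟨ solve 2 (λ w x → :- (w :* (:- x)) := w :* x) refl w _ ⟩
    w * (f̂ ∧ g ∧ ω) (a ∷ b ∷ as)
      ≈⟨ trans (∧-congʳ f̂ (border-∧ g fs as) ab) (∧-scaleʳ f̂ w (g ∧ ω) ab) ⟨
    (f̂ ∧ ĝ ∧ ω) (a ∷ b ∷ as)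
      ≈⟨ +-cong (*-congˡ (∧-vanish-∷ ĝ ω b as ĝ-vanish))
                (-‿cong (trans (∧-vanish-∷ f̂ (contract a (ĝ ∧ ω)) b as f̂-vanish) (*-congˡ (∧-vanish-∷ ĝ ω a as ĝ-vanish)))) ⟩
    f̂ a * (ĝ b * w) - f̂ b * (ĝ a * w)
      ≈⟨ solve 5 (λ w p q r s → p :* (q :* w) :- r :* (s :* w) := w :* (p :* q :- r :* s)) refl w _ _ _ _ ⟩
    w * (f̂ a * ĝ b - f̂ b * ĝ a) ∎)
    where
    ω : Λ
    ω = wedge fs
    ab : List I
    ab = a ∷ b ∷ as
    w : K
    w = ω as
    f̂ ĝ : X
    f̂ = border f fs as
    ĝ = border g fs as
    f̂-vanish : ∀ {a} → a ∈ as → f̂ a ≈ 0#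
    f̂-vanish = border-vanish f fs as
    ĝ-vanish : ∀ {a} → a ∈ as → ĝ a ≈ 0#
    ĝ-vanish = border-vanish g fs as

  -- The contiguous form of `desnanot-jacobi`: column g and row b are moved to the end. Since `fs`
  -- and `as` have equal length, the two moves cost the same sign, and the signs cancel in pairs.
  dodgson : ∀ f g fs a b as → length fs ≡ length as → ¬ wedge fs as ≈ 0# →
    wedge fs as * wedge (f ∷ fs ∷ʳ g) (a ∷ as ∷ʳ b)
      ≈ wedge (f ∷ fs) (a ∷ as) * wedge (fs ∷ʳ g) (as ∷ʳ b) - wedge (f ∷ fs) (as ∷ʳ b) * wedge (fs ∷ʳ g) (a ∷ as)
  dodgson f g fs a b as l w≉0 = begin
    w * wedge (f ∷ fs ∷ʳ g) (a ∷ as ∷ʳ b)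
      ≈⟨ *-congˡ (trans (∧-congʳ f (wedge-∷ʳ fs g) (a ∷ as ∷ʳ b)) (∧-scaleʳ f s (g ∧ ω) (a ∷ as ∷ʳ b))) ⟩
    w * (s * (f ∧ g ∧ ω) (a ∷ as ∷ʳ b))
      ≈⟨ *-congˡ (*-congˡ (alternating-∷ʳ (contract-alternating a (wedge-alternating (f ∷ g ∷ fs))) as b)) ⟩
    w * (s * (sign (length as) * (f ∧ g ∧ ω) (a ∷ b ∷ as)))
      ≡⟨ ≡.cong (λ k → w * (s * (sign k * (f ∧ g ∧ ω) (a ∷ b ∷ as)))) (≡.sym l) ⟩
    w * (s * (s * (f ∧ g ∧ ω) (a ∷ b ∷ as)))
      ≈⟨ solve 3 (λ w s x → w :* (s :* (s :* x)) := (s :* s) :* (w :* x)) refl w s _ ⟩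
    (s * s) * (w * (f ∧ g ∧ ω) (a ∷ b ∷ as))
      ≈⟨ *-congˡ (desnanot-jacobi f g fs a b as w≉0) ⟩
    (s * s) * ((f ∧ ω) (a ∷ as) * (g ∧ ω) (b ∷ as) - (f ∧ ω) (b ∷ as) * (g ∧ ω) (a ∷ as))
      ≈⟨ solve 5 (λ s p q r t → (s :* s) :* (p :* q :- r :* t) := p :* (s :* (s :* q)) :- (s :* r) :* (s :* t)) refl s _ _ _ _ ⟩
    (f ∧ ω) (a ∷ as) * (s * (s * (g ∧ ω) (b ∷ as))) - (s * (f ∧ ω) (b ∷ as)) * (s * (g ∧ ω) (a ∷ as))
      ≈⟨ +-cong (*-congˡ (trans (wedge-∷ʳ fs g (as ∷ʳ b)) (*-congˡ (last (g ∷ fs)))))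
                (-‿cong (*-cong (last (f ∷ fs)) (wedge-∷ʳ fs g _))) ⟨
    wedge (f ∷ fs) (a ∷ as) * wedge (fs ∷ʳ g) (as ∷ʳ b) - wedge (f ∷ fs) (as ∷ʳ b) * wedge (fs ∷ʳ g) (a ∷ as) ∎
    where
    ω : Λ
    ω = wedge fs
    w s : K
    w = ω as
    s = sign (length fs)
    last : ∀ hs → wedge hs (as ∷ʳ b) ≈ s * wedge hs (b ∷ as)
    last hs = trans (alternating-∷ʳ (wedge-alternating hs) as b) (reflexive (≡.cong (λ k → sign k * wedge hs (b ∷ as)) (≡.sym l)))

  -- Wedges of the sublists of size j. Separating those that contain e from the others is Pascal's
  -- rule, which counts them in `length-basis`.
  basis : List X → ℕ → List Λ
  basis _        zero    = unit ∷ []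
  basis []       (suc j) = []
  basis (e ∷ es) (suc j) = map (e ∧_) (basis es j) ++ basis es (suc j)

  length-basis : ∀ es j → length (basis es j) ≡ length es C j
  length-basis []       zero    = ≡.refl
  length-basis (_ ∷ _)  zero    = ≡.refl
  length-basis []       (suc j) = ≡.refl
  length-basis (e ∷ es) (suc j) =
    ≡.trans (Listₚ.length-++ (map (e ∧_) (basis es j)))
      (≡.trans (≡.cong₂ ℕ._+_ (≡.trans (Listₚ.length-map (e ∧_) (basis es j)) (length-basis es j)) (length-basis es (suc j)))
               (nCk+nC[k+1]≡[n+1]C[k+1] (length es) j))

  basis-wedge : ∀ es j {ω} → ω ∈ basis es j → ∃ λ fs → (∀ {f} → f ∈ fs → f ∈ es) × length fs ≡ j × ω ≡ wedge fs
  basis-wedge []       zero (here ≡.refl) = [] , (λ ()) , ≡.refl , ≡.refl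
  basis-wedge (e ∷ es) zero (here ≡.refl) = [] , (λ ()) , ≡.refl , ≡.refl
  basis-wedge (e ∷ es) (suc j) {ω} i = cases (∈-++⁻ (map (e ∧_) (basis es j)) i)
    where
    W : ℕ → List X → Λ → Set
    W j es ω = ∃ λ fs → (∀ {f} → f ∈ fs → f ∈ es) × length fs ≡ j × ω ≡ wedge fs
    extend : ∀ {ψ} → W j es ψ → W (suc j) (e ∷ es) (e ∧ ψ)
    extend (fs , s , l , ≡.refl) = e ∷ fs , (λ { (here p) → here p ; (there p) → there (s p) }) , ≡.cong suc l , ≡.refl
    cases : ω ∈ map (e ∧_) (basis es j) ⊎ ω ∈ basis es (suc j) → W (suc j) (e ∷ es) ω
    cases (inj₁ p) = let (ψ , q , eq) = ∈-map⁻ (e ∧_) p in ≡.subst (W (suc j) (e ∷ es)) (≡.sym eq) (extend (basis-wedge es j q))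
    cases (inj₂ p) = let (fs , s , l , eq) = basis-wedge es (suc j) p in fs , (λ q → there (s q)) , l , eq

  -- Only the order of the factors can be wrong. If ω begins with e and f comes later in the list, f
  -- is moved past e at the cost of a sign; if f is e itself, the square vanishes.
  ∈-∧-basis : ∀ es j {f ω} → f ∈ es → ω ∈ basis es j → Λ.Span (basis es (suc j)) (f ∧ ω)
  ∈-∧-basis (e ∷ es) zero (here ≡.refl) (here ≡.refl) = Λ.∈Span {basis (e ∷ es) 1} (here ≡.refl)
  ∈-∧-basis (e ∷ es) zero (there i) (here ≡.refl) =
    Λ.⊆Adjoin (e ∧ unit) (Λ.Span-sub (basis es 1)) (∈-∧-basis es zero i (here ≡.refl))
  ∈-∧-basis (e ∷ es) (suc j) {f} {ω} i p = cases i (∈-++⁻ (map (e ∧_) (basis es j)) p)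
    where
    open Λ.IsSubspace
    S : Λ → Set
    S = Λ.Span (basis (e ∷ es) (suc (suc j)))
    S-sub : Λ.IsSubspace S
    S-sub = Λ.Span-sub (basis (e ∷ es) (suc (suc j)))
    later : Λ.Span (basis es (suc (suc j))) Λ.⊆ S
    later = Λ.Span-min (basis es (suc (suc j))) S-sub (λ q → Λ.∈Span (∈-++⁺ʳ (map (e ∧_) (basis es (suc j))) q))
    e∧ : Λ.Span (basis es (suc j)) Λ.⊆ (λ ψ → S (e ∧ ψ))
    e∧ = Λ.Span-min (basis es (suc j)) (∧-subspace e S-sub) (λ q → Λ.∈Span (∈-++⁺ˡ (∈-map⁺ (e ∧_) q)))
    moved : ∀ {ψ} → ψ ∈ basis es j → f ∈ es → S (f ∧ e ∧ ψ)
    moved {ψ} q i = resp S-sub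
      (λ as → trans (solve 1 (λ x → (:- con (+ 1)) :* x := :- x) refl _) (sym (∧-anticomm f e ψ as)))
      (scale S-sub (- 1#) (e∧ (∈-∧-basis es j i q)))
    cases : f ∈ e ∷ es → ω ∈ map (e ∧_) (basis es j) ⊎ ω ∈ basis es (suc j) → S (f ∧ ω)
    cases (here ≡.refl) (inj₁ p) = let (ψ , q , eq) = ∈-map⁻ (e ∧_) p in
      ≡.subst (λ χ → S (e ∧ χ)) (≡.sym eq) (Λ.Null⊆ S-sub (∧-square e ψ))
    cases (here ≡.refl) (inj₂ p) = e∧ (Λ.∈Span p)
    cases (there i) (inj₁ p) = let (ψ , q , eq) = ∈-map⁻ (e ∧_) p in
      ≡.subst (λ χ → S (f ∧ χ)) (≡.sym eq) (moved q i)
    cases (there i) (inj₂ p) = later (∈-∧-basis es (suc j) i p)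

  wedge-Span : ∀ es fs → (∀ {f} → f ∈ fs → X.Span es f) → Λ.Span (basis es (length fs)) (wedge fs)
  wedge-Span es []       s = Λ.∈Span {unit ∷ []} (here ≡.refl)
  wedge-Span es (f ∷ fs) s =
    Λ.Span-min (basis es (length fs)) (∧-subspace f S-sub)
      (λ {ω} p → X.Span-min es (∧-subspaceˡ ω S-sub) (λ i → ∈-∧-basis es (length fs) i p) (s (here ≡.refl)))
      (wedge-Span es fs (s ∘ there))
    where
    S-sub : Λ.IsSubspace (Λ.Span (basis es (suc (length fs))))
    S-sub = Λ.Span-sub (basis es (suc (length fs)))

-- T-systems on a strip

consec : ℕ → ℤ → List ℤ
consec zero    a = []
consec (suc j) a = a ∷ consec j (ℤ.suc a)

length-consec : ∀ j a → length (consec j a) ≡ j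
length-consec zero    a = ≡.refl
length-consec (suc j) a = ≡.cong suc (length-consec j (ℤ.suc a))

consec-∷ʳ : ∀ j a → consec (suc j) a ≡ consec j a ∷ʳ (+ j ℤ.+ a)
consec-∷ʳ zero    a = ≡.cong (_∷ []) (≡.sym (ℤₚ.+-identityˡ a))
consec-∷ʳ (suc j) a = ≡.cong (a ∷_) (≡.trans (consec-∷ʳ j (ℤ.suc a))
  (≡.cong (consec j (ℤ.suc a) ∷ʳ_)
    (≡.trans (≡.sym (ℤₚ.+-assoc (+ j) (+ 1) a)) (≡.cong (λ k → + k ℤ.+ a) (ℕₚ.+-comm j 1)))))

consec-+ : ∀ j a p → map (ℤ._+ p) (consec j a) ≡ consec j (a ℤ.+ p)
consec-+ zero    a p = ≡.refl
consec-+ (suc j) a p = ≡.cong (a ℤ.+ p ∷_)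
  (≡.trans (consec-+ j (ℤ.suc a) p) (≡.cong (consec j) (ℤₚ.+-assoc (+ 1) a p)))

ℤ-induction : ∀ {P : ℤ → Set} → P (+ 0) → (∀ z → P z → P (ℤ.suc z)) → (∀ z → P (ℤ.suc z) → P z) → ∀ z → P z
ℤ-induction b u d (+ zero)       = b
ℤ-induction b u d (+ suc n)      = u (+ n) (ℤ-induction b u d (+ n))
ℤ-induction b u d -[1+ zero ]    = d -[1+ 0 ] b
ℤ-induction b u d -[1+ suc n ]   = d -[1+ suc n ] (ℤ-induction b u d -[1+ n ])

-- Carries a polynomial relation along a reparametrisation compatible with the two shifts. It serves
-- twice: between a list of consecutive rows and its first row, and between rows and time.
module Simulation (𝕂 : DiscreteField) {A B : Set} (σ : A → A) (τ : B → B)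
  (_~_ : A → B → Set) (~-step : ∀ {a b} → a ~ b → σ a ~ τ b) where
  open DiscreteField 𝕂
  private
    module A = AnnihilatingPolynomial 𝕂 σ
    module B = AnnihilatingPolynomial 𝕂 τ

  eval-~ : ∀ cs {g h} → (∀ {a b} → a ~ b → g a ≈ h b) → ∀ {a b} → a ~ b → A.eval cs g a ≈ B.eval cs h b
  eval-~ []       e r = e r
  eval-~ (c ∷ cs) e r = +-cong (eval-~ cs (λ r → e (~-step r)) r) (*-congˡ (e r))

module TSystem (𝕂 : DiscreteField) where
  open DiscreteField 𝕂 renaming (Carrier to K) hiding (zero)

  -- `step` is stated for the levels 1, ..., m, which the two boundary levels enclose. The period is
  -- a property of the matrix `T 1`, from which the minors inherit it.
  record IsTSystem (m : ℕ) (p : ℤ) (T : ℕ → ℤ → ℤ → K) : Set where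
    field
      bottom : ∀ α β → T 0 α β ≈ 1#
      top    : ∀ α β → T (suc m) α β ≈ 1#
      step   : ∀ j α β → j < m →
               T (suc j) α β * T (suc j) (ℤ.suc α) (ℤ.suc β)
                 ≈ T (suc j) (ℤ.suc α) β * T (suc j) α (ℤ.suc β) + T (suc (suc j)) α β * T j (ℤ.suc α) (ℤ.suc β)
      nonzero : ∀ j α β → j ≤ suc m → ¬ T j α β ≈ 0#
      period  : ∀ α β → T 1 (α ℤ.+ p) β ≈ T 1 α (β ℤ.+ p)

  module _ {m p T} (isT : IsTSystem m p T) where
    open IsTSystem isT
    open IntegerCoefficients commutativeRing
    open Exterior 𝕂 ℤ
    open import Relation.Binary.Reasoning.Setoid setoid

    N : ℕ
    N = suc m

    col : ℤ → ℤ → K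
    col β α = T 1 α β

    cols : ℕ → ℤ → List (ℤ → K)
    cols j β = map col (consec j β)

    minor : ℕ → ℤ → ℤ → K
    minor j α β = wedge (cols j β) (consec j α)

    minor-dodgson : ∀ j α β → ¬ minor j (ℤ.suc α) (ℤ.suc β) ≈ 0# →
      minor j (ℤ.suc α) (ℤ.suc β) * minor (suc (suc j)) α β
        ≈ minor (suc j) α β * minor (suc j) (ℤ.suc α) (ℤ.suc β)
          - minor (suc j) (ℤ.suc α) β * minor (suc j) α (ℤ.suc β)
    minor-dodgson j α β nz = ≡.subst₂ Goal (≡.sym (≡.trans (≡.cong (map col) (consec-∷ʳ j (ℤ.suc β))) (Listₚ.map-++ col (consec j (ℤ.suc β)) _)))
                                           (≡.sym (consec-∷ʳ j (ℤ.suc α)))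
        (dodgson (col β) (col (+ j ℤ.+ ℤ.suc β)) (cols j (ℤ.suc β)) α (+ j ℤ.+ ℤ.suc α) (consec j (ℤ.suc α))
          (≡.trans (≡.trans (Listₚ.length-map col (consec j (ℤ.suc β))) (length-consec j (ℤ.suc β))) (≡.sym (length-consec j (ℤ.suc α)))) nz)
      where
      Goal : List (ℤ → K) → List ℤ → Set
      Goal fs as = minor j (ℤ.suc α) (ℤ.suc β) * wedge (col β ∷ fs) (α ∷ as)
        ≈ minor (suc j) α β * wedge fs as - wedge (cols (suc j) β) as * wedge fs (consec (suc j) α)

    -- Dodgson's identity and the T-system are the same recursion: both determine level j + 2 from
    -- the two levels below after division by level j at (α + 1, β + 1).
    minor≈T-step : ∀ j → j < m → (∀ α β → minor j α β ≈ T j α β) → (∀ α β → minor (suc j) α β ≈ T (suc j) α β) →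
      ∀ α β → minor (suc (suc j)) α β ≈ T (suc (suc j)) α β
    minor≈T-step j j<m IH₀ IH α β = *-cancelˡ c nz (begin
      c * minor (suc (suc j)) α β
        ≈⟨ minor-dodgson j α β nz ⟩
      minor (suc j) α β * minor (suc j) (ℤ.suc α) (ℤ.suc β) - minor (suc j) (ℤ.suc α) β * minor (suc j) α (ℤ.suc β)
        ≈⟨ +-cong (trans (*-cong (IH _ _) (IH _ _)) (step j α β j<m)) (-‿cong (*-cong (IH _ _) (IH _ _))) ⟩
      (T (suc j) (ℤ.suc α) β * T (suc j) α (ℤ.suc β) + T (suc (suc j)) α β * T j (ℤ.suc α) (ℤ.suc β))
        - T (suc j) (ℤ.suc α) β * T (suc j) α (ℤ.suc β)
        ≈⟨ solve 3 (λ x y z → (x :+ y :* z) :- x := z :* y) refl _ _ _ ⟩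
      T j (ℤ.suc α) (ℤ.suc β) * T (suc (suc j)) α β
        ≈⟨ *-congʳ (IH₀ _ _) ⟨
      c * T (suc (suc j)) α β ∎)
      where
      c : K
      c = minor j (ℤ.suc α) (ℤ.suc β)
      nz : ¬ c ≈ 0#
      nz e = nonzero j _ _ (ℕₚ.≤-trans (ℕₚ.n≤1+n j) (ℕₚ.m≤n⇒m≤1+n j<m)) (trans (sym (IH₀ _ _)) e)

    minor≈T : ∀ j → j ≤ N → ∀ α β → minor j α β ≈ T j α β
    minor≈T zero          _ α β = sym (bottom α β)
    minor≈T (suc zero)    _ α β = solve 1 (λ x → x :* con (+ 1) :- con (+ 0) := x) refl (T 1 α β)
    minor≈T (suc (suc j)) (s≤s j<m) = minor≈T-step j j<m
      (minor≈T j (ℕₚ.≤-trans (ℕₚ.n≤1+n j) (ℕₚ.m≤n⇒m≤1+n j<m)))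
      (minor≈T (suc j) (ℕₚ.m≤n⇒m≤1+n j<m))

    minor-N : ∀ α β → minor N α β ≈ 1#
    minor-N α β = trans (minor≈T N ℕₚ.≤-refl α β) (top α β)

    -- With all minors of size N equal to 1, Dodgson's identity reads minor m · minor (N + 1) = 1 -
    -- 1, and the first factor is a nonzero T-value.
    minor-sucN : ∀ α β → minor (suc N) α β ≈ 0#
    minor-sucN α β = *-cancelˡ (minor m (ℤ.suc α) (ℤ.suc β)) nz (begin
      minor m (ℤ.suc α) (ℤ.suc β) * minor (suc N) α β ≈⟨ minor-dodgson m α β nz ⟩
      minor N α β * minor N (ℤ.suc α) (ℤ.suc β) - minor N (ℤ.suc α) β * minor N α (ℤ.suc β)
        ≈⟨ +-cong (*-cong (minor-N _ _) (minor-N _ _)) (-‿cong (*-cong (minor-N _ _) (minor-N _ _))) ⟩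
      1# * 1# - 1# * 1#
        ≈⟨ solve 1 (λ x → con (+ 1) :* con (+ 1) :- con (+ 1) :* con (+ 1) := x :* con (+ 0)) refl _ ⟩
      minor m (ℤ.suc α) (ℤ.suc β) * 0# ∎)
      where
      nz : ¬ minor m (ℤ.suc α) (ℤ.suc β) ≈ 0#
      nz e = nonzero m _ _ (ℕₚ.n≤1+n m) (trans (sym (minor≈T m (ℕₚ.n≤1+n m) _ _)) e)

    -- The part of g left after elimination against the window of columns at β does not depend on the
    -- window of rows used for the elimination, so it vanishes in every row.
    window-extend : ∀ β g → (∀ α → (g ∧ wedge (cols N β)) (consec (suc N) α) ≈ 0#) → X.Span (cols N β) g
    window-extend β g dep = resp S-sub
      (λ y → begin
        0# + (- 1#) * (ĝ (+ 0) y - wedge es (consec N (+ 0)) * g y)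
          ≈⟨ +-congˡ (*-congˡ (+-cong (ĝ-vanish (+ 0) y) (-‿cong (*-congʳ (minor-N (+ 0) β))))) ⟩
        0# + (- 1#) * (0# - 1# * g y)
          ≈⟨ solve 1 (λ x → con (+ 0) :+ (:- con (+ 1)) :* (con (+ 0) :- con (+ 1) :* x) := x) refl (g y) ⟩
        g y ∎)
      (comb S-sub (- 1#) (null S-sub) (border-Span g es (consec N (+ 0))))
      where
      open X.IsSubspace
      es : List (ℤ → K)
      es = cols N β
      S-sub : X.IsSubspace (X.Span es)
      S-sub = X.Span-sub es
      ĝ : ℤ → ℤ → K
      ĝ x = border g es (consec N x)
      δ : ℤ → ℤ → K
      δ x y = ĝ x y - ĝ (ℤ.suc x) y
      δ-Span : ∀ x → X.Span es (δ x)
      δ-Span x = resp S-sub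
        (λ y → begin
          (ĝ x y - wedge es (consec N x) * g y) - (ĝ (ℤ.suc x) y - wedge es (consec N (ℤ.suc x)) * g y)
            ≈⟨ +-cong (+-congˡ (-‿cong (*-congʳ (minor-N x β)))) (-‿cong (+-congˡ (-‿cong (*-congʳ (minor-N (ℤ.suc x) β))))) ⟩
          (ĝ x y - 1# * g y) - (ĝ (ℤ.suc x) y - 1# * g y)
            ≈⟨ solve 3 (λ p q z → (p :- z) :- (q :- z) := p :- q) refl _ _ (1# * g y) ⟩
          δ x y ∎)
        (minus S-sub (border-Span g es (consec N x)) (border-Span g es (consec N (ℤ.suc x))))
      -- The rows x + 1, ..., x + N - 1 also belong to the next window. Row x does not; there the
      -- entry is a determinant on N + 1 consecutive rows, zero by `dep`.
      ĝ-next : ∀ x {a} → a ∈ consec N x → ĝ (ℤ.suc x) a ≈ 0#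
      ĝ-next x (here ≡.refl) = dep x
      ĝ-next x {a} (there i) = border-vanish g es (consec N (ℤ.suc x))
        (≡.subst (a ∈_) (≡.sym (consec-∷ʳ m (ℤ.suc x))) (∈-++⁺ˡ i))
      δ-vanish : ∀ x {a} → a ∈ consec N x → δ x a ≈ 0#
      δ-vanish x i = trans (+-cong (border-vanish g es (consec N x) i) (-‿cong (ĝ-next x i))) (-‿inverseʳ 0#)
      -- A combination of the columns `es` that vanishes in N consecutive rows is zero, because the
      -- minor in these rows is 1.
      δ≈0 : ∀ x y → δ x y ≈ 0#
      δ≈0 x y = begin
        δ x y                              ≈⟨ trans (*-congˡ (minor-N x β)) (*-identityʳ _) ⟨
        δ x y * wedge es (consec N x)      ≈⟨ ∧-vanish-∷ (δ x) (wedge es) y (consec N x) (δ-vanish x) ⟨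
        (δ x ∧ wedge es) (y ∷ consec N x)  ≈⟨ Span-∧-wedge es (δ-Span x) (y ∷ consec N x) ⟩
        0#                                 ∎
      ĝ-const : ∀ x y → ĝ x y ≈ ĝ (ℤ.suc x) y
      ĝ-const x y = begin
        ĝ x y                    ≈⟨ solve 2 (λ p q → p := (p :- q) :+ q) refl (ĝ x y) (ĝ (ℤ.suc x) y) ⟩
        δ x y + ĝ (ℤ.suc x) y    ≈⟨ trans (+-congʳ (δ≈0 x y)) (+-identityˡ _) ⟩
        ĝ (ℤ.suc x) y            ∎
      ĝ-base : ∀ x y → ĝ x y ≈ ĝ (+ 0) y
      ĝ-base x y = ℤ-induction {λ x → ĝ x y ≈ ĝ (+ 0) y} refl
        (λ z e → trans (sym (ĝ-const z y)) e) (λ z e → trans (ĝ-const z y) e) x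
      -- The window of rows can now be moved freely. Starting it at row y itself makes y a repeated
      -- row of the bordered determinant.
      ĝ-vanish : ∀ x y → ĝ x y ≈ 0#
      ĝ-vanish x y = begin
        ĝ x y      ≈⟨ ĝ-base x y ⟩
        ĝ (+ 0) y  ≈⟨ ĝ-base y y ⟨
        ĝ y y      ≈⟨ border-vanish g es (consec N y) (here ≡.refl) ⟩
        0#         ∎

    col∈next-window : ∀ β → X.Span (cols N (ℤ.suc β)) (col β)
    col∈next-window β = window-extend (ℤ.suc β) (col β) (λ α → minor-sucN α β)

    -- Here the new column is the last of N + 1. `window-extend` expects it in front, so the square
    -- of the sign of this move is inserted.
    col∈previous-window : ∀ β → X.Span (cols N β) (col (+ N ℤ.+ β))
    col∈previous-window β = window-extend β g (λ α → begin
      (g ∧ ω) (rows α)                       ≈⟨ *-identityˡ _ ⟨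
      1# * (g ∧ ω) (rows α)                  ≈⟨ *-congʳ (sign-square (length (cols N β))) ⟨
      (s * s) * (g ∧ ω) (rows α)             ≈⟨ *-assoc s s _ ⟩
      s * (s * (g ∧ ω) (rows α))             ≈⟨ *-congˡ (wedge-∷ʳ (cols N β) g (rows α)) ⟨
      s * wedge (cols N β ∷ʳ g) (rows α)     ≡⟨ ≡.cong (λ fs → s * wedge fs (rows α)) (Listₚ.map-++ col (consec N β) _) ⟨
      s * wedge (map col (consec N β ∷ʳ (+ N ℤ.+ β))) (rows α)
                                             ≡⟨ ≡.cong (λ bs → s * wedge (map col bs) (rows α)) (consec-∷ʳ N β) ⟨
      s * minor (suc N) α β                  ≈⟨ *-congˡ (minor-sucN α β) ⟩
      s * 0#                                 ≈⟨ zeroʳ s ⟩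
      0#                                     ∎)
      where
      g : ℤ → K
      g = col (+ N ℤ.+ β)
      ω : List ℤ → K
      ω = wedge (cols N β)
      s : K
      s = sign (length (cols N β))
      rows : ℤ → List ℤ
      rows = consec (suc N)

    window-min : ∀ β {W} → X.IsSubspace W → (∀ {b} → b ∈ consec N β → W (col b)) → X.Span (cols N β) X.⊆ W
    window-min β {W} s w = X.Span-min (cols N β) s (λ i → let (b , j , eq) = ∈-map⁻ col i in ≡.subst W (≡.sym eq) (w j))

    ∈window : ∀ β {b} → b ∈ consec N β → X.Span (cols N β) (col b)
    ∈window β i = X.∈Span {cols N β} (∈-map⁺ col i)

    window-up : ∀ β → X.Span (cols N (ℤ.suc β)) X.⊆ X.Span (cols N β)
    window-up β = window-min (ℤ.suc β) (X.Span-sub (cols N β))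
      (λ {b} i → cases (∈-++⁻ (consec N β) (≡.subst (b ∈_) (consec-∷ʳ N β) (there i))))
      where
      cases : ∀ {b} → b ∈ consec N β ⊎ b ∈ (+ N ℤ.+ β) ∷ [] → X.Span (cols N β) (col b)
      cases (inj₁ i)             = ∈window β i
      cases (inj₂ (here ≡.refl)) = col∈previous-window β

    window-down : ∀ β → X.Span (cols N β) X.⊆ X.Span (cols N (ℤ.suc β))
    window-down β = window-min β (X.Span-sub (cols N (ℤ.suc β))) cases
      where
      cases : ∀ {b} → b ∈ consec N β → X.Span (cols N (ℤ.suc β)) (col b)
      cases (here ≡.refl) = col∈next-window β
      cases {b} (there i) = ∈window (ℤ.suc β) (≡.subst (b ∈_) (≡.sym (consec-∷ʳ m (ℤ.suc β))) (∈-++⁺ˡ i))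

    es₀ : List (ℤ → K)
    es₀ = cols N (+ 0)

    -- Neighbouring windows span the same space, so membership can be carried step by step from β to
    -- the reference window at 0.
    window⊆ : ∀ β → X.Span (cols N β) X.⊆ X.Span es₀
    window⊆ β {h} = ℤ-induction {λ β → X.Span (cols N β) h → X.Span es₀ h} (λ z → z)
      (λ z k s → k (window-up z s)) (λ z k s → k (window-down z s)) β

    col∈ : ∀ β → X.Span es₀ (col β)
    col∈ β = window⊆ β (∈window β (here ≡.refl))

    module Rows = AnnihilatingPolynomial 𝕂 {List ℤ} (map (ℤ._+ p))
    module Row = AnnihilatingPolynomial 𝕂 {ℤ} (ℤ._+ p)

    ∧-shift : ∀ f ω → Rows.shift (f ∧ ω) Λ.≐ (Row.shift f ∧ Rows.shift ω)
    ∧-shift f ω []       = refl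
    ∧-shift f ω (a ∷ as) = +-congˡ (-‿cong (∧-shift f (contract (a ℤ.+ p) ω) as))

    wedge-shift : ∀ fs → Rows.shift (wedge fs) Λ.≐ wedge (map Row.shift fs)
    wedge-shift []       []      = refl
    wedge-shift []       (_ ∷ _) = refl
    wedge-shift (f ∷ fs) as      = trans (∧-shift f (wedge fs) as) (∧-congʳ (Row.shift f) (wedge-shift fs) as)

    -- Periodicity turns the row shift of column b into column b + p, which lies in the span like
    -- every other column.
    shift∈ : ∀ {f} → f ∈ es₀ → X.Span es₀ (Row.shift f)
    shift∈ i = let (b , _ , eq) = ∈-map⁻ col i in
      ≡.subst (λ f → X.Span es₀ (Row.shift f)) (≡.sym eq)
        (X.IsSubspace.resp (X.Span-sub es₀) (λ a → sym (period a b)) (col∈ (b ℤ.+ p)))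

    basis-stable : ∀ j → Rows.Stable (Λ.Span (basis es₀ j))
    basis-stable j = Λ.Span-min (basis es₀ j) sub stable
      where
      open Λ.IsSubspace
      S-sub : Λ.IsSubspace (Λ.Span (basis es₀ j))
      S-sub = Λ.Span-sub (basis es₀ j)
      sub : Λ.IsSubspace (λ ω → Λ.Span (basis es₀ j) (Rows.shift ω))
      sub = record
        { resp = λ e → resp S-sub (λ as → e (map (ℤ._+ p) as))
        ; null = null S-sub
        ; comb = comb S-sub
        }
      stable : ∀ {ω} → ω ∈ basis es₀ j → Λ.Span (basis es₀ j) (Rows.shift ω)
      stable i with basis-wedge es₀ j i
      ... | fs , fs⊆ , ≡.refl , ≡.refl = resp S-sub (λ as → sym (wedge-shift fs as))
        (≡.subst (λ j → Λ.Span (basis es₀ j) (wedge (map Row.shift fs))) (Listₚ.length-map Row.shift fs)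
          (wedge-Span es₀ (map Row.shift fs)
            (λ i → let (f , k , eq) = ∈-map⁻ Row.shift i in ≡.subst (X.Span es₀) (≡.sym eq) (shift∈ (fs⊆ k)))))

    -- The polynomial kills the whole span of `basis es₀ j`, so a single list of coefficients serves
    -- all α and β. Shifting all of j consecutive rows amounts to shifting the first, which gives a
    -- recurrence in α.
    recurrence : ∀ j → j ≤ N →
      ∃ λ cs → length cs ≡ N C j × (∀ α β → Row.eval cs (λ α → T j α β) α ≈ 0#)
    recurrence j j≤N = proj₁ ann , proj₁ (proj₂ ann) , λ α β → begin
        Row.eval (proj₁ ann) (λ α → T j α β) α
          ≈⟨ Row.eval-cong (proj₁ ann) (λ α → minor≈T j j≤N α β) α ⟨
        Row.eval (proj₁ ann) (λ α → minor j α β) α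
          ≈⟨ Simulation.eval-~ 𝕂 (ℤ._+ p) (map (ℤ._+ p)) (λ α as → as ≡ consec j α)
               (λ { {α} ≡.refl → consec-+ j α p }) (proj₁ ann) (λ { ≡.refl → refl }) ≡.refl ⟩
        Rows.eval (proj₁ ann) (wedge (cols j β)) (consec j α)
          ≈⟨ proj₂ (proj₂ ann) (wedge∈ β) (consec j α) ⟩
        0# ∎
      where
      wedge∈ : ∀ β → Λ.Span (basis es₀ j) (wedge (cols j β))
      wedge∈ β = ≡.subst (λ i → Λ.Span (basis es₀ i) (wedge (cols j β)))
        (≡.trans (Listₚ.length-map col (consec j β)) (length-consec j β))
        (wedge-Span es₀ (cols j β) (λ i → let (b , _ , eq) = ∈-map⁻ col i in ≡.subst (X.Span es₀) (≡.sym eq) (col∈ b)))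
      ann : Rows.Annihilator (N C j) (Λ.Span (basis es₀ j)) Λ.Null
      ann = Rows.annihilate (N C j) (basis es₀ j)
        (≡.trans (length-basis es₀ j) (≡.cong (_C j) (≡.trans (Listₚ.length-map col (consec N (+ 0))) (length-consec N (+ 0)))))
        Λ.Null-sub (λ n as → n (map (ℤ._+ p) as)) (basis-stable j)

open ≡ using (refl; sym; trans; cong; cong₂; subst; module ≡-Reasoning)

-- Polynomials and fractions

module Polynomials {N : ℕ} where
  open ≡-Reasoning

  _≟M_ : (e f : Mono N) → Dec (e ≡ f)
  _≟M_ = Vecₚ.≡-dec ℕ._≟_

  infixl 6 _⊕_
  _⊕_ : ∀ {n} → Vec ℕ n → Vec ℕ n → Vec ℕ n
  _⊕_ = zipWith ℕ._+_

  ⊕-comm : ∀ (e f : Mono N) → e ⊕ f ≡ f ⊕ e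
  ⊕-comm = Vecₚ.zipWith-comm ℕₚ.+-comm

  ⊕-assoc : ∀ (e f g : Mono N) → (e ⊕ f) ⊕ g ≡ e ⊕ (f ⊕ g)
  ⊕-assoc = Vecₚ.zipWith-assoc ℕₚ.+-assoc

  ⊕-identityˡ : ∀ (e : Mono N) → Vec.replicate N 0 ⊕ e ≡ e
  ⊕-identityˡ = Vecₚ.zipWith-identityˡ ℕₚ.+-identityˡ

  ⊕-∸ : ∀ {n} (e f : Vec ℕ n) → zipWith ℕ._∸_ (e ⊕ f) e ≡ f
  ⊕-∸ []      []      = refl
  ⊕-∸ (a ∷ e) (b ∷ f) = cong₂ _∷_ (ℕₚ.m+n∸m≡n a b) (⊕-∸ e f)

  ⊕-cancelˡ : ∀ (e : Mono N) {f g} → e ⊕ f ≡ e ⊕ g → f ≡ g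
  ⊕-cancelˡ e {f} {g} eq = trans (sym (⊕-∸ e f)) (trans (cong (λ h → zipWith ℕ._∸_ h e) eq) (⊕-∸ e g))

  δ : Mono N → Mono N → ℤ
  δ g f = if does (f ≟M g) then 1ℤ else 0ℤ

  δ-yes : ∀ g f → f ≡ g → δ g f ≡ 1ℤ
  δ-yes g f eq with f ≟M g
  ... | yes _ = refl
  ... | no ne = ⊥-elim (ne eq)

  δ-no : ∀ g f → ¬ f ≡ g → δ g f ≡ 0ℤ
  δ-no g f ne with f ≟M g
  ... | yes eq = ⊥-elim (ne eq)
  ... | no _   = refl

  -- Linear extension of φ from monomials to lists of terms; `coeff` is the case φ = `δ g`. Ring
  -- identities are proved for every φ, where they are manipulations of finite sums without any
  -- comparison of exponents.
  pair : (Mono N → ℤ) → Poly N → ℤ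
  pair φ []            = 0ℤ
  pair φ ((c , e) ∷ p) = c ℤ.* φ e ℤ.+ pair φ p

  coeff-pair : ∀ p g → coeff p g ≡ pair (δ g) p
  coeff-pair []            g = refl
  coeff-pair ((c , f) ∷ p) g with f ≟M g
  ... | yes _ = cong₂ ℤ._+_ (sym (ℤₚ.*-identityʳ c)) (coeff-pair p g)
  ... | no _  = trans (coeff-pair p g) (sym (trans (cong (ℤ._+ _) (ℤₚ.*-zeroʳ c)) (ℤₚ.+-identityˡ _)))

  pair-cong : ∀ {φ ψ} → (∀ e → φ e ≡ ψ e) → ∀ p → pair φ p ≡ pair ψ p
  pair-cong e []            = refl
  pair-cong e ((c , f) ∷ p) = cong₂ ℤ._+_ (cong (c ℤ.*_) (e f)) (pair-cong e p)

  pair-zero : ∀ φ p → All (λ t → φ (proj₂ t) ≡ 0ℤ) p → pair φ p ≡ 0ℤ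
  pair-zero φ []            []       = refl
  pair-zero φ ((c , f) ∷ p) (z ∷ zs) = cong₂ ℤ._+_ (trans (cong (c ℤ.*_) z) (ℤₚ.*-zeroʳ c)) (pair-zero φ p zs)

  pair-0 : ∀ p → pair (λ _ → 0ℤ) p ≡ 0ℤ
  pair-0 []            = refl
  pair-0 ((c , f) ∷ p) = cong₂ ℤ._+_ (ℤₚ.*-zeroʳ c) (pair-0 p)

  pair-++ : ∀ φ p q → pair φ (p ++ q) ≡ pair φ p ℤ.+ pair φ q
  pair-++ φ []            q = sym (ℤₚ.+-identityˡ _)
  pair-++ φ ((c , f) ∷ p) q = trans (cong (ℤ._+_ (c ℤ.* φ f)) (pair-++ φ p q)) (sym (ℤₚ.+-assoc (c ℤ.* φ f) _ _))

  pair-comb : ∀ φ c ψ p → pair (λ e → c ℤ.* φ e ℤ.+ ψ e) p ≡ c ℤ.* pair φ p ℤ.+ pair ψ p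
  pair-comb φ c ψ []            = sym (trans (ℤₚ.+-identityʳ _) (ℤₚ.*-zeroʳ c))
  pair-comb φ c ψ ((d , f) ∷ p) = trans (cong (ℤ._+_ (d ℤ.* (c ℤ.* φ f ℤ.+ ψ f))) (pair-comb φ c ψ p))
    (solve 6 (λ d c u v x y → d :* (c :* u :+ v) :+ (c :* x :+ y) := c :* (d :* u :+ x) :+ (d :* v :+ y)) refl
      d c (φ f) (ψ f) (pair φ p) (pair ψ p))
    where open ℤSolver.+-*-Solver

  pair-swap : ∀ (φ : Mono N → Mono N → ℤ) p q →
    pair (λ e → pair (φ e) q) p ≡ pair (λ f → pair (λ e → φ e f) p) q
  pair-swap φ []            q = sym (pair-0 q)
  pair-swap φ ((c , e) ∷ p) q = trans (cong (ℤ._+_ (c ℤ.* pair (φ e) q)) (pair-swap φ p q))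
    (sym (pair-comb (φ e) c (λ f → pair (λ e → φ e f) p) q))

  pair-monomial : ∀ φ c e q →
    pair φ (map (λ { (d , f) → (c ℤ.* d , zipWith ℕ._+_ e f) }) q) ≡ c ℤ.* pair (λ f → φ (e ⊕ f)) q
  pair-monomial φ c e []            = sym (ℤₚ.*-zeroʳ c)
  pair-monomial φ c e ((d , f) ∷ q) = trans (cong (ℤ._+_ ((c ℤ.* d) ℤ.* φ (e ⊕ f))) (pair-monomial φ c e q))
    (trans (cong (ℤ._+ _) (ℤₚ.*-assoc c d _)) (sym (ℤₚ.*-distribˡ-+ c _ _)))

  pair-* : ∀ φ p q → pair φ (p *P q) ≡ pair (λ e → pair (λ f → φ (e ⊕ f)) q) p
  pair-* φ []            q = refl
  pair-* φ ((c , e) ∷ p) q =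
    trans (pair-++ φ (map (λ { (d , f) → (c ℤ.* d , zipWith ℕ._+_ e f) }) q) (p *P q))
      (cong₂ ℤ._+_ (pair-monomial φ c e q) (pair-* φ p q))

  infix 4 _≋_
  -- A wrapper around `_≈P_`: from the unfolded function type the two polynomials could not be
  -- inferred.
  record _≋_ (p q : Poly N) : Set where
    constructor coefficientwise
    field
      coefficients : p ≈P q
  open _≋_ public

  ≋-sym : ∀ {p q} → p ≋ q → q ≋ p
  ≋-sym e .coefficients g = sym (coefficients e g)

  ≋-trans : ∀ {p q r} → p ≋ q → q ≋ r → p ≋ r
  ≋-trans e e′ .coefficients g = trans (coefficients e g) (coefficients e′ g)

  fromPair : ∀ {p q} → (∀ φ → pair φ p ≡ pair φ q) → p ≋ q
  fromPair {p} {q} e .coefficients g = trans (coeff-pair p g) (trans (e (δ g)) (sym (coeff-pair q g)))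

  coeff-++ : ∀ p q g → coeff (p ++ q) g ≡ coeff p g ℤ.+ coeff q g
  coeff-++ p q g = trans (coeff-pair (p ++ q) g)
    (trans (pair-++ (δ g) p q) (sym (cong₂ ℤ._+_ (coeff-pair p g) (coeff-pair q g))))

  +P-cong : ∀ {p p′ q q′} → p ≋ p′ → q ≋ q′ → p +P q ≋ p′ +P q′
  +P-cong {p} {p′} {q} {q′} e e′ .coefficients g =
    trans (coeff-++ p q g) (trans (cong₂ ℤ._+_ (coefficients e g) (coefficients e′ g)) (sym (coeff-++ p′ q′ g)))

  -P_ : Poly N → Poly N
  -P_ = map (λ { (c , e) → (ℤ.- c , e) })

  coeff-neg : ∀ p g → coeff (-P p) g ≡ ℤ.- coeff p g
  coeff-neg []            g = refl
  coeff-neg ((c , f) ∷ p) g with f ≟M g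
  ... | yes _ = trans (cong (ℤ._+_ (ℤ.- c)) (coeff-neg p g)) (sym (ℤₚ.neg-distrib-+ c _))
  ... | no _  = coeff-neg p g

  *P-comm : ∀ p q → p *P q ≋ q *P p
  *P-comm p q = fromPair λ φ → begin
    pair φ (p *P q)                            ≡⟨ pair-* φ p q ⟩
    pair (λ e → pair (λ f → φ (e ⊕ f)) q) p    ≡⟨ pair-swap (λ e f → φ (e ⊕ f)) p q ⟩
    pair (λ f → pair (λ e → φ (e ⊕ f)) p) q    ≡⟨ pair-cong (λ f → pair-cong (λ e → cong φ (⊕-comm e f)) p) q ⟩
    pair (λ f → pair (λ e → φ (f ⊕ e)) p) q    ≡⟨ pair-* φ q p ⟨
    pair φ (q *P p)                            ∎

  *P-assoc : ∀ p q r → (p *P q) *P r ≋ p *P (q *P r)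
  *P-assoc p q r = fromPair λ φ → begin
    pair φ ((p *P q) *P r)
      ≡⟨ trans (pair-* φ (p *P q) r) (pair-* _ p q) ⟩
    pair (λ e → pair (λ f → pair (λ g → φ ((e ⊕ f) ⊕ g)) r) q) p
      ≡⟨ pair-cong (λ e → pair-cong (λ f → pair-cong (λ g → cong φ (⊕-assoc e f g)) r) q) p ⟩
    pair (λ e → pair (λ f → pair (λ g → φ (e ⊕ (f ⊕ g))) r) q) p
      ≡⟨ trans (pair-* φ p (q *P r)) (pair-cong (λ e → pair-* _ q r) p) ⟨
    pair φ (p *P (q *P r)) ∎

  *P-distribʳ : ∀ r p q → (p +P q) *P r ≋ (p *P r) +P (q *P r)
  *P-distribʳ r p q = fromPair λ φ → begin
    pair φ ((p ++ q) *P r)               ≡⟨ trans (pair-* φ (p ++ q) r) (pair-++ _ p q) ⟩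
    _                                    ≡⟨ cong₂ ℤ._+_ (pair-* φ p r) (pair-* φ q r) ⟨
    pair φ (p *P r) ℤ.+ pair φ (q *P r)  ≡⟨ pair-++ φ (p *P r) (q *P r) ⟨
    pair φ ((p *P r) ++ (q *P r))        ∎

  *P-identityˡ : ∀ p → 1P *P p ≋ p
  *P-identityˡ p = fromPair λ φ → begin
    pair φ (1P *P p)                                     ≡⟨ pair-* φ 1P p ⟩
    1ℤ ℤ.* pair (λ f → φ (Vec.replicate N 0 ⊕ f)) p ℤ.+ 0ℤ   ≡⟨ trans (ℤₚ.+-identityʳ _) (ℤₚ.*-identityˡ _) ⟩
    pair (λ f → φ (Vec.replicate N 0 ⊕ f)) p                 ≡⟨ pair-cong (λ f → cong φ (⊕-identityˡ f)) p ⟩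
    pair φ p                                             ∎

  -- Multiplication by a monomial translates coefficients: the value is the coefficient at g - e if
  -- e divides g, and 0 otherwise. So it depends on the coefficients alone, not on the list of
  -- terms.
  pair-translate-cong : ∀ e g q q′ → q ≋ q′ → pair (λ f → δ g (e ⊕ f)) q ≡ pair (λ f → δ g (e ⊕ f)) q′
  pair-translate-cong e g q q′ eq with (e ⊕ zipWith ℕ._∸_ g e) ≟M g
  ... | yes refl′ = begin
    pair (λ f → δ g (e ⊕ f)) q   ≡⟨ pair-cong translate q ⟩
    pair (δ h) q                 ≡⟨ trans (sym (coeff-pair q h)) (trans (coefficients eq h) (coeff-pair q′ h)) ⟩
    pair (δ h) q′                ≡⟨ pair-cong translate q′ ⟨
    pair (λ f → δ g (e ⊕ f)) q′  ∎
    where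
    h : Mono N
    h = zipWith ℕ._∸_ g e
    translate : ∀ f → δ g (e ⊕ f) ≡ δ h f
    translate f with f ≟M h
    ... | yes f≡h = δ-yes g (e ⊕ f) (trans (cong (e ⊕_) f≡h) refl′)
    ... | no f≢h  = δ-no g (e ⊕ f) (λ eq → f≢h (⊕-cancelˡ e (trans eq (sym refl′))))
  ... | no ne = trans (pair-cong vanish q) (trans (pair-0 q) (sym (trans (pair-cong vanish q′) (pair-0 q′))))
    where
    vanish : ∀ f → δ g (e ⊕ f) ≡ 0ℤ
    vanish f = δ-no g (e ⊕ f) λ { refl → ne (cong (e ⊕_) (⊕-∸ e f)) }

  *P-congˡ : ∀ p {q q′} → q ≋ q′ → p *P q ≋ p *P q′
  *P-congˡ p {q} {q′} eq .coefficients g = begin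
    coeff (p *P q) g                                ≡⟨ trans (coeff-pair (p *P q) g) (pair-* (δ g) p q) ⟩
    pair (λ e → pair (λ f → δ g (e ⊕ f)) q) p       ≡⟨ pair-cong (λ e → pair-translate-cong e g q q′ eq) p ⟩
    pair (λ e → pair (λ f → δ g (e ⊕ f)) q′) p      ≡⟨ trans (coeff-pair (p *P q′) g) (pair-* (δ g) p q′) ⟨
    coeff (p *P q′) g                               ∎

  *P-cong : ∀ {p p′ q q′} → p ≋ p′ → q ≋ q′ → p *P q ≋ p′ *P q′
  *P-cong {p} {p′} {q} {q′} e e′ =
    ≋-trans (*P-congˡ p e′) (≋-trans (*P-comm p q′) (≋-trans (*P-congˡ q′ e) (*P-comm q′ p′)))

  polynomialRing : CommutativeRing 0ℓ 0ℓ
  polynomialRing = record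
    { Carrier = Poly N ; _≈_ = _≋_ ; _+_ = _+P_ ; _*_ = _*P_ ; -_ = -P_ ; 0# = 0P ; 1# = 1P
    ; isCommutativeRing = record
      { isRing = record
        { +-isAbelianGroup = record
          { isGroup = record
            { isMonoid = record
              { isSemigroup = record
                { isMagma = record
                  { isEquivalence = record
                    { refl  = coefficientwise λ g → refl
                    ; sym   = ≋-sym
                    ; trans = ≋-trans }
                  ; ∙-cong = +P-cong }
                ; assoc = λ p q r → coefficientwise λ g → cong (λ s → coeff s g) (Listₚ.++-assoc p q r) }
              ; identity = (λ p → coefficientwise λ g → refl) , λ p → coefficientwise λ g → cong (λ s → coeff s g) (Listₚ.++-identityʳ p) }
            ; inverse = (λ p → coefficientwise λ g → trans (coeff-++ (-P p) p g) (trans (cong (ℤ._+ coeff p g) (coeff-neg p g)) (ℤₚ.+-inverseˡ (coeff p g))))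
                      , (λ p → coefficientwise λ g → trans (coeff-++ p (-P p) g) (trans (cong (λ z → coeff p g ℤ.+ z) (coeff-neg p g)) (ℤₚ.+-inverseʳ (coeff p g))))
            ; ⁻¹-cong = λ {p} {q} e → coefficientwise λ g → trans (coeff-neg p g) (trans (cong ℤ.-_ (coefficients e g)) (sym (coeff-neg q g))) }
          ; comm = λ p q → coefficientwise λ g → trans (coeff-++ p q g) (trans (ℤₚ.+-comm (coeff p g) _) (sym (coeff-++ q p g))) }
        ; *-cong = *P-cong
        ; *-assoc = *P-assoc
        ; *-identity = *P-identityˡ , λ p → ≋-trans (*P-comm p 1P) (*P-identityˡ p)
        ; distrib = (λ r p q → ≋-trans (*P-comm r (p +P q)) (≋-trans (*P-distribʳ r p q) (+P-cong (*P-comm p r) (*P-comm q r))))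
                  , *P-distribʳ }
      ; *-comm = *P-comm } }

  -- Lexicographic leading monomials: decidable vanishing and absence of zero divisors.

  data _≺_ : ∀ {n} → Vec ℕ n → Vec ℕ n → Set where
    this : ∀ {n a b} {e f : Vec ℕ n} → a ℕ.< b → (a ∷ e) ≺ (b ∷ f)
    next : ∀ {n a} {e f : Vec ℕ n} → e ≺ f → (a ∷ e) ≺ (a ∷ f)

  ≺-irrefl : ∀ {n} {e : Vec ℕ n} → ¬ e ≺ e
  ≺-irrefl (this l) = ℕₚ.<-irrefl refl l
  ≺-irrefl (next l) = ≺-irrefl l

  ≺-trans : ∀ {n} {e f g : Vec ℕ n} → e ≺ f → f ≺ g → e ≺ g
  ≺-trans (this l) (this k) = this (ℕₚ.<-trans l k)
  ≺-trans (this l) (next k) = this l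
  ≺-trans (next l) (this k) = this k
  ≺-trans (next l) (next k) = next (≺-trans l k)

  ≺-cmp : ∀ {n} (e f : Vec ℕ n) → Tri (e ≺ f) (e ≡ f) (f ≺ e)
  ≺-cmp []      []      = tri≈ (λ ()) refl (λ ())
  ≺-cmp (a ∷ e) (b ∷ f) with ℕₚ.<-cmp a b
  ... | tri< l n g = tri< (this l) (λ { refl → n refl }) (λ { (this k) → g k ; (next _) → n refl })
  ... | tri> l n g = tri> (λ { (this k) → l k ; (next _) → n refl }) (λ { refl → n refl }) (this g)
  ... | tri≈ l refl g with ≺-cmp e f
  ...   | tri< k n h = tri< (next k) (λ { refl → n refl }) (λ { (this x) → g x ; (next x) → h x })
  ...   | tri> k n h = tri> (λ { (this x) → l x ; (next x) → k x }) (λ { refl → n refl }) (next h)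
  ...   | tri≈ k refl h = tri≈ (λ { (this x) → l x ; (next x) → k x }) refl (λ { (this x) → g x ; (next x) → h x })

  ≺-⊕ʳ : ∀ {n} {e f : Vec ℕ n} g → e ≺ f → (e ⊕ g) ≺ (f ⊕ g)
  ≺-⊕ʳ (c ∷ g) (this l) = this (ℕₚ.+-monoˡ-< c l)
  ≺-⊕ʳ (c ∷ g) (next l) = next (≺-⊕ʳ g l)

  ≺-⊕ˡ : ∀ {n} {e f : Vec ℕ n} g → e ≺ f → (g ⊕ e) ≺ (g ⊕ f)
  ≺-⊕ˡ (c ∷ g) (this l) = this (ℕₚ.+-monoʳ-< c l)
  ≺-⊕ˡ (c ∷ g) (next l) = next (≺-⊕ˡ g l)

  record Leading (p : Poly N) : Set where
    field
      exponent : Mono N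
      nonzero  : ¬ coeff p exponent ≡ 0ℤ
      above    : ∀ g → exponent ≺ g → coeff p g ≡ 0ℤ

  coeff-support : ∀ p g → ¬ coeff p g ≡ 0ℤ → g ∈ map proj₂ p
  coeff-support []            g nz = ⊥-elim (nz refl)
  coeff-support ((c , f) ∷ p) g nz with f ≟M g
  ... | yes refl = here refl
  ... | no _     = there (coeff-support p g nz)

  -- Listed terms may cancel, so the search looks at collected coefficients. It can be confined to
  -- the listed exponents, since all others have coefficient 0.
  leading? : ∀ p → (∀ g → coeff p g ≡ 0ℤ) ⊎ Leading p
  leading? p = finish (search (map proj₂ p))
    where
    Result : List (Mono N) → Set
    Result gs = (∀ {g} → g ∈ gs → coeff p g ≡ 0ℤ)
              ⊎ ∃ λ e → ¬ coeff p e ≡ 0ℤ × (∀ {g} → g ∈ gs → e ≺ g → coeff p g ≡ 0ℤ)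
    search : ∀ gs → Result gs
    search []       = inj₁ λ ()
    search (h ∷ gs) with coeff p h ℤ.≟ 0ℤ | search gs
    ... | yes z | inj₁ zs = inj₁ λ { (here refl) → z ; (there i) → zs i }
    ... | yes z | inj₂ (e , nz , ab) = inj₂ (e , nz , λ { (here refl) _ → z ; (there i) → ab i })
    ... | no nz | inj₁ zs = inj₂ (h , nz , λ { (here refl) l → ⊥-elim (≺-irrefl l) ; (there i) _ → zs i })
    ... | no nz | inj₂ (e , nz′ , ab) with ≺-cmp e h
    ...   | tri< e≺h _ _ = inj₂ (h , nz , λ { (here refl) l → ⊥-elim (≺-irrefl l) ; (there i) l → ab i (≺-trans e≺h l) })
    ...   | tri≈ _ refl _ = inj₂ (e , nz′ , λ { (here refl) l → ⊥-elim (≺-irrefl l) ; (there i) l → ab i l })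
    ...   | tri> ¬e≺h _ _ = inj₂ (e , nz′ , λ { (here refl) l → ⊥-elim (¬e≺h l) ; (there i) l → ab i l })
    extend : ∀ g → (g ∈ map proj₂ p → coeff p g ≡ 0ℤ) → coeff p g ≡ 0ℤ
    extend g k with coeff p g ℤ.≟ 0ℤ
    ... | yes z = z
    ... | no nz = k (coeff-support p g nz)
    finish : Result (map proj₂ p) → (∀ g → coeff p g ≡ 0ℤ) ⊎ Leading p
    finish (inj₁ zs)            = inj₁ λ g → extend g zs
    finish (inj₂ (e , nz , ab)) = inj₂ record
      { exponent = e ; nonzero = nz ; above = λ g l → extend g (λ i → ab i l) }

  _≺?_ : ∀ (e f : Mono N) → Dec (e ≺ f)
  e ≺? f with ≺-cmp e f
  ... | tri< l _ _ = yes l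
  ... | tri≈ n _ _ = no n
  ... | tri> n _ _ = no n

  below : Mono N → Poly N → Poly N
  below e []            = []
  below e ((c , f) ∷ p) with f ≺? e
  ... | yes _ = (c , f) ∷ below e p
  ... | no _  = below e p

  below-All : ∀ e p → All (λ t → proj₂ t ≺ e) (below e p)
  below-All e []            = []
  below-All e ((c , f) ∷ p) with f ≺? e
  ... | yes l = l ∷ below-All e p
  ... | no _  = below-All e p

  coeff-below-≺ : ∀ e p g → g ≺ e → coeff (below e p) g ≡ coeff p g
  coeff-below-≺ e []            g l = refl
  coeff-below-≺ e ((c , f) ∷ p) g l with f ≺? e
  coeff-below-≺ e ((c , f) ∷ p) g l | yes _ with f ≟M g
  ... | yes _ = cong (ℤ._+_ c) (coeff-below-≺ e p g l)
  ... | no _  = coeff-below-≺ e p g l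
  coeff-below-≺ e ((c , f) ∷ p) g l | no n with f ≟M g
  ... | yes refl = ⊥-elim (n l)
  ... | no _     = coeff-below-≺ e p g l

  coeff-below-⊀ : ∀ e p g → ¬ g ≺ e → coeff (below e p) g ≡ 0ℤ
  coeff-below-⊀ e []            g l = refl
  coeff-below-⊀ e ((c , f) ∷ p) g l with f ≺? e
  ... | no _  = coeff-below-⊀ e p g l
  ... | yes k with f ≟M g
  ...   | yes refl = ⊥-elim (l k)
  ...   | no _     = coeff-below-⊀ e p g l

  module _ {p : Poly N} (lead : Leading p) where
    open Leading lead

    sorted : Poly N
    sorted = (coeff p exponent , exponent) ∷ below exponent p

    sorted-≋ : p ≋ sorted
    sorted-≋ .coefficients g with exponent ≟M g
    ... | yes refl = sym (trans (cong (ℤ._+_ (coeff p exponent)) (coeff-below-⊀ exponent p g ≺-irrefl)) (ℤₚ.+-identityʳ _))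
    ... | no ne with ≺-cmp g exponent
    ...   | tri< l _ _ = sym (coeff-below-≺ exponent p g l)
    ...   | tri≈ _ eq _ = ⊥-elim (ne (sym eq))
    ...   | tri> n _ l = trans (above g l) (sym (coeff-below-⊀ exponent p g n))

  -- The order is preserved by addition of exponents. Once each factor is rewritten as one leading
  -- term followed by smaller ones, only the two leading terms contribute to the top exponent.
  *P-leading : ∀ {p q} (l : Leading p) (k : Leading q) →
    coeff (p *P q) (Leading.exponent l ⊕ Leading.exponent k) ≡ coeff p (Leading.exponent l) ℤ.* coeff q (Leading.exponent k)
  *P-leading {p} {q} l k = begin
    coeff (p *P q) (e ⊕ f)
      ≡⟨ coefficients (*P-cong (sorted-≋ l) (sorted-≋ k)) (e ⊕ f) ⟩
    coeff (sorted l *P sorted k) (e ⊕ f)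
      ≡⟨ trans (coeff-pair (sorted l *P sorted k) (e ⊕ f)) (pair-* (δ (e ⊕ f)) (sorted l) (sorted k)) ⟩
    coeff p e ℤ.* (coeff q f ℤ.* δ (e ⊕ f) (e ⊕ f) ℤ.+ pair (λ g → δ (e ⊕ f) (e ⊕ g)) (below f q))
      ℤ.+ pair (λ h → pair (λ g → δ (e ⊕ f) (h ⊕ g)) (sorted k)) (below e p)
      ≡⟨ cong₂ ℤ._+_ (cong (coeff p e ℤ.*_) (cong₂ ℤ._+_ (cong (coeff q f ℤ.*_) (δ-yes (e ⊕ f) (e ⊕ f) refl))
           (pair-zero _ (below f q) (All.map (λ {t} l → δ-no (e ⊕ f) (e ⊕ proj₂ t) λ eq → ≺-irrefl (≡.subst (_≺ (e ⊕ f)) eq (≺-⊕ˡ e l))) (below-All f q)))))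
           (pair-zero _ (below e p) (All.map (λ {t} l → pair-zero _ (sorted k) (smaller l)) (below-All e p))) ⟩
    coeff p e ℤ.* (coeff q f ℤ.* 1ℤ ℤ.+ 0ℤ) ℤ.+ 0ℤ
      ≡⟨ solve 2 (λ x y → x :* (y :* con 1ℤ :+ con 0ℤ) :+ con 0ℤ := x :* y) refl (coeff p e) (coeff q f) ⟩
    coeff p e ℤ.* coeff q f ∎
    where
    open ℤSolver.+-*-Solver
    e f : Mono N
    e = Leading.exponent l
    f = Leading.exponent k
    differ : ∀ {h} → h ≺ (e ⊕ f) → δ (e ⊕ f) h ≡ 0ℤ
    differ {h} l = δ-no (e ⊕ f) h λ { refl → ≺-irrefl l }
    smaller : ∀ {h} → h ≺ e → All (λ t → δ (e ⊕ f) (h ⊕ proj₂ t) ≡ 0ℤ) (sorted k)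
    smaller {h} l = differ (≺-⊕ʳ f l) ∷ All.map (λ m → differ (≺-trans (≺-⊕ˡ h m) (≺-⊕ʳ f l))) (below-All f q)

  zero?P : ∀ p → Dec (p ≋ 0P)
  zero?P p with leading? p
  ... | inj₁ z = yes (coefficientwise z)
  ... | inj₂ l = no λ z → Leading.nonzero l (coefficients z (Leading.exponent l))

  *P-nonzero : ∀ p q → ¬ p ≋ 0P → ¬ q ≋ 0P → ¬ p *P q ≋ 0P
  *P-nonzero p q np nq z = cases (leading? p) (leading? q)
    where
    cases : (∀ g → coeff p g ≡ 0ℤ) ⊎ Leading p → (∀ g → coeff q g ≡ 0ℤ) ⊎ Leading q → ⊥
    cases (inj₁ zp) _         = np (coefficientwise zp)
    cases (inj₂ _)  (inj₁ zq) = nq (coefficientwise zq)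
    cases (inj₂ l)  (inj₂ k)  = Sum.[ Leading.nonzero l , Leading.nonzero k ]′
      (ℤₚ.i*j≡0⇒i≡0∨j≡0 (coeff p (Leading.exponent l))
        (trans (sym (*P-leading l k)) (coefficients z (Leading.exponent l ⊕ Leading.exponent k))))

-- The field of fractions of an integral domain with decidable vanishing.

module Fractions (R : CommutativeRing 0ℓ 0ℓ) where
  open CommutativeRing R renaming (Carrier to A) hiding (refl; sym; trans)
  private
    module R = CommutativeRing R

  module _
    (isZero? : ∀ x → Dec (x ≈ 0#))
    (*-nonzero : ∀ x y → ¬ x ≈ 0# → ¬ y ≈ 0# → ¬ x * y ≈ 0#)
    (1≉0 : ¬ 1# ≈ 0#) where
    open IntegerCoefficients R using (solve; _:=_; _:+_; _:*_; _:-_; :-_; con)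
    open import Relation.Binary.Reasoning.Setoid setoid
    open import Algebra.Properties.Ring ring using (x≈y⇒x∙y⁻¹≈ε; x∙y⁻¹≈ε⇒x≈y)

    *-cancelˡ : ∀ c x y → ¬ c ≈ 0# → c * x ≈ c * y → x ≈ y
    *-cancelˡ c x y nz eq with isZero? (x - y)
    ... | yes z = x∙y⁻¹≈ε⇒x≈y x y z
    ... | no n  = ⊥-elim (*-nonzero c (x - y) nz n (begin
      c * (x - y)     ≈⟨ solve 3 (λ c x y → c :* (x :- y) := c :* x :- c :* y) R.refl c x y ⟩
      c * x - c * y   ≈⟨ x≈y⇒x∙y⁻¹≈ε eq ⟩
      0#              ∎))

    -- The proof of a nonzero denominator is what makes cross-multiplication transitive. The
    -- operations below act on the underlying pairs exactly as those of `Frac` do, so the first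
    -- projection commutes with them by computation.
    Q : Set
    Q = Σ (A × A) λ f → ¬ proj₂ f ≈ 0#

    record _≃_ (x y : Q) : Set where
      constructor cross
      field
        uncross : proj₁ (proj₁ x) * proj₂ (proj₁ y) ≈ proj₁ (proj₁ y) * proj₂ (proj₁ x)
    open _≃_

    ≃-trans : ∀ {x y z} → x ≃ y → y ≃ z → x ≃ z
    ≃-trans {(a , b) , _} {(c , d) , nd} {(e , f) , _} (cross p) (cross q) = cross (*-cancelˡ d _ _ nd (begin
      d * (a * f)   ≈⟨ solve 3 (λ d a f → d :* (a :* f) := (a :* d) :* f) R.refl d a f ⟩
      (a * d) * f   ≈⟨ *-congʳ p ⟩
      (c * b) * f   ≈⟨ solve 3 (λ c b f → (c :* b) :* f := (c :* f) :* b) R.refl c b f ⟩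
      (c * f) * b   ≈⟨ *-congʳ q ⟩
      (e * d) * b   ≈⟨ solve 3 (λ e d b → (e :* d) :* b := d :* (e :* b)) R.refl e d b ⟩
      d * (e * b)   ∎))

    _+Q_ _*Q_ : Q → Q → Q
    ((a , b) , n) +Q ((c , d) , m) = (a * d + c * b , b * d) , *-nonzero b d n m
    ((a , b) , n) *Q ((c , d) , m) = (a * c , b * d) , *-nonzero b d n m

    -Q_ : Q → Q
    -Q ((a , b) , n) = (- a , b) , n

    0Q 1Q : Q
    0Q = (0# , 1#) , 1≉0
    1Q = (1# , 1#) , 1≉0

    +Q-cong : ∀ {x x′ y y′} → x ≃ x′ → y ≃ y′ → (x +Q y) ≃ (x′ +Q y′)
    +Q-cong {(a , b) , _} {(a′ , b′) , _} {(c , d) , _} {(c′ , d′) , _} (cross p) (cross q) = cross (begin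
      (a * d + c * b) * (b′ * d′)
        ≈⟨ solve 6 (λ a d c b b′ d′ → (a :* d :+ c :* b) :* (b′ :* d′) := (a :* b′) :* (d :* d′) :+ (c :* d′) :* (b :* b′)) R.refl a d c b b′ d′ ⟩
      (a * b′) * (d * d′) + (c * d′) * (b * b′)
        ≈⟨ +-cong (*-congʳ p) (*-congʳ q) ⟩
      (a′ * b) * (d * d′) + (c′ * d) * (b * b′)
        ≈⟨ solve 6 (λ a d c b b′ d′ → (a :* b) :* (d :* d′) :+ (c :* d) :* (b :* b′) := (a :* d′ :+ c :* b′) :* (b :* d)) R.refl a′ d c′ b b′ d′ ⟩
      (a′ * d′ + c′ * b′) * (b * d) ∎)

    *Q-cong : ∀ {x x′ y y′} → x ≃ x′ → y ≃ y′ → (x *Q y) ≃ (x′ *Q y′)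
    *Q-cong {(a , b) , _} {(a′ , b′) , _} {(c , d) , _} {(c′ , d′) , _} (cross p) (cross q) = cross (begin
      (a * c) * (b′ * d′)   ≈⟨ solve 4 (λ a c b d → (a :* c) :* (b :* d) := (a :* b) :* (c :* d)) R.refl a c b′ d′ ⟩
      (a * b′) * (c * d′)   ≈⟨ *-cong p q ⟩
      (a′ * b) * (c′ * d)   ≈⟨ solve 4 (λ a c b d → (a :* c) :* (b :* d) := (a :* b) :* (c :* d)) R.refl a′ b c′ d ⟩
      (a′ * c′) * (b * d)   ∎)

    *Q-comm : ∀ x y → (x *Q y) ≃ (y *Q x)
    *Q-comm ((a , b) , _) ((c , d) , _) = cross (*-cong (*-comm a c) (*-comm d b))

    *Q-identityˡ : ∀ x → (1Q *Q x) ≃ x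
    *Q-identityˡ ((a , b) , _) = cross (solve 2 (λ a b → (con (+ 1) :* a) :* b := a :* (con (+ 1) :* b)) R.refl a b)

    +Q-comm : ∀ x y → (x +Q y) ≃ (y +Q x)
    +Q-comm ((a , b) , _) ((c , d) , _) = cross (*-cong (+-comm _ _) (*-comm d b))

    +Q-identityˡ : ∀ x → (0Q +Q x) ≃ x
    +Q-identityˡ ((a , b) , _) = cross (solve 2 (λ a b → (con (+ 0) :* b :+ a :* con (+ 1)) :* b := a :* (con (+ 1) :* b)) R.refl a b)

    -Q-inverseˡ : ∀ x → ((-Q x) +Q x) ≃ 0Q
    -Q-inverseˡ ((a , b) , _) = cross (solve 2 (λ a b → ((:- a) :* b :+ a :* b) :* con (+ 1) := con (+ 0) :* (b :* b)) R.refl a b)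

    *Q-distribʳ : ∀ z x y → ((x +Q y) *Q z) ≃ ((x *Q z) +Q (y *Q z))
    *Q-distribʳ ((e , f) , _) ((a , b) , _) ((c , d) , _) = cross
      (solve 6 (λ a b c d e f → ((a :* d :+ c :* b) :* e) :* ((b :* f) :* (d :* f))
                             := ((a :* e) :* (d :* f) :+ (c :* e) :* (b :* f)) :* ((b :* d) :* f))
        R.refl a b c d e f)

    fractionRing : CommutativeRing 0ℓ 0ℓ
    fractionRing = record
      { Carrier = Q ; _≈_ = _≃_ ; _+_ = _+Q_ ; _*_ = _*Q_ ; -_ = -Q_ ; 0# = 0Q ; 1# = 1Q
      ; isCommutativeRing = record
        { isRing = record
          { +-isAbelianGroup = record
            { isGroup = record
              { isMonoid = record
                { isSemigroup = record
                  { isMagma = record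
                    { isEquivalence = record
                      { refl = cross R.refl
                      ; sym   = λ { (cross p) → cross (R.sym p) }
                      ; trans = ≃-trans }
                    ; ∙-cong = +Q-cong }
                  ; assoc = λ { ((a , b) , _) ((c , d) , _) ((e , f) , _) → cross
                      (solve 6 (λ a b c d e f → ((a :* d :+ c :* b) :* f :+ e :* (b :* d)) :* (b :* (d :* f))
                                             := (a :* (d :* f) :+ (c :* f :+ e :* d) :* b) :* ((b :* d) :* f))
                        R.refl a b c d e f) } }
                ; identity = +Q-identityˡ , λ x → ≃-trans (+Q-comm x 0Q) (+Q-identityˡ x) }
              ; inverse = -Q-inverseˡ , λ x → ≃-trans (+Q-comm x (-Q x)) (-Q-inverseˡ x)
              ; ⁻¹-cong = λ { {(a , b) , _} {(c , d) , _} (cross p) → cross (begin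
                  (- a) * d   ≈⟨ solve 2 (λ a d → (:- a) :* d := :- (a :* d)) R.refl a d ⟩
                  - (a * d)   ≈⟨ -‿cong p ⟩
                  - (c * b)   ≈⟨ solve 2 (λ a d → (:- a) :* d := :- (a :* d)) R.refl c b ⟨
                  (- c) * b   ∎) } }
            ; comm = +Q-comm }
          ; *-cong = *Q-cong
          ; *-assoc = λ { ((a , b) , _) ((c , d) , _) ((e , f) , _) → cross (*-cong (*-assoc a c e) (R.sym (*-assoc b d f))) }
          ; *-identity = *Q-identityˡ , λ x → ≃-trans (*Q-comm x 1Q) (*Q-identityˡ x)
          ; distrib = (λ z x y → ≃-trans (*Q-comm z (x +Q y)) (≃-trans (*Q-distribʳ z x y) (+Q-cong (*Q-comm x z) (*Q-comm y z))))
                    , *Q-distribʳ }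
        ; *-comm = *Q-comm } }

    ≡⇒≃ : ∀ {x y} → proj₁ x ≡ proj₁ y → x ≃ y
    ≡⇒≃ refl = cross R.refl

    -- The quotient is recognised by its underlying pair, because `_/F_` comes without a proof that
    -- its denominator is nonzero; that proof is part of e.
    /-cancel : ∀ e w x → proj₁ e ≡ (proj₁ (proj₁ w) * proj₂ (proj₁ x) , proj₂ (proj₁ w) * proj₁ (proj₁ x)) → (e *Q x) ≃ w
    /-cancel (_ , _) ((n , d) , _) ((a , b) , _) refl = cross
      (solve 4 (λ n d a b → ((n :* b) :* a) :* d := n :* ((d :* a) :* b)) R.refl n d a b)

    numerator-zero : ∀ x → proj₁ (proj₁ x) ≈ 0# → x ≃ 0Q
    numerator-zero ((a , b) , _) z = cross (R.trans (*-identityʳ a) (R.trans z (R.sym (zeroˡ b))))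

    zero-numerator : ∀ x → x ≃ 0Q → proj₁ (proj₁ x) ≈ 0#
    zero-numerator ((a , b) , _) (cross z) = R.trans (R.sym (*-identityʳ a)) (R.trans z (zeroˡ b))

    fractionField : DiscreteField
    fractionField = record
      { commutativeRing = fractionRing
      ; _≟_ = λ { ((a , b) , _) ((c , d) , _) → map′ (λ z → cross (x∙y⁻¹≈ε⇒x≈y _ _ z)) (λ { (cross p) → x≈y⇒x∙y⁻¹≈ε p })
                                                (isZero? (a * d - c * b)) }
      ; inverse = λ { x@((a , b) , nb) nz → ((b , a) , λ z → nz (numerator-zero x z))
                    , cross (R.trans (*-identityʳ _) (R.trans (*-comm b a) (R.sym (*-identityˡ _)))) } }

-- Mutation at an independent set of vertices

module Mutation {N : ℕ} where

  paths : (Fin N → Fin N → ℤ) → Fin N → Fin N → Fin N → ℤ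
  paths B z i j = + ([ B i z ]₊ ℕ.* [ B z j ]₊) ℤ.- + ([ B i z ]₋ ℕ.* [ B z j ]₋)

  exchange : (Fin N → Fin N → ℤ) → (Fin N → Frac N) → Fin N → Frac N
  exchange B x v = (∏F (map (λ y → x y ^F [ B y v ]₊) (allFin N)) +F ∏F (map (λ y → x y ^F [ B y v ]₋) (allFin N))) /F x v

  paths-cong : ∀ {B B′} z i j → B i z ≡ B′ i z → B z j ≡ B′ z j → paths B z i j ≡ paths B′ z i j
  paths-cong z i j e f rewrite e | f = refl

  paths-zeroˡ : ∀ {B} z i j → B i z ≡ 0ℤ → paths B z i j ≡ 0ℤ
  paths-zeroˡ z i j e rewrite e = refl

  paths-zeroʳ : ∀ {B} z i j → B z j ≡ 0ℤ → paths B z i j ≡ 0ℤ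
  paths-zeroʳ {B} z i j e rewrite e | ℕₚ.*-zeroʳ [ B i z ]₊ | ℕₚ.*-zeroʳ [ B i z ]₋ = refl

  -- A variable with exponent 0 contributes `1F` whatever it is, so it may change without disturbing
  -- the propositional equality.
  exchange-cong : ∀ {B B′ x x′} v → (∀ y → B y v ≡ B′ y v) → (∀ y → B y v ≡ 0ℤ ⊎ x y ≡ x′ y) → x v ≡ x′ v →
    exchange B x v ≡ exchange B′ x′ v
  exchange-cong {B} {B′} {x} {x′} v eB ex ev =
    cong₂ _/F_ (cong₂ _+F_ (cong ∏F (Listₚ.map-cong (λ y → factor [_]₊ refl y) (allFin N)))
                           (cong ∏F (Listₚ.map-cong (λ y → factor [_]₋ refl y) (allFin N)))) ev
    where
    factor : (part : ℤ → ℕ) → part 0ℤ ≡ 0 → ∀ y → x y ^F part (B y v) ≡ x′ y ^F part (B′ y v)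
    factor part p0 y with ex y
    ... | inj₁ z = trans (cong (λ k → x y ^F k) (trans (cong part z) p0))
                         (sym (cong (λ k → x′ y ^F k) (trans (cong part (trans (sym (eB y)) z)) p0)))
    ... | inj₂ e = cong₂ _^F_ e (cong part (eB y))

  module _ (s : Seed N) (z : Fin N) where

    mutate-B-row : ∀ j → B (mutate z s) z j ≡ ℤ.- B s z j
    mutate-B-row j rewrite dec-true (z ≟F z) refl = refl

    mutate-B-col : ∀ i → B (mutate z s) i z ≡ ℤ.- B s i z
    mutate-B-col i with does (i ≟F z)
    ... | true  = refl
    ... | false rewrite dec-true (z ≟F z) refl = refl

    mutate-B-other : ∀ i j → i ≢ z → j ≢ z → B (mutate z s) i j ≡ B s i j ℤ.+ paths (B s) z i j
    mutate-B-other i j i≢z j≢z rewrite dec-false (i ≟F z) i≢z | dec-false (j ≟F z) j≢z =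
      ℤₚ.+-assoc (B s i j) _ _

    mutate-x-self : x (mutate z s) z ≡ exchange (B s) (x s) z
    mutate-x-self rewrite dec-true (z ≟F z) refl = refl

    mutate-x-other : ∀ v → v ≢ z → x (mutate z s) v ≡ x s v
    mutate-x-other v v≢z rewrite dec-false (v ≟F z) v≢z = refl

  sumℤ : List ℤ → ℤ
  sumℤ = foldr ℤ._+_ 0ℤ

  module _ (c : Fin N → Bool) where

    Independent : (Fin N → Fin N → ℤ) → Set
    Independent B = ∀ {i j} → c i ≡ true → c j ≡ true → B i j ≡ 0ℤ

    module _ (s : Seed N) (ind : Independent (B s)) {z : Fin N} (cz : c z ≡ true) where

      mutate-B-coloredʳ : ∀ i {v} → c v ≡ true → v ≢ z → B (mutate z s) i v ≡ B s i v
      mutate-B-coloredʳ i {v} cv v≢z = cases (i ≟F z)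
        where
        cases : Dec (i ≡ z) → B (mutate z s) i v ≡ B s i v
        cases (yes refl) = trans (mutate-B-row s z v) (trans (cong ℤ.-_ (ind cz cv)) (sym (ind cz cv)))
        cases (no i≢z)   = trans (mutate-B-other s z i v i≢z v≢z)
                         (trans (cong (ℤ._+_ (B s i v)) (paths-zeroʳ {B s} z i v (ind cz cv))) (ℤₚ.+-identityʳ _))

      mutate-B-coloredˡ : ∀ {v} j → c v ≡ true → v ≢ z → B (mutate z s) v j ≡ B s v j
      mutate-B-coloredˡ {v} j cv v≢z = cases (j ≟F z)
        where
        cases : Dec (j ≡ z) → B (mutate z s) v j ≡ B s v j
        cases (yes refl) = trans (mutate-B-col s z v) (trans (cong ℤ.-_ (ind cv cz)) (sym (ind cv cz)))
        cases (no j≢z)   = trans (mutate-B-other s z v j v≢z j≢z)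
                         (trans (cong (ℤ._+_ (B s v j)) (paths-zeroˡ {B s} z v j (ind cv cz))) (ℤₚ.+-identityʳ _))

      mutate-independent : Independent (B (mutate z s))
      mutate-independent {i} {j} ci cj = cases (j ≟F z)
        where
        cases : Dec (j ≡ z) → B (mutate z s) i j ≡ 0ℤ
        cases (yes refl) = trans (mutate-B-col s z i) (cong ℤ.-_ (ind ci cz))
        cases (no j≢z)   = trans (mutate-B-coloredʳ i cj j≢z) (ind ci cj)

      mutate-exchange : ∀ {v} → c v ≡ true → v ≢ z → exchange (B (mutate z s)) (x (mutate z s)) v ≡ exchange (B s) (x s) v
      mutate-exchange {v} cv v≢z = exchange-cong {B (mutate z s)} {B s} v (λ y → mutate-B-coloredʳ y cv v≢z) same
                                     (mutate-x-other s z v v≢z)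
        where
        same : ∀ y → B (mutate z s) y v ≡ 0ℤ ⊎ x (mutate z s) y ≡ x s y
        same y = cases (y ≟F z)
          where
          cases : Dec (y ≡ z) → B (mutate z s) y v ≡ 0ℤ ⊎ x (mutate z s) y ≡ x s y
          cases (yes refl) = inj₁ (mutate-independent cz cv)
          cases (no y≢z)   = inj₂ (mutate-x-other s z y y≢z)

    Colored : List (Fin N) → Set
    Colored zs = All (λ z → c z ≡ true) zs

    ∉-head : ∀ {z : Fin N} {zs : List (Fin N)} → All (z ≢_) zs → ∀ {v} → v ∈ zs → v ≢ z
    ∉-head u i e = All.lookup u i (sym e)

    mutateAll-x-other : ∀ zs s {v} → v ∉ zs → x (mutateAll zs s) v ≡ x s v
    mutateAll-x-other []       s v∉ = refl
    mutateAll-x-other (z ∷ zs) s {v} v∉ =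
      trans (mutateAll-x-other zs (mutate z s) (v∉ ∘ there)) (mutate-x-other s z v (v∉ ∘ here))

    -- Variables of an independent set do not enter each other's exchange relation, so the
    -- successive mutations act as if all were performed on the original seed.
    mutateAll-x : ∀ zs s → Colored zs → Unique zs → Independent (B s) → ∀ {v} → v ∈ zs →
      x (mutateAll zs s) v ≡ exchange (B s) (x s) v
    mutateAll-x (z ∷ zs) s (cz ∷ cs) (u ∷ us) ind (here refl) =
      trans (mutateAll-x-other zs (mutate z s) (λ i → All.lookup u i refl)) (mutate-x-self s z)
    mutateAll-x (z ∷ zs) s (cz ∷ cs) (u ∷ us) ind (there i) =
      trans (mutateAll-x zs (mutate z s) cs us (mutate-independent s ind cz) i)
            (mutate-exchange s ind cz (All.lookup cs i) (∉-head u i))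

    mutateAll-B-outsideʳ : ∀ zs s → Colored zs → Independent (B s) → ∀ i {v} → c v ≡ true → v ∉ zs →
      B (mutateAll zs s) i v ≡ B s i v
    mutateAll-B-outsideʳ []       s cs ind i cv v∉ = refl
    mutateAll-B-outsideʳ (z ∷ zs) s (cz ∷ cs) ind i cv v∉ =
      trans (mutateAll-B-outsideʳ zs (mutate z s) cs (mutate-independent s ind cz) i cv (v∉ ∘ there))
            (mutate-B-coloredʳ s ind cz i cv (v∉ ∘ here))

    mutateAll-B-outsideˡ : ∀ zs s → Colored zs → Independent (B s) → ∀ {v} j → c v ≡ true → v ∉ zs →
      B (mutateAll zs s) v j ≡ B s v j
    mutateAll-B-outsideˡ []       s cs ind j cv v∉ = refl
    mutateAll-B-outsideˡ (z ∷ zs) s (cz ∷ cs) ind j cv v∉ =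
      trans (mutateAll-B-outsideˡ zs (mutate z s) cs (mutate-independent s ind cz) j cv (v∉ ∘ there))
            (mutate-B-coloredˡ s ind cz j cv (v∉ ∘ here))

    -- Only the mutation at v itself changes column v: the other mutated vertices are not joined to
    -- v.
    mutateAll-Bʳ : ∀ zs s → Colored zs → Unique zs → Independent (B s) → ∀ i {v} → v ∈ zs →
      B (mutateAll zs s) i v ≡ ℤ.- B s i v
    mutateAll-Bʳ (z ∷ zs) s (cz ∷ cs) (u ∷ us) ind i (here refl) =
      trans (mutateAll-B-outsideʳ zs (mutate z s) cs (mutate-independent s ind cz) i cz (λ k → All.lookup u k refl)) (mutate-B-col s z i)
    mutateAll-Bʳ (z ∷ zs) s (cz ∷ cs) (u ∷ us) ind i (there k) =
      trans (mutateAll-Bʳ zs (mutate z s) cs us (mutate-independent s ind cz) i k)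
            (cong ℤ.-_ (mutate-B-coloredʳ s ind cz i (All.lookup cs k) (∉-head u k)))

    mutateAll-Bˡ : ∀ zs s → Colored zs → Unique zs → Independent (B s) → ∀ {v} j → v ∈ zs →
      B (mutateAll zs s) v j ≡ ℤ.- B s v j
    mutateAll-Bˡ (z ∷ zs) s (cz ∷ cs) (u ∷ us) ind j (here refl) =
      trans (mutateAll-B-outsideˡ zs (mutate z s) cs (mutate-independent s ind cz) j cz (λ k → All.lookup u k refl)) (mutate-B-row s z j)
    mutateAll-Bˡ (z ∷ zs) s (cz ∷ cs) (u ∷ us) ind j (there k) =
      trans (mutateAll-Bˡ zs (mutate z s) cs us (mutate-independent s ind cz) j k)
            (cong ℤ.-_ (mutate-B-coloredˡ s ind cz j (All.lookup cs k) (∉-head u k)))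

    -- The entry collects the paths through each mutated vertex in turn. Earlier mutations leave the
    -- arrows at later vertices of the list alone, so all paths can be counted in the original
    -- matrix.
    mutateAll-B-uncolored : ∀ zs s → Colored zs → Unique zs → Independent (B s) → ∀ {i j} → c i ≡ false → c j ≡ false →
      B (mutateAll zs s) i j ≡ B s i j ℤ.+ sumℤ (map (λ z → paths (B s) z i j) zs)
    mutateAll-B-uncolored []       s cs us ind ci cj = sym (ℤₚ.+-identityʳ _)
    mutateAll-B-uncolored (z ∷ zs) s (cz ∷ cs) (u ∷ us) ind {i} {j} ci cj = begin
      B (mutateAll zs (mutate z s)) i j
        ≡⟨ mutateAll-B-uncolored zs (mutate z s) cs us (mutate-independent s ind cz) ci cj ⟩
      B (mutate z s) i j ℤ.+ sumℤ (map (λ y → paths (B (mutate z s)) y i j) zs)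
        ≡⟨ cong₂ ℤ._+_ (mutate-B-other s z i j (other ci) (other cj)) (cong sumℤ (same zs cs u)) ⟩
      (B s i j ℤ.+ paths (B s) z i j) ℤ.+ sumℤ (map (λ y → paths (B s) y i j) zs)
        ≡⟨ ℤₚ.+-assoc (B s i j) _ _ ⟩
      B s i j ℤ.+ sumℤ (map (λ y → paths (B s) y i j) (z ∷ zs)) ∎
      where
      open ≡-Reasoning
      other : ∀ {v} → c v ≡ false → v ≢ z
      other cv refl with trans (sym cz) cv
      ... | ()
      same : ∀ ys → Colored ys → All (z ≢_) ys → map (λ y → paths (B (mutate z s)) y i j) ys ≡ map (λ y → paths (B s) y i j) ys
      same []       []       []       = refl
      same (y ∷ ys) (cy ∷ cs) (v ∷ vs) = cong₂ _∷_
        (paths-cong {B (mutate z s)} {B s} y i j (mutate-B-coloredʳ s ind cz i cy (λ e → v (sym e))) (mutate-B-coloredˡ s ind cz j cy (λ e → v (sym e))))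
        (same ys cs vs)

    colored : List (Fin N)
    colored = filterᵇ c (allFin N)

    colored-unique : Unique colored
    colored-unique = filter⁺ (T? ∘ c) (allFin⁺ N)

    ∈colored : ∀ {v} → c v ≡ true → v ∈ colored
    ∈colored {v} cv = ∈-filter⁺ (T? ∘ c) (∈-allFin v) (Equivalence.from Boolₚ.T-≡ cv)

    ∈colored⁻ : ∀ {v} → v ∈ colored → c v ≡ true
    ∈colored⁻ i = Equivalence.to Boolₚ.T-≡ (proj₂ (∈-filter⁻ (T? ∘ c) {xs = allFin N} i))

    colored-Colored : Colored colored
    colored-Colored = All.tabulate ∈colored⁻

    ∉colored : ∀ {v} → c v ≡ false → v ∉ colored
    ∉colored cv i with trans (sym (∈colored⁻ i)) cv
    ... | ()

-- The field of fractions and positivity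

multiplicity : ∀ {N} → List (Fin N) → Fin N → ℕ
multiplicity []       y = 0
multiplicity (u ∷ us) y = ind (does (y ≟F u)) ℕ.+ multiplicity us y

multiplicity-∈ : ∀ {N} (us : List (Fin N)) {u} → u ∈ us → multiplicity us u ≢ 0
multiplicity-∈ (u ∷ us) (here refl) rewrite dec-true (u ≟F u) refl = λ ()
multiplicity-∈ (u ∷ us) {v} (there i) e = multiplicity-∈ us i (ℕₚ.m+n≡0⇒n≡0 (ind (does (v ≟F u))) e)

module Products (𝕂 : DiscreteField) {N : ℕ} where
  open DiscreteField 𝕂 renaming (Carrier to K; refl to ≈-refl; sym to ≈-sym; trans to ≈-trans) hiding (zero)
  open import Relation.Binary.Reasoning.Setoid setoid

  ∏ : List K → K
  ∏ = foldr _*_ 1#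

  infixr 8 _^_
  _^_ : K → ℕ → K
  a ^ zero  = 1#
  a ^ suc k = a * a ^ k

  ^-+ : ∀ a j k → a ^ (j ℕ.+ k) ≈ a ^ j * a ^ k
  ^-+ a zero    k = ≈-sym (*-identityˡ _)
  ^-+ a (suc j) k = ≈-trans (*-congˡ (^-+ a j k)) (≈-sym (*-assoc a _ _))

  ∏-cong : ∀ {A : Set} {f g : A → K} (as : List A) → (∀ {a} → a ∈ as → f a ≈ g a) → ∏ (map f as) ≈ ∏ (map g as)
  ∏-cong []       e = ≈-refl
  ∏-cong (a ∷ as) e = *-cong (e (here refl)) (∏-cong as (e ∘ there))

  ∏-one : ∀ {A : Set} (f : A → K) as → (∀ {a} → a ∈ as → f a ≈ 1#) → ∏ (map f as) ≈ 1#
  ∏-one f []       e = ≈-refl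
  ∏-one f (a ∷ as) e = ≈-trans (*-cong (e (here refl)) (∏-one f as (e ∘ there))) (*-identityˡ 1#)

  ∏-* : ∀ {A : Set} (f g : A → K) as → ∏ (map (λ a → f a * g a) as) ≈ ∏ (map f as) * ∏ (map g as)
  ∏-* f g []       = ≈-sym (*-identityˡ 1#)
  ∏-* f g (a ∷ as) = begin
    (f a * g a) * ∏ (map (λ a → f a * g a) as)          ≈⟨ *-congˡ (∏-* f g as) ⟩
    (f a * g a) * (∏ (map f as) * ∏ (map g as))         ≈⟨ *-assoc _ _ _ ⟩
    f a * (g a * (∏ (map f as) * ∏ (map g as)))         ≈⟨ *-congˡ (≈-trans (≈-sym (*-assoc _ _ _)) (*-congʳ (*-comm _ _))) ⟩
    f a * ((∏ (map f as) * g a) * ∏ (map g as))         ≈⟨ *-congˡ (*-assoc _ _ _) ⟩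
    f a * (∏ (map f as) * (g a * ∏ (map g as)))         ≈⟨ *-assoc _ _ _ ⟨
    (f a * ∏ (map f as)) * (g a * ∏ (map g as))         ∎

  ∏-indicator : ∀ (X : Fin N → K) u L → Unique L → u ∈ L → ∏ (map (λ y → X y ^ ind (does (y ≟F u))) L) ≈ X u
  ∏-indicator X u (.u ∷ L) (n ∷ _) (here refl) = begin
    X u ^ ind (does (u ≟F u)) * ∏ (map (λ y → X y ^ ind (does (y ≟F u))) L)
      ≈⟨ *-cong (reflexive (cong (λ b → X u ^ ind b) (dec-true (u ≟F u) refl)))
                (∏-one _ L (λ {y} i → reflexive (cong (λ b → X y ^ ind b) (dec-false (y ≟F u) (λ e → All.lookup n i (sym e)))))) ⟩
    (X u * 1#) * 1# ≈⟨ ≈-trans (*-identityʳ _) (*-identityʳ _) ⟩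
    X u ∎
  ∏-indicator X u (y ∷ L) (n ∷ us) (there i) =
    ≈-trans (*-cong (reflexive (cong (λ b → X y ^ ind b) (dec-false (y ≟F u) (λ e → All.lookup n i e)))) (∏-indicator X u L us i))
            (*-identityˡ _)

  -- Turns the product over all vertices in the definition of mutation into a product over a list of
  -- neighbours.
  ∏-multiplicity : ∀ (X : Fin N → K) us → ∏ (map (λ y → X y ^ multiplicity us y) (allFin N)) ≈ ∏ (map X us)
  ∏-multiplicity X []       = ∏-one _ (allFin N) (λ _ → ≈-refl)
  ∏-multiplicity X (u ∷ us) = begin
    ∏ (map (λ y → X y ^ (ind (does (y ≟F u)) ℕ.+ multiplicity us y)) (allFin N))
      ≈⟨ ∏-cong (allFin N) (λ {y} _ → ^-+ (X y) (ind (does (y ≟F u))) _) ⟩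
    ∏ (map (λ y → X y ^ ind (does (y ≟F u)) * X y ^ multiplicity us y) (allFin N))
      ≈⟨ ∏-* _ _ (allFin N) ⟩
    _ * _
      ≈⟨ *-cong (∏-indicator X u (allFin N) (allFin⁺ N) (∈-allFin u)) (∏-multiplicity X us) ⟩
    X u * ∏ (map X us) ∎

module FunctionField (N : ℕ) where
  open Polynomials {N}

  PositiveZ : ℤ → Set
  PositiveZ c = ∃ λ n → c ≡ + suc n

  Positives : Poly N → Set
  Positives = All (λ t → PositiveZ (proj₁ t))

  -- A condition on the list of terms rather than on collected coefficients: it passes to sums and
  -- products at once, and it rules out cancellation, so the polynomial is nonzero.
  data PositiveP : Poly N → Set where
    positive : ∀ {c e p} → PositiveZ c → Positives p → PositiveP ((c , e) ∷ p)

  coeff-nonneg : ∀ {p} → Positives p → ∀ g → ∃ λ n → coeff p g ≡ + n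
  coeff-nonneg []                              g = 0 , refl
  coeff-nonneg {(c , f) ∷ p} ((n , refl) ∷ ps) g with f ≟M g | coeff-nonneg ps g
  ... | yes _ | k , e = suc n ℕ.+ k , cong (ℤ._+_ (+ suc n)) e
  ... | no _  | k , e = k , e

  positive-nonzero : ∀ {p} → PositiveP p → ¬ p ≋ 0P
  positive-nonzero {(c , f) ∷ p} (positive (n , refl) ps) z = absurd (coefficients z f)
    where
    absurd : ¬ coeff ((+ suc n , f) ∷ p) f ≡ 0ℤ
    absurd with f ≟M f | coeff-nonneg ps f
    ... | yes _ | k , e = λ eq → case (trans (sym (cong (ℤ._+_ (+ suc n)) e)) eq)
      where
      case : ¬ + (suc n ℕ.+ k) ≡ 0ℤ
      case ()
    ... | no ne | _     = ⊥-elim (ne refl)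

  PositiveZ-* : ∀ {c d} → PositiveZ c → PositiveZ d → PositiveZ (c ℤ.* d)
  PositiveZ-* (m , refl) (n , refl) = _ , refl

  All-monomial : ∀ {c} (e : Mono N) {q} → PositiveZ c → Positives q →
    Positives (map (λ { (d , f) → (c ℤ.* d , e ⊕ f) }) q)
  All-monomial e pc qs = Allₚ.map⁺ (All.map (PositiveZ-* pc) qs)

  All-* : ∀ {p q} → Positives p → Positives q →
    Positives (p *P q)
  All-* {[]}          []        qs = []
  All-* {(c , e) ∷ p} (pc ∷ ps) qs = Allₚ.++⁺ (All-monomial e pc qs) (All-* ps qs)

  +P-positive : ∀ {p q} → PositiveP p → PositiveP q → PositiveP (p +P q)
  +P-positive (positive c ps) (positive d qs) = positive c (Allₚ.++⁺ ps (d ∷ qs))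

  *P-positive : ∀ {p q} → PositiveP p → PositiveP q → PositiveP (p *P q)
  *P-positive {(_ , e) ∷ _} (positive c ps) (positive d qs) =
    positive (PositiveZ-* c d) (Allₚ.++⁺ (All-monomial e c qs) (All-* ps (d ∷ qs)))

  1P-positive : PositiveP 1P
  1P-positive = positive (0 , refl) []

  PositiveF : Frac N → Set
  PositiveF f = PositiveP (num f) × PositiveP (den f)

  +F-positive : ∀ {f g} → PositiveF f → PositiveF g → PositiveF (f +F g)
  +F-positive (a , b) (c , d) = +P-positive (*P-positive a d) (*P-positive c b) , *P-positive b d

  *F-positive : ∀ {f g} → PositiveF f → PositiveF g → PositiveF (f *F g)
  *F-positive (a , b) (c , d) = *P-positive a c , *P-positive b d

  /F-positive : ∀ {f g} → PositiveF f → PositiveF g → PositiveF (f /F g)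
  /F-positive (a , b) (c , d) = *P-positive a d , *P-positive b c

  1F-positive : PositiveF 1F
  1F-positive = 1P-positive , 1P-positive

  varF-positive : ∀ i → PositiveF (varF i)
  varF-positive i = positive (0 , refl) [] , 1P-positive

  ^F-positive : ∀ {f} k → PositiveF f → PositiveF (f ^F k)
  ^F-positive zero    p = 1F-positive
  ^F-positive (suc k) p = *F-positive p (^F-positive k p)

  ∏F-positive : ∀ {A : Set} (f : A → Frac N) as → (∀ a → PositiveF (f a)) → PositiveF (∏F (map f as))
  ∏F-positive f []       p = 1F-positive
  ∏F-positive f (a ∷ as) p = *F-positive (p a) (∏F-positive f as p)

  1P≉0P : ¬ 1P ≋ 0P
  1P≉0P = positive-nonzero 1P-positive

  module 𝔽 = DiscreteField (Fractions.fractionField polynomialRing zero?P *P-nonzero 1P≉0P)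
  open Fractions polynomialRing

  𝔽 : DiscreteField
  𝔽 = fractionField zero?P *P-nonzero 1P≉0P

  lift : (f : Frac N) → PositiveF f → 𝔽.Carrier
  lift f p = f , positive-nonzero (proj₂ p)

  lift-nonzero : ∀ f p → ¬ lift f p 𝔽.≈ 𝔽.0#
  lift-nonzero f p z = positive-nonzero (proj₁ p) (zero-numerator zero?P *P-nonzero 1P≉0P (lift f p) z)

  lift-cong : ∀ {f g p q} → f ≡ g → lift f p 𝔽.≈ lift g q
  lift-cong = ≡⇒≃ zero?P *P-nonzero 1P≉0P

  open Products 𝔽 {N} public
  open Mutation {N}

  proj₁-^ : ∀ X k → proj₁ (X ^ k) ≡ proj₁ X ^F k
  proj₁-^ X zero    = refl
  proj₁-^ X (suc k) = cong (proj₁ X *F_) (proj₁-^ X k)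

  proj₁-∏ : ∀ {A : Set} (f : A → 𝔽.Carrier) as → proj₁ (∏ (map f as)) ≡ ∏F (map (proj₁ ∘ f) as)
  proj₁-∏ f []       = refl
  proj₁-∏ f (a ∷ as) = cong (proj₁ (f a) *F_) (proj₁-∏ f as)

  lifted : ∀ {x : Fin N → Frac N} → (∀ v → PositiveF (x v)) → Fin N → 𝔽.Carrier
  lifted {x} pos v = lift (x v) (pos v)

  module _ (B : Fin N → Fin N → ℤ) {x : Fin N → Frac N} (pos : ∀ v → PositiveF (x v)) where

    exchange-positive : ∀ v → PositiveF (exchange B x v)
    exchange-positive v = /F-positive
      (+F-positive (∏F-positive _ (allFin N) (λ y → ^F-positive [ B y v ]₊ (pos y)))
                   (∏F-positive _ (allFin N) (λ y → ^F-positive [ B y v ]₋ (pos y)))) (pos v)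

    private
      X : Fin N → 𝔽.Carrier
      X = lifted pos

    exchange-relation : ∀ v (p : PositiveF (exchange B x v)) →
      lift (exchange B x v) p 𝔽.* X v
        𝔽.≈ ∏ (map (λ y → X y ^ [ B y v ]₊) (allFin N)) 𝔽.+ ∏ (map (λ y → X y ^ [ B y v ]₋) (allFin N))
    exchange-relation v p = /-cancel zero?P *P-nonzero 1P≉0P (lift (exchange B x v) p) (powers [_]₊ 𝔽.+ powers [_]₋) (X v)
      (cong₂ (λ f g → (f +F g) /F x v) (product [_]₊) (product [_]₋))
      where
      powers : (ℤ → ℕ) → 𝔽.Carrier
      powers part = ∏ (map (λ y → X y ^ part (B y v)) (allFin N))
      product : (part : ℤ → ℕ) → ∏F (map (λ y → x y ^F part (B y v)) (allFin N)) ≡ proj₁ (∏ (map (λ y → X y ^ part (B y v)) (allFin N)))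
      product part = sym (trans (proj₁-∏ (λ y → X y ^ part (B y v)) (allFin N))
        (cong ∏F (Listₚ.map-cong (λ y → proj₁-^ (X y) (part (B y v))) (allFin N))))

-- Bipartite belts

difference : Bool → ℕ → ℕ → ℤ
difference true  h v = + h ℤ.- + v
difference false h v = + v ℤ.- + h

difference-not : ∀ κ h v → ℤ.- difference κ h v ≡ difference (not κ) h v
difference-not true  h v = solve 2 (λ h v → :- (h :- v) := v :- h) refl (+ h) (+ v)
  where open ℤSolver.+-*-Solver
difference-not false h v = solve 2 (λ h v → :- (v :- h) := h :- v) refl (+ h) (+ v)
  where open ℤSolver.+-*-Solver

[n-0]₊ : ∀ n → [ + n ℤ.- 0ℤ ]₊ ≡ n
[n-0]₊ n = cong [_]₊ (ℤₚ.+-identityʳ (+ n))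

[n-0]₋ : ∀ n → [ + n ℤ.- 0ℤ ]₋ ≡ 0
[n-0]₋ n = cong [_]₋ (ℤₚ.+-identityʳ (+ n))

[0-n]₊ : ∀ n → [ 0ℤ ℤ.- + n ]₊ ≡ 0
[0-n]₊ zero    = refl
[0-n]₊ (suc n) = refl

[0-n]₋ : ∀ n → [ 0ℤ ℤ.- + n ]₋ ≡ n
[0-n]₋ zero    = refl
[0-n]₋ (suc n) = refl

difference-₊ : ∀ κ h v → h ≡ 0 ⊎ v ≡ 0 → [ difference κ h v ]₊ ≡ (if κ then h else v)
difference-₊ true  .0 v  (inj₁ refl) = [0-n]₊ v
difference-₊ true  h  .0 (inj₂ refl) = [n-0]₊ h
difference-₊ false .0 v  (inj₁ refl) = [n-0]₊ v
difference-₊ false h  .0 (inj₂ refl) = [0-n]₊ h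

difference-₋ : ∀ κ h v → h ≡ 0 ⊎ v ≡ 0 → [ difference κ h v ]₋ ≡ (if κ then v else h)
difference-₋ true  .0 v  (inj₁ refl) = [0-n]₋ v
difference-₋ true  h  .0 (inj₂ refl) = [n-0]₋ h
difference-₋ false .0 v  (inj₁ refl) = [n-0]₋ v
difference-₋ false h  .0 (inj₂ refl) = [0-n]₋ h

-- The exchange matrix is ± (hor − ver), the sign depending on the colour of the column. Mutation at all vertices of one
-- colour negates it, because the arrows created between vertices of the other colour cancel by `commute`.
record Belt (N : ℕ) : Set where
  field
    black      : Fin N → Bool
    hor ver    : Fin N → Fin N → ℕ
    hor-nbrs ver-nbrs : Fin N → List (Fin N)
    hor-count  : ∀ v y → hor y v ≡ multiplicity (hor-nbrs v) y
    ver-count  : ∀ v y → ver y v ≡ multiplicity (ver-nbrs v) y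
    disjoint   : ∀ y z → hor y z ≡ 0 ⊎ ver y z ≡ 0
    hor-color  : ∀ y z → black y ≡ black z → hor y z ≡ 0
    ver-color  : ∀ y z → black y ≡ black z → ver y z ≡ 0
    commute    : ∀ i j → sum (map (λ z → hor i z ℕ.* ver z j) (allFin N)) ≡ sum (map (λ z → ver i z ℕ.* hor z j) (allFin N))

module BeltMutation {N : ℕ} (belt : Belt N) where
  open Belt belt
  open FunctionField N
  open Mutation {N}

  HasMatrix : (Fin N → Bool) → Seed N → Set
  HasMatrix κ s = ∀ y z → B s y z ≡ difference (κ z) (hor y z) (ver y z)

  Positive : Seed N → Set
  Positive s = ∀ v → PositiveF (x s v)

  variable-of : (s : Seed N) → Positive s → Fin N → 𝔽.Carrier
  variable-of s = lifted {x s}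

  neighbours : (Fin N → 𝔽.Carrier) → Fin N → 𝔽.Carrier
  neighbours X v = ∏ (map X (hor-nbrs v)) 𝔽.+ ∏ (map X (ver-nbrs v))

  sum-difference : ∀ (f g : Fin N → ℕ) zs →
    sumℤ (map (λ z → + f z ℤ.- + g z) zs) ≡ + sum (map f zs) ℤ.- + sum (map g zs)
  sum-difference f g []       = refl
  sum-difference f g (z ∷ zs) = trans (cong (ℤ._+_ (+ f z ℤ.- + g z)) (sum-difference f g zs))
    (trans (solve 4 (λ a b c d → (a :- b) :+ (c :- d) := (a :+ c) :- (b :+ d)) refl (+ f z) (+ g z) (+ sum (map f zs)) (+ sum (map g zs)))
      (cong₂ ℤ._-_ (sym (ℤₚ.pos-+ (f z) _)) (sym (ℤₚ.pos-+ (g z) _))))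
    where open ℤSolver.+-*-Solver

  sum-filter : ∀ (c : Fin N → Bool) (f : Fin N → ℕ) → (∀ z → c z ≡ false → f z ≡ 0) → ∀ zs →
    sum (map f (filterᵇ c zs)) ≡ sum (map f zs)
  sum-filter c f z₀ []       = refl
  sum-filter c f z₀ (z ∷ zs) with c z in eq
  ... | true  = cong (f z ℕ.+_) (sum-filter c f z₀ zs)
  ... | false = trans (sum-filter c f z₀ zs) (cong (ℕ._+ sum (map f zs)) (sym (z₀ z eq)))

  -- c selects the vertices to be mutated, κ records the signs of the current matrix. They are
  -- independent data because forward and backward evolution start from the same signs but mutate
  -- opposite colours first.
  module HalfStep (c κ : Fin N → Bool)
    (c-black : ∀ y z → c y ≡ c z → black y ≡ black z)
    (κ-opposite : ∀ y z → c y ≡ true → c z ≡ false → κ y ≡ not (κ z))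
    (s : Seed N) (mat : HasMatrix κ s) (pos : Positive s) where

    s′ : Seed N
    s′ = mutateAll (colored c) s

    hor-zero : ∀ y z → c y ≡ c z → hor y z ≡ 0
    hor-zero y z e = hor-color y z (c-black y z e)

    ver-zero : ∀ y z → c y ≡ c z → ver y z ≡ 0
    ver-zero y z e = ver-color y z (c-black y z e)

    difference-zero : ∀ k y z → c y ≡ c z → difference k (hor y z) (ver y z) ≡ 0ℤ
    difference-zero true  y z e rewrite hor-zero y z e | ver-zero y z e = refl
    difference-zero false y z e rewrite hor-zero y z e | ver-zero y z e = refl

    independent : Independent c (B s)
    independent {i} {j} ci cj = trans (mat i j) (difference-zero (κ j) i j (trans ci (sym cj)))

    B₊ : ∀ y z → [ B s y z ]₊ ≡ (if κ z then hor y z else ver y z)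
    B₊ y z = trans (cong [_]₊ (mat y z)) (difference-₊ (κ z) _ _ (disjoint y z))

    B₋ : ∀ y z → [ B s y z ]₋ ≡ (if κ z then ver y z else hor y z)
    B₋ y z = trans (cong [_]₋ (mat y z)) (difference-₋ (κ z) _ _ (disjoint y z))

    -- Every path between i and j through z has one horizontal and one vertical arrow. Read from i
    -- to j, they come in one order for i → z → j and in the other for j → z → i, and `commute` says
    -- that both orders have the same total.
    paths-zero : ∀ i j → c i ≡ false → c j ≡ false → sumℤ (map (λ z → paths (B s) z i j) (colored c)) ≡ 0ℤ
    paths-zero i j ci cj = begin
      sumℤ (map (λ z → paths (B s) z i j) (colored c))
        ≡⟨ cong sumℤ (Listₚ.map-cong-local (All.map (λ {z} → path z) (colored-Colored c))) ⟩
      sumℤ (map (λ z → + f (κ j) z ℤ.- + f (not (κ j)) z) (colored c))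
        ≡⟨ sum-difference (f (κ j)) (f (not (κ j))) (colored c) ⟩
      + sum (map (f (κ j)) (colored c)) ℤ.- + sum (map (f (not (κ j))) (colored c))
        ≡⟨ cong₂ (λ a b → + a ℤ.- + b) (total (κ j)) (total (not (κ j))) ⟩
      + sum (map (f true) (allFin N)) ℤ.- + sum (map (f true) (allFin N))
        ≡⟨ ℤₚ.+-inverseʳ (+ sum (map (f true) (allFin N))) ⟩
      0ℤ ∎
      where
      open ≡-Reasoning
      f : Bool → Fin N → ℕ
      f true  z = ver i z ℕ.* hor z j
      f false z = hor i z ℕ.* ver z j
      path′ : ∀ z k → [ B s i z ]₊ ≡ (if not k then hor i z else ver i z) → [ B s i z ]₋ ≡ (if not k then ver i z else hor i z) →
        [ B s z j ]₊ ≡ (if k then hor z j else ver z j) → [ B s z j ]₋ ≡ (if k then ver z j else hor z j) →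
        paths (B s) z i j ≡ + f k z ℤ.- + f (not k) z
      path′ z true  a b d e = cong₂ (λ p q → + p ℤ.- + q) (cong₂ ℕ._*_ a d) (cong₂ ℕ._*_ b e)
      path′ z false a b d e = cong₂ (λ p q → + p ℤ.- + q) (cong₂ ℕ._*_ a d) (cong₂ ℕ._*_ b e)
      path : ∀ z → c z ≡ true → paths (B s) z i j ≡ + f (κ j) z ℤ.- + f (not (κ j)) z
      path z cz = path′ z (κ j)
        (trans (B₊ i z) (cong (λ k → if k then hor i z else ver i z) (κ-opposite z j cz cj)))
        (trans (B₋ i z) (cong (λ k → if k then ver i z else hor i z) (κ-opposite z j cz cj)))
        (B₊ z j) (B₋ z j)
      f-zero : ∀ k z → c z ≡ false → f k z ≡ 0
      f-zero true  z cz = cong (ℕ._* hor z j) (ver-zero i z (trans ci (sym cz)))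
      f-zero false z cz = cong (ℕ._* ver z j) (hor-zero i z (trans ci (sym cz)))
      total : ∀ k → sum (map (f k) (colored c)) ≡ sum (map (f true) (allFin N))
      total true  = sum-filter c (f true) (f-zero true) (allFin N)
      total false = trans (sum-filter c (f false) (f-zero false) (allFin N)) (commute i j)

    color? : ∀ v → c v ≡ true ⊎ c v ≡ false
    color? v with c v
    ... | true  = inj₁ refl
    ... | false = inj₂ refl

    negated : ∀ y z → B s′ y z ≡ ℤ.- B s y z → B s′ y z ≡ difference (not (κ z)) (hor y z) (ver y z)
    negated y z e = trans e (trans (cong ℤ.-_ (mat y z)) (difference-not (κ z) _ _))

    matrix : HasMatrix (not ∘ κ) s′
    matrix y z with color? z | color? y
    ... | inj₁ cz | _       = negated y z (mutateAll-Bʳ c (colored c) s (colored-Colored c) (colored-unique c) independent y (∈colored c cz))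
    ... | inj₂ _  | inj₁ cy = negated y z (mutateAll-Bˡ c (colored c) s (colored-Colored c) (colored-unique c) independent z (∈colored c cy))
    ... | inj₂ cz | inj₂ cy = trans (mutateAll-B-uncolored c (colored c) s (colored-Colored c) (colored-unique c) independent cy cz)
      (trans (cong₂ ℤ._+_ (trans (mat y z) (difference-zero (κ z) y z (trans cy (sym cz)))) (paths-zero y z cy cz))
             (sym (difference-zero (not (κ z)) y z (trans cy (sym cz)))))

    unchanged : ∀ {v} → c v ≡ false → x s′ v ≡ x s v
    unchanged cv = mutateAll-x-other c (colored c) s (∉colored c cv)

    changed : ∀ {v} → c v ≡ true → x s′ v ≡ exchange (B s) (x s) v
    changed cv = mutateAll-x c (colored c) s (colored-Colored c) (colored-unique c) independent (∈colored c cv)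

    positive′ : Positive s′
    positive′ v with color? v
    ... | inj₁ cv = ≡.subst PositiveF (sym (changed cv)) (exchange-positive (B s) pos v)
    ... | inj₂ cv = ≡.subst PositiveF (sym (unchanged cv)) (pos v)

    X X′ : Fin N → 𝔽.Carrier
    X  = variable-of s pos
    X′ = variable-of s′ positive′

    -- The sign at v only decides which of the two products counts incoming arrows, and the exchange
    -- relation adds both.
    power-sum : ∀ k (e f : Fin N → ℕ) v →
      (∀ y → e y ≡ (if k then hor y v else ver y v)) → (∀ y → f y ≡ (if k then ver y v else hor y v)) →
      ∏ (map (λ y → X y ^ e y) (allFin N)) 𝔽.+ ∏ (map (λ y → X y ^ f y) (allFin N)) 𝔽.≈ neighbours X v
    power-sum k e f v eh fh = finish k eh fh
      where
      product : ∀ (e : Fin N → ℕ) us → (∀ y → e y ≡ multiplicity us y) → ∏ (map (λ y → X y ^ e y) (allFin N)) 𝔽.≈ ∏ (map X us)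
      product e us h = 𝔽.trans (𝔽.reflexive (cong ∏ (Listₚ.map-cong (λ y → cong (X y ^_) (h y)) (allFin N)))) (∏-multiplicity X us)
      finish : ∀ k → (∀ y → e y ≡ (if k then hor y v else ver y v)) → (∀ y → f y ≡ (if k then ver y v else hor y v)) →
        ∏ (map (λ y → X y ^ e y) (allFin N)) 𝔽.+ ∏ (map (λ y → X y ^ f y) (allFin N)) 𝔽.≈ neighbours X v
      finish true  eh fh = 𝔽.+-cong (product e (hor-nbrs v) (λ y → trans (eh y) (hor-count v y)))
                                    (product f (ver-nbrs v) (λ y → trans (fh y) (ver-count v y)))
      finish false eh fh = 𝔽.trans (𝔽.+-cong (product e (ver-nbrs v) (λ y → trans (eh y) (ver-count v y)))
                                             (product f (hor-nbrs v) (λ y → trans (fh y) (hor-count v y))))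
                                   (𝔽.+-comm (∏ (map X (ver-nbrs v))) (∏ (map X (hor-nbrs v))))

    relation : ∀ {v} → c v ≡ true → X′ v 𝔽.* X v 𝔽.≈ neighbours X v
    relation {v} cv = 𝔽.trans (𝔽.*-congʳ {X v} (lift-cong {p = positive′ v} {q = exchange-positive (B s) pos v} (changed cv)))
      (𝔽.trans (exchange-relation (B s) pos v (exchange-positive (B s) pos v))
        (power-sum (κ v) (λ y → [ B s y v ]₊) (λ y → [ B s y v ]₋) v (λ y → B₊ y v) (λ y → B₋ y v)))

  neighbours-cong : ∀ {X Y : Fin N → 𝔽.Carrier} v → (∀ {u} → black u ≢ black v → X u 𝔽.≈ Y u) → neighbours X v 𝔽.≈ neighbours Y v
  neighbours-cong v e = 𝔽.+-cong
    (∏-cong (hor-nbrs v) (λ {u} i → e (λ same → multiplicity-∈ (hor-nbrs v) i (trans (sym (hor-count v u)) (hor-color u v same)))))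
    (∏-cong (ver-nbrs v) (λ {u} i → e (λ same → multiplicity-∈ (ver-nbrs v) i (trans (sym (ver-count v u)) (ver-color u v same)))))

  module FullStep (c c̄ : Fin N → Bool) (c̄-not : ∀ u → c̄ u ≡ not (c u))
    (c-black : ∀ y z → c y ≡ c z → black y ≡ black z)
    (black-c : ∀ y z → black y ≡ black z → c y ≡ c z)
    (s : Seed N) (mat : HasMatrix black s) (pos : Positive s) where

    opposite : ∀ y z → c y ≢ c z → black y ≡ not (black z)
    opposite y z ne = Boolₚ.¬-not (ne ∘ black-c y z)

    true≢false : ∀ {a b : Bool} → a ≡ true → b ≡ false → a ≢ b
    true≢false refl refl ()

    module First = HalfStep c black c-black (λ y z cy cz → opposite y z (true≢false cy cz)) s mat pos
    module Second = HalfStep c̄ (not ∘ black)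
      (λ y z e → c-black y z (Boolₚ.not-injective (trans (sym (c̄-not y)) (trans e (c̄-not z)))))
      (λ y z cy cz → cong not (opposite y z (λ e → true≢false cy cz (trans (c̄-not y) (trans (cong not e) (sym (c̄-not z)))))))
      First.s′ First.matrix First.positive′

    s″ : Seed N
    s″ = Second.s′

    positive″ : Positive s″
    positive″ = Second.positive′

    matrix″ : HasMatrix black s″
    matrix″ y z = trans (Second.matrix y z) (cong (λ k → difference k (hor y z) (ver y z)) (Boolₚ.not-involutive (black z)))

    X X″ : Fin N → 𝔽.Carrier
    X  = variable-of s pos
    X″ = variable-of s″ positive″

    relation-first : ∀ {v} → c v ≡ true → X″ v 𝔽.* X v 𝔽.≈ neighbours X v
    relation-first {v} cv = 𝔽.trans
      (𝔽.*-congʳ {X v} (lift-cong {p = positive″ v} {q = First.positive′ v} (Second.unchanged (trans (c̄-not v) (cong not cv)))))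
      (First.relation cv)

    -- The neighbours of v have the other colour: they were renewed in the first half-step and stay
    -- fixed in the second, so their values are already the final ones.
    relation-second : ∀ {v} → c v ≡ false → X″ v 𝔽.* X v 𝔽.≈ neighbours X″ v
    relation-second {v} cv = 𝔽.trans
      (𝔽.*-congˡ {X″ v} (lift-cong {p = pos v} {q = First.positive′ v} (sym (First.unchanged cv))))
      (𝔽.trans (Second.relation (trans (c̄-not v) (cong not cv)))
        (neighbours-cong v (λ {u} ne → lift-cong {p = First.positive′ u} {q = positive″ u}
          (sym (Second.unchanged (trans (c̄-not u) (cong not (Boolₚ.¬-not {c u} {false} (λ cu → ne (c-black u v (trans cu (sym cv))))))))))))

open import Data.Bool using (_∧_; _∨_)

-- Box products

indicator-cong : ∀ {P Q : Set} (p : Dec P) (q : Dec Q) → (P → Q) → (Q → P) → ind (does p) ≡ ind (does q)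
indicator-cong (yes _) (yes _) _ _ = refl
indicator-cong (no _)  (no _)  _ _ = refl
indicator-cong (yes p) (no ¬q) f _ = ⊥-elim (¬q (f p))
indicator-cong (no ¬p) (yes q) _ g = ⊥-elim (¬p (g q))

indicator-yes : ∀ {P : Set} (p : Dec P) → P → ind (does p) ≡ 1
indicator-yes p x = cong ind (dec-true p x)

indicator-no : ∀ {P : Set} (p : Dec P) → ¬ P → ind (does p) ≡ 0
indicator-no p x = cong ind (dec-false p x)

sum-indicator-list : ∀ {N} (u : Fin N) k zs → Unique zs → u ∈ zs → sum (map (λ z → ind (does (z ≟F u)) ℕ.* k) zs) ≡ k
sum-indicator-list {N} u k (.u ∷ zs) (n ∷ _) (here refl) =
  trans (cong₂ ℕ._+_ (trans (cong (ℕ._* k) (indicator-yes (u ≟F u) refl)) (ℕₚ.*-identityˡ k)) (rest zs n)) (ℕₚ.+-identityʳ k)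
  where
  rest : ∀ zs → All (u ≢_) zs → sum (map (λ z → ind (does (z ≟F u)) ℕ.* k) zs) ≡ 0
  rest []       []       = refl
  rest (z ∷ zs) (n ∷ ns) = cong₂ ℕ._+_ (cong (ℕ._* k) (indicator-no (z ≟F u) (n ∘ sym))) (rest zs ns)
sum-indicator-list u k (z ∷ zs) (n ∷ us) (there i) =
  cong₂ ℕ._+_ (cong (ℕ._* k) (indicator-no (z ≟F u) (All.lookup n i))) (sum-indicator-list u k zs us i)

sum-indicator : ∀ {N} (u : Fin N) k (f : Fin N → ℕ) → (∀ z → f z ≡ ind (does (z ≟F u)) ℕ.* k) → sum (map f (allFin N)) ≡ k
sum-indicator {N} u k f e = trans (cong sum (Listₚ.map-cong e (allFin N))) (sum-indicator-list u k (allFin N) (allFin⁺ N) (∈-allFin u))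

multiplicity-++ : ∀ {N} (us ws : List (Fin N)) y → multiplicity (us ++ ws) y ≡ multiplicity us y ℕ.+ multiplicity ws y
multiplicity-++ []       ws y = refl
multiplicity-++ (u ∷ us) ws y = trans (cong (ind (does (y ≟F u)) ℕ.+_) (multiplicity-++ us ws y)) (sym (ℕₚ.+-assoc (ind (does (y ≟F u))) _ _))

record IsBipartite (G : BipGraph) : Set where
  field
    nbrs  : Fin (size G) → List (Fin (size G))
    count : ∀ v y → mult G y v ≡ multiplicity (nbrs v) y
    symm  : ∀ a b → mult G a b ≡ mult G b a
    bip   : ∀ a b → part G a ≡ part G b → mult G a b ≡ 0

module BoxProduct (Q Q′ : BipGraph) (bQ : IsBipartite Q) (bQ′ : IsBipartite Q′) where
  module G  = IsBipartite bQ
  module G′ = IsBipartite bQ′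

  V : Set
  V = Fin (BoxN Q Q′)

  row : V → Fin (size Q)
  row u = proj₁ (remQuot {size Q} (size Q′) u)

  column : V → Fin (size Q′)
  column u = proj₂ (remQuot {size Q} (size Q′) u)

  agree : Bool → Bool → Bool
  agree a b = (a ∧ b) ∨ (not a ∧ not b)

  black : V → Bool
  black u = agree (part Q (row u)) (part Q′ (column u))

  isBlack≡black : ∀ u → isBlack Q Q′ u ≡ black u
  isBlack≡black u with remQuot {size Q} (size Q′) u
  ... | _ , _ = refl

  hor ver : V → V → ℕ
  hor y z = ind (does (row y ≟F row z)) ℕ.* mult Q′ (column y) (column z)
  ver y z = ind (does (column y ≟F column z)) ℕ.* mult Q (row y) (row z)

  row-combine : ∀ q a → row (combine q a) ≡ q
  row-combine q a = cong proj₁ (Finₚ.remQuot-combine {size Q} {size Q′} q a)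

  column-combine : ∀ q a → column (combine q a) ≡ a
  column-combine q a = cong proj₂ (Finₚ.remQuot-combine {size Q} {size Q′} q a)

  combine-row-column : ∀ u → combine (row u) (column u) ≡ u
  combine-row-column = Finₚ.combine-remQuot {size Q} (size Q′)

  ind-combine : ∀ y q a → ind (does (y ≟F combine q a)) ≡ ind (does (row y ≟F q)) ℕ.* ind (does (column y ≟F a))
  ind-combine y q a = cases (row y ≟F q) (column y ≟F a)
    where
    cases : (r : Dec (row y ≡ q)) (c : Dec (column y ≡ a)) → ind (does (y ≟F combine q a)) ≡ ind (does r) ℕ.* ind (does c)
    cases (yes refl) (yes refl) = indicator-yes (y ≟F combine q a) (sym (combine-row-column y))
    cases (yes _) (no c) = indicator-no (y ≟F combine q a) (λ { refl → c (column-combine q a) })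
    cases (no r) _ = indicator-no (y ≟F combine q a) (λ { refl → r (row-combine q a) })

  multiplicity-row : ∀ q as y → ind (does (row y ≟F q)) ℕ.* multiplicity as (column y) ≡ multiplicity (map (combine q) as) y
  multiplicity-row q []       y = ℕₚ.*-zeroʳ (ind (does (row y ≟F q)))
  multiplicity-row q (a ∷ as) y = trans (ℕₚ.*-distribˡ-+ (ind (does (row y ≟F q))) (ind (does (column y ≟F a))) _)
    (cong₂ ℕ._+_ (sym (ind-combine y q a)) (multiplicity-row q as y))

  multiplicity-column : ∀ a qs y → ind (does (column y ≟F a)) ℕ.* multiplicity qs (row y) ≡ multiplicity (map (λ q → combine q a) qs) y
  multiplicity-column a []       y = ℕₚ.*-zeroʳ (ind (does (column y ≟F a)))
  multiplicity-column a (q ∷ qs) y = trans (ℕₚ.*-distribˡ-+ (ind (does (column y ≟F a))) (ind (does (row y ≟F q))) _)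
    (cong₂ ℕ._+_ (trans (ℕₚ.*-comm (ind (does (column y ≟F a))) _) (sym (ind-combine y q a))) (multiplicity-column a qs y))

  agree-cancelˡ : ∀ p {a b} → agree p a ≡ agree p b → a ≡ b
  agree-cancelˡ true  {true}  {true}  _ = refl
  agree-cancelˡ true  {false} {false} _ = refl
  agree-cancelˡ false {true}  {true}  _ = refl
  agree-cancelˡ false {false} {false} _ = refl

  agree-cancelʳ : ∀ p {a b} → agree a p ≡ agree b p → a ≡ b
  agree-cancelʳ p     {true}  {true}  _ = refl
  agree-cancelʳ p     {false} {false} _ = refl
  agree-cancelʳ true  {true}  {false} ()
  agree-cancelʳ true  {false} {true}  ()
  agree-cancelʳ false {true}  {false} ()
  agree-cancelʳ false {false} {true}  ()

  *-indicator : ∀ {P : Set} (p : Dec P) k → (P → k ≡ 0) → ind (does p) ℕ.* k ≡ 0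
  *-indicator (yes p) k z = trans (ℕₚ.*-identityˡ k) (z p)
  *-indicator (no _)  k z = refl

  hor-color : ∀ y z → black y ≡ black z → hor y z ≡ 0
  hor-color y z e = *-indicator (row y ≟F row z) _ λ r →
    G′.bip (column y) (column z) (agree-cancelˡ (part Q (row y)) (trans e (cong (λ q → agree (part Q q) (part Q′ (column z))) (sym r))))

  ver-color : ∀ y z → black y ≡ black z → ver y z ≡ 0
  ver-color y z e = *-indicator (column y ≟F column z) _ λ c →
    G.bip (row y) (row z) (agree-cancelʳ (part Q′ (column y)) (trans e (cong (λ a → agree (part Q (row z)) (part Q′ a)) (sym c))))

  disjoint : ∀ y z → hor y z ≡ 0 ⊎ ver y z ≡ 0
  disjoint y z = cases (row y ≟F row z)
    where
    cases : Dec (row y ≡ row z) → hor y z ≡ 0 ⊎ ver y z ≡ 0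
    cases (no n)  = inj₁ (cong (ℕ._* mult Q′ (column y) (column z)) (indicator-no (row y ≟F row z) n))
    cases (yes e) = inj₂ (*-indicator (column y ≟F column z) _ λ _ → G.bip (row y) (row z) (cong (part Q) e))

  -- The two ways round a rectangle with opposite corners i and j: each sum has a single possible
  -- intermediate corner, and both corners contribute the same product of edge multiplicities.
  commute : ∀ i j → sum (map (λ z → hor i z ℕ.* ver z j) (allFin _)) ≡ sum (map (λ z → ver i z ℕ.* hor z j) (allFin _))
  commute i j = trans (sum-indicator (combine (row i) (column j)) k _ hv) (sym (sum-indicator (combine (row j) (column i)) k _ vh))
    where
    k : ℕ
    k = mult Q′ (column i) (column j) ℕ.* mult Q (row i) (row j)
    hv : ∀ z → hor i z ℕ.* ver z j ≡ ind (does (z ≟F combine (row i) (column j))) ℕ.* k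
    hv z = trans (cases (row i ≟F row z) (column z ≟F column j))
      (cong (ℕ._* k) (sym (trans (ind-combine z (row i) (column j)) (cong (ℕ._* _) (indicator-cong (row z ≟F row i) (row i ≟F row z) sym sym)))))
      where
      cases : (r : Dec (row i ≡ row z)) (c : Dec (column z ≡ column j)) →
        (ind (does r) ℕ.* mult Q′ (column i) (column z)) ℕ.* (ind (does c) ℕ.* mult Q (row z) (row j)) ≡ (ind (does r) ℕ.* ind (does c)) ℕ.* k
      cases (no _) _ = refl
      cases (yes _) (no _) = ℕₚ.*-zeroʳ (1 ℕ.* mult Q′ (column i) (column z))
      cases (yes r) (yes c) = trans (cong₂ (λ a b → (1 ℕ.* mult Q′ (column i) a) ℕ.* (1 ℕ.* mult Q b (row j))) c (sym r))
        (solve 2 (λ x y → (con 1 :* x) :* (con 1 :* y) := (con 1 :* con 1) :* (x :* y)) refl (mult Q′ (column i) (column j)) (mult Q (row i) (row j)))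
        where open ℕSolver.+-*-Solver
    vh : ∀ z → ver i z ℕ.* hor z j ≡ ind (does (z ≟F combine (row j) (column i))) ℕ.* k
    vh z = trans (cases (column i ≟F column z) (row z ≟F row j))
      (cong (ℕ._* k) (sym (trans (ind-combine z (row j) (column i)) (cong (ind (does (row z ≟F row j)) ℕ.*_) (indicator-cong (column z ≟F column i) (column i ≟F column z) sym sym)))))
      where
      cases : (c : Dec (column i ≡ column z)) (r : Dec (row z ≡ row j)) →
        (ind (does c) ℕ.* mult Q (row i) (row z)) ℕ.* (ind (does r) ℕ.* mult Q′ (column z) (column j)) ≡ (ind (does r) ℕ.* ind (does c)) ℕ.* k
      cases (no _) (yes _) = refl
      cases (no _) (no _) = refl
      cases (yes _) (no _) = ℕₚ.*-zeroʳ (1 ℕ.* mult Q (row i) (row z))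
      cases (yes c) (yes r) = trans (cong₂ (λ a b → (1 ℕ.* mult Q (row i) a) ℕ.* (1 ℕ.* mult Q′ b (column j))) r (sym c))
        (solve 2 (λ x y → (con 1 :* y) :* (con 1 :* x) := (con 1 :* con 1) :* (x :* y)) refl (mult Q′ (column i) (column j)) (mult Q (row i) (row j)))
        where open ℕSolver.+-*-Solver

  belt : Belt (BoxN Q Q′)
  belt = record
    { black = black ; hor = hor ; ver = ver
    ; hor-nbrs = λ v → map (combine (row v)) (G′.nbrs (column v))
    ; ver-nbrs = λ v → map (λ q → combine q (column v)) (G.nbrs (row v))
    ; hor-count = λ v y → trans (cong (ind (does (row y ≟F row v)) ℕ.*_) (G′.count (column v) (column y)))
                                (multiplicity-row (row v) (G′.nbrs (column v)) y)
    ; ver-count = λ v y → trans (cong (ind (does (column y ≟F column v)) ℕ.*_) (G.count (row v) (row y)))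
                                (multiplicity-column (column v) (G.nbrs (row v)) y)
    ; disjoint = disjoint
    ; hor-color = hor-color
    ; ver-color = ver-color
    ; commute = commute
    }

  orient′ : Bool → Bool → Bool → Bool
  orient′ p a b = if p then not a ∧ b else a ∧ not b

  orient : Bool → Bool → Bool → Bool
  orient a p r = if a then p ∧ not r else not p ∧ r

  *1 : ∀ M → 1 ℕ.* M ℕ.* 1 ≡ 1 ℕ.* M
  *1 M = ℕₚ.*-identityʳ (1 ℕ.* M)

  *0 : ∀ M → 1 ℕ.* M ℕ.* 0 ≡ 0
  *0 M = ℕₚ.*-zeroʳ (1 ℕ.* M)

  *1+0 : ∀ M → 1 ℕ.* M ℕ.* 1 ℕ.+ 0 ≡ 1 ℕ.* M
  *1+0 M = trans (ℕₚ.+-identityʳ _) (*1 M)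

  *0+0 : ∀ M → 1 ℕ.* M ℕ.* 0 ℕ.+ 0 ≡ 0
  *0+0 M = trans (ℕₚ.+-identityʳ _) (*0 M)

  arrows-same-row : ∀ p a b M → (a ≡ b → M ≡ 0) →
    + (1 ℕ.* M ℕ.* ind (orient′ p a b) ℕ.+ 0) ℤ.- + (1 ℕ.* M ℕ.* ind (orient′ p b a) ℕ.+ 0) ≡ difference (agree p b) (1 ℕ.* M) 0
  arrows-same-row p a b M z with p | a | b
  ... | true  | true  | true  rewrite z refl = refl
  ... | true  | false | false rewrite z refl = refl
  ... | false | true  | true  rewrite z refl = refl
  ... | false | false | false rewrite z refl = refl
  ... | true  | true  | false = cong₂ (λ x y → + x ℤ.- + y) (*0+0 M) (*1+0 M)
  ... | true  | false | true  = cong₂ (λ x y → + x ℤ.- + y) (*1+0 M) (*0+0 M)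
  ... | false | true  | false = cong₂ (λ x y → + x ℤ.- + y) (*1+0 M) (*0+0 M)
  ... | false | false | true  = cong₂ (λ x y → + x ℤ.- + y) (*0+0 M) (*1+0 M)

  arrows-same-column : ∀ a p r M → (p ≡ r → M ≡ 0) →
    + (1 ℕ.* M ℕ.* ind (orient a p r)) ℤ.- + (1 ℕ.* M ℕ.* ind (orient a r p)) ≡ difference (agree r a) 0 (1 ℕ.* M)
  arrows-same-column a p r M z with a | p | r
  ... | true  | true  | true  rewrite z refl = refl
  ... | true  | false | false rewrite z refl = refl
  ... | false | true  | true  rewrite z refl = refl
  ... | false | false | false rewrite z refl = refl
  ... | true  | true  | false = cong₂ (λ x y → + x ℤ.- + y) (*1 M) (*0 M)
  ... | true  | false | true  = cong₂ (λ x y → + x ℤ.- + y) (*0 M) (*1 M)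
  ... | false | true  | false = cong₂ (λ x y → + x ℤ.- + y) (*0 M) (*1 M)
  ... | false | false | true  = cong₂ (λ x y → + x ℤ.- + y) (*1 M) (*0 M)

  difference-00 : ∀ k → difference k 0 0 ≡ 0ℤ
  difference-00 true  = refl
  difference-00 false = refl

  -- In the cyclic orientation of the box product every horizontal arrow ends at a black vertex and
  -- every vertical arrow starts at one. Hence the colour of the second vertex fixes all signs.
  arrows : ∀ q₁ a₁ q₂ a₂ →
    + boxArrows Q Q′ (q₁ , a₁) (q₂ , a₂) ℤ.- + boxArrows Q Q′ (q₂ , a₂) (q₁ , a₁)
      ≡ difference (agree (part Q q₂) (part Q′ a₂)) (ind (does (q₁ ≟F q₂)) ℕ.* mult Q′ a₁ a₂) (ind (does (a₁ ≟F a₂)) ℕ.* mult Q q₁ q₂)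
  arrows q₁ a₁ q₂ a₂ = cases (q₁ ≟F q₂) (q₂ ≟F q₁) (a₁ ≟F a₂) (a₂ ≟F a₁)
    where
    D : Bool → Bool → ℤ → Set
    D e f l = l ≡ difference (agree (part Q q₂) (part Q′ a₂)) (ind e ℕ.* mult Q′ a₁ a₂) (ind f ℕ.* mult Q q₁ q₂)
    cases : (r : Dec (q₁ ≡ q₂)) (r′ : Dec (q₂ ≡ q₁)) (c : Dec (a₁ ≡ a₂)) (c′ : Dec (a₂ ≡ a₁)) → D (does r) (does c)
      ( + (ind (does r) ℕ.* mult Q′ a₁ a₂ ℕ.* ind (orient′ (part Q q₁) (part Q′ a₁) (part Q′ a₂))
           ℕ.+ ind (does c) ℕ.* mult Q q₁ q₂ ℕ.* ind (orient (part Q′ a₁) (part Q q₁) (part Q q₂)))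
      ℤ.- + (ind (does r′) ℕ.* mult Q′ a₂ a₁ ℕ.* ind (orient′ (part Q q₂) (part Q′ a₂) (part Q′ a₁))
           ℕ.+ ind (does c′) ℕ.* mult Q q₂ q₁ ℕ.* ind (orient (part Q′ a₂) (part Q q₂) (part Q q₁))) )
    cases (yes refl) (no n) _ _ = ⊥-elim (n refl)
    cases (no n) (yes refl) _ _ = ⊥-elim (n refl)
    cases _ _ (yes refl) (no n) = ⊥-elim (n refl)
    cases _ _ (no n) (yes refl) = ⊥-elim (n refl)
    cases (yes refl) (yes _) (yes refl) (yes _)
      rewrite G.bip q₁ q₁ refl | G′.bip a₁ a₁ refl = sym (difference-00 (agree (part Q q₁) (part Q′ a₁)))
    cases (no _) (no _) (no _) (no _) = sym (difference-00 (agree (part Q q₂) (part Q′ a₂)))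
    cases (yes refl) (yes _) (no _) (no _) rewrite G′.symm a₂ a₁ =
      arrows-same-row (part Q q₁) (part Q′ a₁) (part Q′ a₂) (mult Q′ a₁ a₂) (G′.bip a₁ a₂)
    cases (no _) (no _) (yes refl) (yes _) rewrite G.symm q₂ q₁ =
      arrows-same-column (part Q′ a₁) (part Q q₁) (part Q q₂) (mult Q q₁ q₂) (G.bip q₁ q₂)

  boxB-difference : ∀ y z → boxB Q Q′ y z ≡ difference (black z) (hor y z) (ver y z)
  boxB-difference y z = arrows (row y) (column y) (row z) (column z)

-- Parity; the path and the cycle as bipartite graphs.

evenᵇ-suc : ∀ k → evenᵇ (suc k) ≡ not (evenᵇ k)
evenᵇ-suc zero          = refl
evenᵇ-suc (suc zero)    = refl
evenᵇ-suc (suc (suc k)) = evenᵇ-suc k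

evenᵇ-suc≢ : ∀ k → evenᵇ k ≢ evenᵇ (suc k)
evenᵇ-suc≢ k e = Boolₚ.not-¬ refl (trans e (evenᵇ-suc k))

-- Empty for k ≥ m, so that products over it treat a missing neighbour as 1.
at : ∀ {m} → ℕ → List (Fin m)
at {m} k with k ℕ.<? m
... | yes k<m = fromℕ< k<m ∷ []
... | no _    = []

multiplicity-at : ∀ {m} k (y : Fin m) → multiplicity (at k) y ≡ ind (toℕ y == k)
multiplicity-at {m} k y with k ℕ.<? m
... | yes k<m = trans (ℕₚ.+-identityʳ _) (indicator-cong (y ≟F fromℕ< k<m) (toℕ y ℕ.≟ k)
  (λ { refl → Finₚ.toℕ-fromℕ< k<m }) (λ e → Finₚ.toℕ-injective (trans e (sym (Finₚ.toℕ-fromℕ< k<m)))))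
... | no k≮m  = sym (indicator-no (toℕ y ℕ.≟ k) (λ { refl → k≮m (Finₚ.toℕ<n y) }))

below : ∀ {m} → ℕ → List (Fin m)
below zero    = []
below (suc k) = at k

multiplicity-below : ∀ {m} k (y : Fin m) → multiplicity (below k) y ≡ ind (k == suc (toℕ y))
multiplicity-below zero    y = refl
multiplicity-below (suc k) y = trans (multiplicity-at k y)
  (indicator-cong (toℕ y ℕ.≟ k) (suc k ℕ.≟ suc (toℕ y)) (λ e → cong suc (sym e)) (λ e → sym (ℕₚ.suc-injective e)))

pathA-bipartite : ∀ m → IsBipartite (pathA m)
pathA-bipartite m = record
  { nbrs  = λ v → below (toℕ v) ++ at (suc (toℕ v))
  ; count = λ v y → sym (trans (multiplicity-++ (below (toℕ v)) (at (suc (toℕ v))) y)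
                               (cong₂ ℕ._+_ (multiplicity-below (toℕ v) y) (multiplicity-at (suc (toℕ v)) y)))
  ; symm  = λ a b → ℕₚ.+-comm (ind (toℕ b == suc (toℕ a))) _
  ; bip   = λ a b e → cong₂ ℕ._+_
      (indicator-no (toℕ b ℕ.≟ suc (toℕ a)) (λ f → evenᵇ-suc≢ (toℕ a) (trans e (cong evenᵇ f))))
      (indicator-no (toℕ a ℕ.≟ suc (toℕ b)) (λ f → evenᵇ-suc≢ (toℕ b) (trans (sym e) (cong evenᵇ f))))
  }

module Cyclic (p : ℕ) where

  next : Fin (suc p) → Fin (suc p)
  next a with suc (toℕ a) ℕ.<? suc p
  ... | yes l = fromℕ< l
  ... | no _  = Fin.zero

  prev : Fin (suc p) → Fin (suc p)
  prev Fin.zero    = fromℕ p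
  prev (Fin.suc a) = inject₁ a

  toℕ-next-< : ∀ a → suc (toℕ a) ℕ.< suc p → toℕ (next a) ≡ suc (toℕ a)
  toℕ-next-< a l with suc (toℕ a) ℕ.<? suc p
  ... | yes k = Finₚ.toℕ-fromℕ< k
  ... | no n  = ⊥-elim (n l)

  next-last : ∀ a → toℕ a ≡ p → next a ≡ Fin.zero
  next-last a e with suc (toℕ a) ℕ.<? suc p
  ... | yes k = ⊥-elim (ℕₚ.<-irrefl (cong suc e) k)
  ... | no n  = refl

  last? : ∀ (a : Fin (suc p)) → suc (toℕ a) ℕ.< suc p ⊎ toℕ a ≡ p
  last? a with suc (toℕ a) ℕ.<? suc p
  ... | yes k = inj₁ k
  ... | no n  = inj₂ (ℕₚ.≤-antisym (ℕₚ.≤-pred (Finₚ.toℕ<n a)) (ℕₚ.≤-pred (ℕₚ.≮⇒≥ n)))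

  next-prev : ∀ a → next (prev a) ≡ a
  next-prev Fin.zero    = next-last (fromℕ p) (Finₚ.toℕ-fromℕ p)
  next-prev (Fin.suc a) = Finₚ.toℕ-injective
    (trans (toℕ-next-< (inject₁ a) (ℕ.s≤s (≡.subst (ℕ._< p) (sym (Finₚ.toℕ-inject₁ a)) (Finₚ.toℕ<n a)))) (cong suc (Finₚ.toℕ-inject₁ a)))

  next-injective : ∀ a b → next a ≡ next b → a ≡ b
  next-injective a b e with last? a | last? b
  ... | inj₁ k | inj₁ l = Finₚ.toℕ-injective (ℕₚ.suc-injective (trans (sym (toℕ-next-< a k)) (trans (cong toℕ e) (toℕ-next-< b l))))
  ... | inj₂ k | inj₂ l = Finₚ.toℕ-injective (trans k (sym l))
  ... | inj₁ k | inj₂ l = ⊥-elim (ℕₚ.0≢1+n (trans (sym (cong toℕ (trans e (next-last b l)))) (toℕ-next-< a k)))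
  ... | inj₂ k | inj₁ l = ⊥-elim (ℕₚ.0≢1+n (trans (sym (cong toℕ (trans (sym e) (next-last a k)))) (toℕ-next-< b l)))

  prev-next : ∀ a → prev (next a) ≡ a
  prev-next a = next-injective (prev (next a)) a (next-prev (next a))

  ind-next : ∀ y v → ind (does (y ≟F next v)) ≡ ind (toℕ y == suc (toℕ v)) ℕ.+ ind ((toℕ y == 0) ∧ (toℕ v == p))
  ind-next y v with last? v
  ... | inj₁ l = trans (indicator-cong (y ≟F next v) (toℕ y ℕ.≟ suc (toℕ v))
                   (λ { refl → toℕ-next-< v l }) (λ e → Finₚ.toℕ-injective (trans e (sym (toℕ-next-< v l)))))
                 (sym (trans (cong (ind (toℕ y == suc (toℕ v)) ℕ.+_) (cong ind
                   (trans (cong ((toℕ y == 0) ∧_) (dec-false (toℕ v ℕ.≟ p) (λ e → ℕₚ.<-irrefl (cong suc e) l))) (Boolₚ.∧-zeroʳ _)))) (ℕₚ.+-identityʳ _)))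
  ... | inj₂ e = trans (indicator-cong (y ≟F next v) (toℕ y ℕ.≟ 0)
                   (λ { refl → cong toℕ (next-last v e) }) (λ z → Finₚ.toℕ-injective (trans z (sym (cong toℕ (next-last v e))))))
                 (sym (cong₂ ℕ._+_ (indicator-no (toℕ y ℕ.≟ suc (toℕ v)) (λ f → ℕₚ.<-irrefl (trans f (cong suc e)) (Finₚ.toℕ<n y)))
                   (cong ind (trans (cong ((toℕ y == 0) ∧_) (dec-true (toℕ v ℕ.≟ p) e)) (Boolₚ.∧-identityʳ _)))))

  ind-prev : ∀ y v → ind (does (y ≟F prev v)) ≡ ind (toℕ v == suc (toℕ y)) ℕ.+ ind ((toℕ v == 0) ∧ (toℕ y == p))
  ind-prev y v = trans (indicator-cong (y ≟F prev v) (v ≟F next y)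
    (λ { refl → sym (next-prev v) }) (λ { refl → sym (prev-next y) })) (ind-next v y)

  module _ (p-odd : evenᵇ p ≡ false) where

    evenᵇ-next : ∀ a → evenᵇ (toℕ (next a)) ≡ not (evenᵇ (toℕ a))
    evenᵇ-next a with last? a
    ... | inj₁ l = trans (cong evenᵇ (toℕ-next-< a l)) (evenᵇ-suc (toℕ a))
    ... | inj₂ e = trans (cong (evenᵇ ∘ toℕ) (next-last a e)) (sym (cong not (trans (cong evenᵇ e) p-odd)))

-- For p = n + suc (n + 0) this is what `cycleA (suc n)` computes to, so results about it apply to
-- the theorem without transport.
cycle : ℕ → BipGraph
cycle p = record
  { size = suc p
  ; mult = λ a b → ind (toℕ b == suc (toℕ a)) ℕ.+ ind (toℕ a == suc (toℕ b))
      ℕ.+ ind ((toℕ a == 0) ∧ (toℕ b == p)) ℕ.+ ind ((toℕ b == 0) ∧ (toℕ a == p))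
  ; part = λ a → evenᵇ (toℕ a)
  }

-- For p = 1 the successor and the predecessor of v coincide; being listed twice, they account for
-- the double edge. Oddness of p keeps the colours alternating across the closing edge.
cycle-bipartite : ∀ p → evenᵇ p ≡ false → IsBipartite (cycle p)
cycle-bipartite p p-odd = record
  { nbrs  = λ v → next v ∷ prev v ∷ []
  ; count = count
  ; symm  = λ a b → solve 4 (λ w x y z → ((w :+ x) :+ y) :+ z := ((x :+ w) :+ z) :+ y) refl
      (ind (toℕ b == suc (toℕ a))) (ind (toℕ a == suc (toℕ b))) (ind ((toℕ a == 0) ∧ (toℕ b == p))) (ind ((toℕ b == 0) ∧ (toℕ a == p)))
  ; bip   = λ a b e → trans (count b a) (cong₂ ℕ._+_
      (indicator-no (a ≟F next b) (λ { refl → Boolₚ.not-¬ refl (trans (sym e) (evenᵇ-next p-odd b)) }))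
      (trans (ℕₚ.+-identityʳ _) (indicator-no (a ≟F prev b)
        (λ { refl → Boolₚ.not-¬ refl (trans e (trans (cong (evenᵇ ∘ toℕ) (sym (next-prev b))) (evenᵇ-next p-odd (prev b)))) }))))
  }
  where
  open Cyclic p
  open ℕSolver.+-*-Solver
  count : ∀ v y → mult (cycle p) y v ≡ multiplicity (next v ∷ prev v ∷ []) y
  count v y = sym (trans (cong₂ ℕ._+_ (ind-next y v) (cong (ℕ._+ 0) (ind-prev y v)))
    (solve 4 (λ w x y z → (x :+ y) :+ ((w :+ z) :+ con 0) := ((w :+ x) :+ y) :+ z) refl
      (ind (toℕ v == suc (toℕ y))) (ind (toℕ y == suc (toℕ v))) (ind ((toℕ y == 0) ∧ (toℕ v == p))) (ind ((toℕ v == 0) ∧ (toℕ y == p)))))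

-- The T-system of a path times a cycle

-- A sequence over ℤ that follows `step` everywhere. It gives halves with parity and residues on the
-- cycle, both governed by a successor rule instead of integer division.
module Walk {S : Set} (start : S) (step back : S → S) (step-back : ∀ s → step (back s) ≡ s) where

  walk : ℤ → S
  walk (+ zero)     = start
  walk (+ suc k)    = step (walk (+ k))
  walk -[1+ zero ]  = back start
  walk -[1+ suc k ] = back (walk -[1+ k ])

  walk-suc : ∀ i → walk (ℤ.suc i) ≡ step (walk i)
  walk-suc (+ k)        = refl
  walk-suc -[1+ zero ]  = sym (step-back start)
  walk-suc -[1+ suc k ] = sym (step-back (walk -[1+ k ]))

-- Moves between the pairs (t is even , ⌊t/2⌋) for consecutive t.
halving-step halving-back : Bool × ℤ → Bool × ℤ
halving-step (e , h) = not e , (if e then h else ℤ.suc h)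
halving-back (e , h) = not e , (if e then ℤ.pred h else h)

halving-step-back : ∀ s → halving-step (halving-back s) ≡ s
halving-step-back (true  , h) = cong (true ,_) (ℤₚ.suc-pred h)
halving-step-back (false , h) = refl

module Halving = Walk (true , 0ℤ) halving-step halving-back halving-step-back

even : ℤ → Bool
even t = proj₁ (Halving.walk t)

half : ℤ → ℤ
half t = proj₂ (Halving.walk t)

even-suc : ∀ t → even (ℤ.suc t) ≡ not (even t)
even-suc t = cong proj₁ (Halving.walk-suc t)

half-suc : ∀ t → half (ℤ.suc t) ≡ (if even t then half t else ℤ.suc (half t))
half-suc t = cong proj₂ (Halving.walk-suc t)

half-suc-even : ∀ t → even t ≡ true → half (ℤ.suc t) ≡ half t
half-suc-even t e = trans (half-suc t) (cong (if_then half t else ℤ.suc (half t)) e)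

half-suc-odd : ∀ t → even t ≡ false → half (ℤ.suc t) ≡ ℤ.suc (half t)
half-suc-odd t e = trans (half-suc t) (cong (if_then half t else ℤ.suc (half t)) e)

half-suc-suc : ∀ t → half (ℤ.suc (ℤ.suc t)) ≡ ℤ.suc (half t)
half-suc-suc t = cases (even t) refl
  where
  cases : ∀ b → even t ≡ b → half (ℤ.suc (ℤ.suc t)) ≡ ℤ.suc (half t)
  cases true  e = trans (half-suc-odd (ℤ.suc t) (trans (even-suc t) (cong not e))) (cong ℤ.suc (half-suc-even t e))
  cases false e = trans (half-suc-even (ℤ.suc t) (trans (even-suc t) (cong not e))) (half-suc-odd t e)

half-double : ∀ t d → half (t ℤ.+ (d ℤ.+ d)) ≡ half t ℤ.+ d
half-double t = ℤ-induction base (λ z e → trans (double z) (trans (cong ℤ.suc e) (move z)))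
  (λ z e → suc-injective (trans (sym (double z)) (trans e (sym (move z)))))
  where
  open ℤSolver.+-*-Solver using (solve; _:=_; _:+_; _:-_; con)
  suc-injective : ∀ {i j} → ℤ.suc i ≡ ℤ.suc j → i ≡ j
  suc-injective {i} {j} e = trans (sym (ℤₚ.pred-suc i)) (trans (cong ℤ.pred e) (ℤₚ.pred-suc j))
  base : half (t ℤ.+ 0ℤ) ≡ half t ℤ.+ 0ℤ
  base = trans (cong half (ℤₚ.+-identityʳ t)) (sym (ℤₚ.+-identityʳ (half t)))
  double : ∀ z → half (t ℤ.+ (ℤ.suc z ℤ.+ ℤ.suc z)) ≡ ℤ.suc (half (t ℤ.+ (z ℤ.+ z)))
  double z = trans (cong half (solve 2 (λ t z → t :+ ((con 1ℤ :+ z) :+ (con 1ℤ :+ z)) := con 1ℤ :+ (con 1ℤ :+ (t :+ (z :+ z)))) refl t z))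
                   (half-suc-suc (t ℤ.+ (z ℤ.+ z)))
  move : ∀ z → ℤ.suc (half t ℤ.+ z) ≡ half t ℤ.+ ℤ.suc z
  move z = solve 2 (λ h z → con 1ℤ :+ (h :+ z) := h :+ (con 1ℤ :+ z)) refl (half t) z

even-difference : ∀ a b → even (a ℤ.- b) ≡ even (a ℤ.+ b)
even-difference a = ℤ-induction refl
  (λ z e → trans (down z) (trans (cong not e) (sym (up z))))
  (λ z e → Boolₚ.not-injective (trans (sym (down z)) (trans e (up z))))
  where
  open ℤSolver.+-*-Solver using (solve; _:=_; _:+_; _:-_; con)
  up : ∀ z → even (a ℤ.+ ℤ.suc z) ≡ not (even (a ℤ.+ z))
  up z = trans (cong even (solve 2 (λ a z → a :+ (con 1ℤ :+ z) := con 1ℤ :+ (a :+ z)) refl a z)) (even-suc (a ℤ.+ z))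
  down : ∀ z → even (a ℤ.- ℤ.suc z) ≡ not (even (a ℤ.- z))
  down z = trans (sym (Boolₚ.not-involutive _)) (cong not (trans (sym (even-suc (a ℤ.- ℤ.suc z)))
    (cong even (solve 2 (λ a z → con 1ℤ :+ (a :- (con 1ℤ :+ z)) := a :- z) refl a z))))

-- `⟦ i ⟧` is the residue of i modulo p + 1, reached by walking round the cycle, so that neighbours
-- on the cycle match neighbours in ℤ.
module Residues (p : ℕ) where
  open Cyclic p public
  open Walk {Fin (suc p)} Fin.zero next prev next-prev public renaming (walk to ⟦_⟧; walk-suc to ⟦⟧-suc)

  toℕ-⟦⟧ : ∀ k → k ℕ.< suc p → toℕ ⟦ + k ⟧ ≡ k
  toℕ-⟦⟧ zero    l = refl
  toℕ-⟦⟧ (suc k) l = trans (toℕ-next-< ⟦ + k ⟧ (subst (λ j → suc j ℕ.< suc p) (sym IH) l)) (cong suc IH)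
    where
    IH : toℕ ⟦ + k ⟧ ≡ k
    IH = toℕ-⟦⟧ k (ℕₚ.<-trans (ℕₚ.n<1+n k) l)

  ⟦toℕ⟧ : ∀ a → ⟦ + toℕ a ⟧ ≡ a
  ⟦toℕ⟧ a = Finₚ.toℕ-injective (toℕ-⟦⟧ (toℕ a) (Finₚ.toℕ<n a))

  ⟦⟧-periodic : ∀ i → ⟦ i ℤ.+ + suc p ⟧ ≡ ⟦ i ⟧
  ⟦⟧-periodic = ℤ-induction (next-last ⟦ + p ⟧ (toℕ-⟦⟧ p (ℕₚ.n<1+n p)))
    (λ z e → trans (up z) (trans (cong next e) (sym (⟦⟧-suc z))))
    (λ z e → next-injective _ _ (trans (sym (up z)) (trans e (⟦⟧-suc z))))
    where
    up : ∀ z → ⟦ ℤ.suc z ℤ.+ + suc p ⟧ ≡ next ⟦ z ℤ.+ + suc p ⟧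
    up z = trans (cong ⟦_⟧ (ℤₚ.+-assoc 1ℤ z (+ suc p))) (⟦⟧-suc (z ℤ.+ + suc p))

  prev-⟦suc⟧ : ∀ i → prev ⟦ ℤ.suc i ⟧ ≡ ⟦ i ⟧
  prev-⟦suc⟧ i = trans (cong prev (⟦⟧-suc i)) (prev-next ⟦ i ⟧)

  evenᵇ-⟦⟧ : evenᵇ p ≡ false → ∀ i → evenᵇ (toℕ ⟦ i ⟧) ≡ even i
  evenᵇ-⟦⟧ p-odd = ℤ-induction refl
    (λ z e → trans (up z) (trans (cong not e) (sym (even-suc z))))
    (λ z e → Boolₚ.not-injective (trans (sym (up z)) (trans e (even-suc z))))
    where
    up : ∀ z → evenᵇ (toℕ ⟦ ℤ.suc z ⟧) ≡ not (evenᵇ (toℕ ⟦ z ⟧))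
    up z = trans (cong (evenᵇ ∘ toℕ) (⟦⟧-suc z)) (evenᵇ-next p-odd ⟦ z ⟧)

at-toℕ : ∀ {m} (p : Fin m) → at (toℕ p) ≡ p ∷ []
at-toℕ {m} p with toℕ p ℕ.<? m
... | yes l = cong (_∷ []) (Finₚ.fromℕ<-toℕ p l)
... | no n  = ⊥-elim (n (Finₚ.toℕ<n p))

at-cases : ∀ m k → at {m} k ≡ [] ⊎ ∃ λ p → at {m} k ≡ p ∷ []
at-cases m k with k ℕ.<? m
... | yes l = inj₂ (fromℕ< l , refl)
... | no n  = inj₁ refl

at-≥ : ∀ m → at {m} m ≡ []
at-≥ m with m ℕ.<? m
... | yes l = ⊥-elim (ℕₚ.<-irrefl refl l)
... | no _  = refl

module Belts (m p : ℕ) (p-odd : evenᵇ p ≡ false) where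

  Q Q′ : BipGraph
  Q  = pathA m
  Q′ = cycle p

  N : ℕ
  N = BoxN Q Q′

  open BoxProduct Q Q′ (pathA-bipartite m) (cycle-bipartite p p-odd)
  open BeltMutation belt
  open FunctionField N
  open Residues p
  open 𝔽 using (_≈_; _+_; _*_; 1#; 0#) renaming (Carrier to K)

  record Good (s : Seed N) : Set where
    field
      matrix : HasMatrix black s
      pos    : Positive s
  open Good

  good₀ : Good (initialSeed Q Q′)
  good₀ = record { matrix = boxB-difference ; pos = varF-positive }

  white : V → Bool
  white u = not (isBlack Q Q′ u)

  isBlack⇒black : ∀ y z → isBlack Q Q′ y ≡ isBlack Q Q′ z → black y ≡ black z
  isBlack⇒black y z e = trans (sym (isBlack≡black y)) (trans e (isBlack≡black z))

  black⇒isBlack : ∀ y z → black y ≡ black z → isBlack Q Q′ y ≡ isBlack Q Q′ z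
  black⇒isBlack y z e = trans (isBlack≡black y) (trans e (sym (isBlack≡black z)))

  module Forward {s} (g : Good s) = FullStep (isBlack Q Q′) white (λ _ → refl) isBlack⇒black black⇒isBlack s (matrix g) (pos g)

  module Backward {s} (g : Good s) = FullStep white (isBlack Q Q′) (λ u → sym (Boolₚ.not-involutive _))
    (λ y z e → isBlack⇒black y z (Boolₚ.not-injective e)) (λ y z e → cong not (black⇒isBlack y z e)) s (matrix g) (pos g)

  good-forward : ∀ k → Good (iterate k (λ s → μ₋ Q Q′ (μ₊ Q Q′ s)) (initialSeed Q Q′))
  good-forward zero    = good₀
  good-forward (suc k) = record { matrix = Forward.matrix″ (good-forward k) ; pos = Forward.positive″ (good-forward k) }

  good-backward : ∀ k → Good (iterate k (λ s → μ₊ Q Q′ (μ₋ Q Q′ s)) (initialSeed Q Q′))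
  good-backward zero    = good₀
  good-backward (suc k) = record { matrix = Backward.matrix″ (good-backward k) ; pos = Backward.positive″ (good-backward k) }

  μPow-positive : ∀ k v → PositiveF (μPow Q Q′ k v)
  μPow-positive (+ k)    = pos (good-forward k)
  μPow-positive -[1+ k ] = pos (good-backward (suc k))

  X : ℤ → V → K
  X k v = lift (μPow Q Q′ k v) (μPow-positive k v)

  -- An exchange relation is symmetric in the old and the new variable, so both directions of time
  -- give the same form. Backwards, black vertices are mutated second and see renewed neighbours,
  -- which are again those at time k.
  black-relation : ∀ k {v} → isBlack Q Q′ v ≡ true → X (ℤ.suc k) v * X k v ≈ neighbours (X k) v
  black-relation (+ k)        b = Forward.relation-first (good-forward k) b
  black-relation -[1+ zero ]  {v} b = 𝔽.trans (𝔽.*-comm (X 0ℤ v) (X -[1+ 0 ] v)) (Backward.relation-second good₀ (cong not b))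
  black-relation -[1+ suc k ] {v} b = 𝔽.trans (𝔽.*-comm (X -[1+ k ] v) (X -[1+ suc k ] v)) (Backward.relation-second (good-backward (suc k)) (cong not b))

  white-relation : ∀ k {v} → isBlack Q Q′ v ≡ false → X (ℤ.suc k) v * X k v ≈ neighbours (X (ℤ.suc k)) v
  white-relation (+ k)        w = Forward.relation-second (good-forward k) w
  white-relation -[1+ zero ]  {v} w = 𝔽.trans (𝔽.*-comm (X 0ℤ v) (X -[1+ 0 ] v)) (Backward.relation-first good₀ (cong not w))
  white-relation -[1+ suc k ] {v} w = 𝔽.trans (𝔽.*-comm (X -[1+ k ] v) (X -[1+ suc k ] v)) (Backward.relation-first (good-backward (suc k)) (cong not w))

  column-product : (V → K) → List (Fin m) → Fin (suc p) → K
  column-product Y ps a = ∏ (map (λ r → Y (combine r a)) ps)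

  -- α − β is the position on the unfolded cycle and q + α + β the time in half-steps of μ: at the vertex (q , α − β) it is
  -- even exactly when the vertex is black. The lattice is the one in which T j becomes the contiguous j × j minor of T 1.
  T : ℕ → ℤ → ℤ → K
  T zero    α β = 1#
  T (suc q) α β = column-product (X (half (+ q ℤ.+ (α ℤ.+ β)))) (at q) ⟦ α ℤ.- β ⟧

  column-product-single : ∀ Y q a → column-product Y (at (toℕ q)) a ≈ Y (combine q a)
  column-product-single Y q a = 𝔽.trans (𝔽.reflexive (cong (λ ps → column-product Y ps a) (at-toℕ q))) (𝔽.*-identityʳ (Y (combine q a)))

  ∏-++ : ∀ (xs ys : List K) → ∏ (xs ++ ys) ≈ ∏ xs * ∏ ys
  ∏-++ []       ys = 𝔽.sym (𝔽.*-identityˡ (∏ ys))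
  ∏-++ (x ∷ xs) ys = 𝔽.trans (𝔽.*-congˡ {x} (∏-++ xs ys)) (𝔽.sym (𝔽.*-assoc x (∏ xs) (∏ ys)))

  -- These are the two terms of the T-system. A neighbour missing at an end of the path gives an
  -- empty product, hence the boundary value 1.
  neighbours-combine : ∀ Y q a → neighbours Y (combine q a)
    ≈ Y (combine q (next a)) * Y (combine q (prev a)) + column-product Y (at (suc (toℕ q))) a * column-product Y (below (toℕ q)) a
  neighbours-combine Y q a =
    𝔽.trans (𝔽.reflexive (cong₂ (λ r c → ∏ (map Y (map (combine r) (next c ∷ prev c ∷ [])))
                                        + ∏ (map Y (map (λ s → combine s c) (below (toℕ r) ++ at (suc (toℕ r))))))
                           (row-combine q a) (column-combine q a)))
      (𝔽.+-cong (𝔽.*-congˡ {Y (combine q (next a))} (𝔽.*-identityʳ (Y (combine q (prev a)))))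
        (𝔽.trans (𝔽.reflexive (trans (cong ∏ (sym (Listₚ.map-∘ (below (toℕ q) ++ at (suc (toℕ q))))))
                                     (cong ∏ (Listₚ.map-++ (λ r → Y (combine r a)) (below (toℕ q)) (at (suc (toℕ q)))))))
          (𝔽.trans (∏-++ (map (λ r → Y (combine r a)) (below (toℕ q))) (map (λ r → Y (combine r a)) (at (suc (toℕ q)))))
            (𝔽.*-comm (column-product Y (below (toℕ q)) a) (column-product Y (at (suc (toℕ q))) a)))))

  agree-not : ∀ a b → agree (not a) b ≡ not (agree a b)
  agree-not true  true  = refl
  agree-not true  false = refl
  agree-not false true  = refl
  agree-not false false = refl

  agree-true : ∀ b → agree true b ≡ b
  agree-true true  = refl
  agree-true false = refl

  even-+ : ∀ q t → even (+ q ℤ.+ t) ≡ agree (evenᵇ q) (even t)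
  even-+ zero    t = trans (cong even (ℤₚ.+-identityˡ t)) (sym (agree-true (even t)))
  even-+ (suc q) t = trans (cong even (ℤₚ.+-assoc 1ℤ (+ q) t)) (trans (even-suc (+ q ℤ.+ t))
    (trans (cong not (even-+ q t)) (trans (sym (agree-not (evenᵇ q) (even t))) (cong (λ e → agree e (even t)) (sym (evenᵇ-suc q))))))

  isBlack-even : ∀ q α β → isBlack Q Q′ (combine q ⟦ α ℤ.- β ⟧) ≡ even (+ toℕ q ℤ.+ (α ℤ.+ β))
  isBlack-even q α β = trans (isBlack≡black (combine q ⟦ α ℤ.- β ⟧))
    (trans (cong₂ (λ r c → agree (evenᵇ (toℕ r)) (evenᵇ (toℕ c))) (row-combine q ⟦ α ℤ.- β ⟧) (column-combine q ⟦ α ℤ.- β ⟧))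
      (trans (cong (agree (evenᵇ (toℕ q))) (trans (evenᵇ-⟦⟧ p-odd (α ℤ.- β)) (even-difference α β)))
        (sym (even-+ (toℕ q) (α ℤ.+ β)))))

  -- This is the exchange relation at the vertex (q, α - β), with t = q + α + β. All four factors on
  -- the right sit at half-time t + 1. For even t the vertex is black and `half` does not change
  -- from t to t + 1; for odd t it is white and `half` goes up by one. These are the times at which
  -- the two relations above take the neighbours.
  T-step-Fin : ∀ q α β →
    T (suc (toℕ q)) α β * T (suc (toℕ q)) (ℤ.suc α) (ℤ.suc β)
      ≈ T (suc (toℕ q)) (ℤ.suc α) β * T (suc (toℕ q)) α (ℤ.suc β) + T (suc (suc (toℕ q))) α β * T (toℕ q) (ℤ.suc α) (ℤ.suc β)
  T-step-Fin q α β = 𝔽.trans left (𝔽.trans (mutation (even t) refl) (𝔽.sym right))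
    where
    open ℤSolver.+-*-Solver using (solve; _:=_; _:+_; _:-_; con)
    t : ℤ
    t = + toℕ q ℤ.+ (α ℤ.+ β)
    a : Fin (suc p)
    a = ⟦ α ℤ.- β ⟧
    v : V
    v = combine q a
    Y : V → K
    Y = X (half (ℤ.suc t))
    same-column : ⟦ ℤ.suc α ℤ.- ℤ.suc β ⟧ ≡ a
    same-column = cong ⟦_⟧ (solve 2 (λ α β → (con 1ℤ :+ α) :- (con 1ℤ :+ β) := α :- β) refl α β)
    T-at : ∀ {α′ β′ k b} → half (+ toℕ q ℤ.+ (α′ ℤ.+ β′)) ≡ k → ⟦ α′ ℤ.- β′ ⟧ ≡ b → T (suc (toℕ q)) α′ β′ ≈ X k (combine q b)
    T-at {α′} {β′} refl refl = column-product-single (X (half (+ toℕ q ℤ.+ (α′ ℤ.+ β′)))) q ⟦ α′ ℤ.- β′ ⟧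
    left : T (suc (toℕ q)) α β * T (suc (toℕ q)) (ℤ.suc α) (ℤ.suc β) ≈ X (ℤ.suc (half t)) v * X (half t) v
    left = 𝔽.trans (𝔽.*-cong (T-at {α} {β} refl refl)
      (T-at {ℤ.suc α} {ℤ.suc β} (trans (cong half (solve 3 (λ q α β → q :+ ((con 1ℤ :+ α) :+ (con 1ℤ :+ β)) := con 1ℤ :+ (con 1ℤ :+ (q :+ (α :+ β)))) refl (+ toℕ q) α β))
                         (half-suc-suc t)) same-column))
      (𝔽.*-comm (X (half t) v) (X (ℤ.suc (half t)) v))
    mutation : ∀ b → even t ≡ b → X (ℤ.suc (half t)) v * X (half t) v ≈ neighbours Y v
    mutation true  e = 𝔽.trans (black-relation (half t) (trans (isBlack-even q α β) e))
      (𝔽.reflexive (cong (λ k → neighbours (X k) v) (sym (half-suc-even t e))))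
    mutation false e = 𝔽.trans (white-relation (half t) (trans (isBlack-even q α β) e))
      (𝔽.reflexive (cong (λ k → neighbours (X k) v) (sym (half-suc-odd t e))))
    upper : T (suc (suc (toℕ q))) α β ≡ column-product Y (at (suc (toℕ q))) a
    upper = cong (λ s → column-product (X (half s)) (at (suc (toℕ q))) a) (ℤₚ.+-assoc 1ℤ (+ toℕ q) (α ℤ.+ β))
    lower : ∀ k → T k (ℤ.suc α) (ℤ.suc β) ≡ column-product (X (half (ℤ.suc (+ k ℤ.+ (α ℤ.+ β))))) (below k) a
    lower zero    = refl
    lower (suc k) = cong₂ (λ s b → column-product (X (half s)) (at k) b)
      (solve 3 (λ k α β → k :+ ((con 1ℤ :+ α) :+ (con 1ℤ :+ β)) := con 1ℤ :+ ((con 1ℤ :+ k) :+ (α :+ β))) refl (+ k) α β) same-column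
    right : T (suc (toℕ q)) (ℤ.suc α) β * T (suc (toℕ q)) α (ℤ.suc β) + T (suc (suc (toℕ q))) α β * T (toℕ q) (ℤ.suc α) (ℤ.suc β)
      ≈ neighbours Y v
    right = 𝔽.trans (𝔽.+-cong
      (𝔽.*-cong
        (T-at {ℤ.suc α} {β} (cong half (solve 3 (λ q α β → q :+ ((con 1ℤ :+ α) :+ β) := con 1ℤ :+ (q :+ (α :+ β))) refl (+ toℕ q) α β))
              (trans (cong ⟦_⟧ (ℤₚ.+-assoc 1ℤ α (ℤ.- β))) (⟦⟧-suc (α ℤ.- β))))
        (T-at {α} {ℤ.suc β} (cong half (solve 3 (λ q α β → q :+ (α :+ (con 1ℤ :+ β)) := con 1ℤ :+ (q :+ (α :+ β))) refl (+ toℕ q) α β))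
              (trans (sym (prev-⟦suc⟧ (α ℤ.- ℤ.suc β)))
                     (cong (prev ∘ ⟦_⟧) (solve 2 (λ α β → con 1ℤ :+ (α :- (con 1ℤ :+ β)) := α :- β) refl α β)))))
      (𝔽.*-cong (𝔽.reflexive upper) (𝔽.reflexive (lower (toℕ q)))))
      (𝔽.sym (neighbours-combine Y q a))

  1≉0 : ¬ 1# ≈ 0#
  1≉0 = lift-nonzero 1F 1F-positive

  T-nonzero : ∀ j α β → ¬ T j α β ≈ 0#
  T-nonzero zero    α β = 1≉0
  T-nonzero (suc q) α β = cases (at-cases m q)
    where
    k : ℤ
    k = half (+ q ℤ.+ (α ℤ.+ β))
    cases : at {m} q ≡ [] ⊎ (∃ λ r → at {m} q ≡ r ∷ []) → ¬ T (suc q) α β ≈ 0#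
    cases (inj₁ e) z = 1≉0 (𝔽.trans (𝔽.reflexive (cong (λ rs → column-product (X k) rs ⟦ α ℤ.- β ⟧) (sym e))) z)
    cases (inj₂ (r , e)) z = lift-nonzero (μPow Q Q′ k u) (μPow-positive k u)
      (𝔽.trans (𝔽.sym (𝔽.*-identityʳ (X k u))) (𝔽.trans (𝔽.reflexive (cong (λ rs → column-product (X k) rs ⟦ α ℤ.- β ⟧) (sym e))) z))
      where
      u : V
      u = combine r ⟦ α ℤ.- β ⟧

  open TSystem 𝔽

  isTSystem : IsTSystem m (+ suc p) T
  isTSystem = record
    { bottom  = λ α β → 𝔽.refl
    ; top     = λ α β → 𝔽.reflexive (cong (λ rs → column-product (X (half (+ m ℤ.+ (α ℤ.+ β)))) rs ⟦ α ℤ.- β ⟧) (at-≥ m))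
    ; step    = λ j α β j<m → subst
        (λ j → T (suc j) α β * T (suc j) (ℤ.suc α) (ℤ.suc β) ≈ T (suc j) (ℤ.suc α) β * T (suc j) α (ℤ.suc β) + T (suc (suc j)) α β * T j (ℤ.suc α) (ℤ.suc β))
        (Finₚ.toℕ-fromℕ< j<m) (T-step-Fin (fromℕ< j<m) α β)
    ; nonzero = λ j α β _ → T-nonzero j α β
    -- Both sides have the same time α + β + 2n, and their positions α - β + 2n and α - β - 2n
    -- differ by two full turns of the cycle.
    ; period  = λ α β → 𝔽.reflexive (cong₂ (λ s b → column-product (X (half s)) (at 0) b)
        (solve 3 (λ α β p → con 0ℤ :+ ((α :+ p) :+ β) := con 0ℤ :+ (α :+ (β :+ p))) refl α β (+ suc p))
        (trans (cong ⟦_⟧ (solve 3 (λ α β p → (α :+ p) :- β := ((α :- (β :+ p)) :+ p) :+ p) refl α β (+ suc p)))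
               (trans (⟦⟧-periodic ((α ℤ.- (β ℤ.+ + suc p)) ℤ.+ + suc p)) (⟦⟧-periodic (α ℤ.- (β ℤ.+ + suc p))))))
    }
    where open ℤSolver.+-*-Solver using (solve; _:=_; _:+_; _:-_; con)

  -- One full period 2n of rows is n steps of the time evolution.
  orbit-recurrence : ∀ n → + suc p ≡ n ℤ.+ n → ∀ (q : Fin m) (a : Fin (suc p)) →
    ∃ λ cs → length cs ≡ suc m C suc (toℕ q)
           × (∀ k → AnnihilatingPolynomial.eval 𝔽 {ℤ} (ℤ._+ n) cs (λ k → X k (combine q a)) k ≈ 0#)
  orbit-recurrence n pn q a = proj₁ rec , proj₁ (proj₂ rec) , λ k → 𝔽.trans
    (𝔽.sym (Simulation.eval-~ 𝔽 (ℤ._+ + suc p) (ℤ._+ n) _~[ k ]_ (λ {α} → next-period k {α})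
      (proj₁ rec) (λ {α} {l} → value k {α} {l}) (start k)))
    (proj₂ (proj₂ rec) (α₀ k) (β₀ k))
    where
    open ℤSolver.+-*-Solver using (solve; _:=_; _:+_; _:-_; con)
    rec : ∃ λ cs → length cs ≡ suc m C suc (toℕ q)
        × (∀ α β → AnnihilatingPolynomial.eval 𝔽 {ℤ} (ℤ._+ + suc p) cs (λ α → T (suc (toℕ q)) α β) α ≈ 0#)
    rec = recurrence isTSystem (suc (toℕ q)) (ℕ.s≤s (ℕₚ.<⇒≤ (Finₚ.toℕ<n q)))
    -- `α₀` and `β₀` solve α - β = a and half (q + α + β) = k: with α = a + β the second equation
    -- becomes half s + β = k.
    s : ℤ
    s = + toℕ q ℤ.+ + toℕ a
    α₀ β₀ : ℤ → ℤ
    β₀ k = k ℤ.- half s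
    α₀ k = + toℕ a ℤ.+ β₀ k
    -- Row α of the fixed column `β₀ k` shows the vertex (q, a) at time l. Adding 2n to α returns to
    -- the same place on the cycle and advances l by n.
    _~[_]_ : ℤ → ℤ → ℤ → Set
    α ~[ k ] l = half (+ toℕ q ℤ.+ (α ℤ.+ β₀ k)) ≡ l × ⟦ α ℤ.- β₀ k ⟧ ≡ a
    next-period : ∀ k {α l} → α ~[ k ] l → (α ℤ.+ + suc p) ~[ k ] (l ℤ.+ n)
    next-period k {α} (e , f) =
      trans (cong half (trans (cong (λ d → + toℕ q ℤ.+ ((α ℤ.+ d) ℤ.+ β₀ k)) pn)
              (solve 4 (λ q α n β → q :+ ((α :+ (n :+ n)) :+ β) := (q :+ (α :+ β)) :+ (n :+ n)) refl (+ toℕ q) α n (β₀ k))))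
            (trans (half-double (+ toℕ q ℤ.+ (α ℤ.+ β₀ k)) n) (cong (ℤ._+ n) e))
      , trans (cong ⟦_⟧ (solve 3 (λ α d β → (α :+ d) :- β := (α :- β) :+ d) refl α (+ suc p) (β₀ k))) (trans (⟦⟧-periodic (α ℤ.- β₀ k)) f)
    value : ∀ k {α l} → α ~[ k ] l → T (suc (toℕ q)) α (β₀ k) ≈ X l (combine q a)
    value k {α} (e , f) = 𝔽.trans (column-product-single (X (half (+ toℕ q ℤ.+ (α ℤ.+ β₀ k)))) q ⟦ α ℤ.- β₀ k ⟧)
      (𝔽.reflexive (cong₂ (λ l b → X l (combine q b)) e f))
    start : ∀ k → α₀ k ~[ k ] k
    start k = trans (cong half (solve 3 (λ q a b → q :+ ((a :+ b) :+ b) := (q :+ a) :+ (b :+ b)) refl (+ toℕ q) (+ toℕ a) (β₀ k)))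
                (trans (half-double s (β₀ k)) (solve 2 (λ h k → h :+ (k :- h) := k) refl (half s) k))
            , trans (cong ⟦_⟧ (solve 2 (λ a b → (a :+ b) :- b := a) refl (+ toℕ a) (β₀ k))) (⟦toℕ⟧ a)

open import Data.Nat using (_+_; _*_; _∸_; _≥_)

-- From polynomials to recurrences

module Recurrences (𝕂 : DiscreteField) where
  open DiscreteField 𝕂 renaming (Carrier to K; refl to ≈-refl; sym to ≈-sym; trans to ≈-trans; _+_ to _+K_; _*_ to _*K_)
  open IntegerCoefficients commutativeRing
  open import Relation.Binary.Reasoning.Setoid setoid

  module Unit = AnnihilatingPolynomial 𝕂 {ℤ} ℤ.suc
  open Unit using (eval)

  -- Substitution of S^(n+1) for S in a monic polynomial.
  stretch : ℕ → List K → List K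
  stretch n []       = []
  stretch n (c ∷ cs) = c ∷ List.replicate n 0# ++ stretch n cs

  length-stretch : ∀ n cs → length (stretch n cs) ≡ suc n * length cs
  length-stretch n []       = sym (ℕₚ.*-zeroʳ (suc n))
  length-stretch n (c ∷ cs) = trans (cong suc (trans (Listₚ.length-++ (List.replicate n 0#))
    (cong₂ _+_ (Listₚ.length-replicate n) (length-stretch n cs)))) (sym (ℕₚ.*-suc (suc n) (length cs)))

  eval-zeros : ∀ n l h k → eval (List.replicate n 0# ++ l) h k ≈ eval l (λ i → h (i ℤ.+ + n)) k
  eval-zeros zero    l h k = Unit.eval-cong l (λ i → reflexive (cong h (sym (ℤₚ.+-identityʳ i)))) k
  eval-zeros (suc n) l h k = begin
    eval (List.replicate n 0# ++ l) (λ i → h (ℤ.suc i)) k +K 0# *K h k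
      ≈⟨ ≈-trans (+-congˡ (zeroˡ (h k))) (+-identityʳ _) ⟩
    eval (List.replicate n 0# ++ l) (λ i → h (ℤ.suc i)) k
      ≈⟨ eval-zeros n l (λ i → h (ℤ.suc i)) k ⟩
    eval l (λ i → h (ℤ.suc (i ℤ.+ + n))) k
      ≈⟨ Unit.eval-cong l (λ i → reflexive (cong h (move i (+ n)))) k ⟩
    eval l (λ i → h (i ℤ.+ + suc n)) k ∎
    where
    move : ∀ i n → ℤ.suc (i ℤ.+ n) ≡ i ℤ.+ ℤ.suc n
    move = S.solve 2 (λ i n → S.con 1ℤ S.:+ (i S.:+ n) S.:= i S.:+ (S.con 1ℤ S.:+ n)) refl
      where module S = ℤSolver.+-*-Solver

  eval-stretch : ∀ n cs h k → AnnihilatingPolynomial.eval 𝕂 {ℤ} (ℤ._+ + suc n) cs h k ≈ eval (stretch n cs) h k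
  eval-stretch n []       h k = ≈-refl
  eval-stretch n (c ∷ cs) h k = +-congʳ (≈-trans (eval-stretch n cs (λ i → h (i ℤ.+ + suc n)) k)
    (≈-trans (Unit.eval-cong (stretch n cs) (λ i → reflexive (cong h (move i (+ n)))) k)
      (≈-sym (eval-zeros n (stretch n cs) (λ i → h (ℤ.suc i)) k))))
    where
    move : ∀ i n → i ℤ.+ ℤ.suc n ≡ ℤ.suc (i ℤ.+ n)
    move = S.solve 2 (λ i n → i S.:+ (S.con 1ℤ S.:+ n) S.:= S.con 1ℤ S.:+ (i S.:+ n)) refl
      where module S = ℤSolver.+-*-Solver

  sumF : ∀ r → (Fin r → K) → K
  sumF zero    f = 0#
  sumF (suc r) f = f Fin.zero +K sumF r (λ i → f (Fin.suc i))

  sumF-cong : ∀ r {f g : Fin r → K} → (∀ i → f i ≈ g i) → sumF r f ≈ sumF r g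
  sumF-cong zero    e = ≈-refl
  sumF-cong (suc r) e = +-cong (e Fin.zero) (sumF-cong r (λ i → e (Fin.suc i)))

  sumF-last : ∀ r (f : ℕ → K) → sumF (suc r) (f ∘ toℕ) ≈ sumF r (f ∘ toℕ) +K f r
  sumF-last zero    f = +-comm _ _
  sumF-last (suc r) f = ≈-trans (+-congˡ (sumF-last r (f ∘ suc))) (≈-sym (+-assoc _ _ _))

  -- The coefficients of the recurrence, listed from the most recent term, so in the opposite order to the polynomial.
  coefficient : List K → ℕ → K
  coefficient []       i = 0#
  coefficient (c ∷ cs) i = if does (i ℕ.≟ length cs) then - c else coefficient cs i

  -- An identity for every sequence, which is what makes induction on the list possible: the
  -- recurrence fails at k exactly by the value of the polynomial at k - r, where r is its degree.
  eval-coefficients : ∀ cs a k →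
    a k ≈ eval cs a (k ℤ.- + length cs) +K sumF (length cs) (λ i → coefficient cs (toℕ i) *K a (k ℤ.- + suc (toℕ i)))
  eval-coefficients []       a k = ≈-trans (reflexive (cong a (sym (ℤₚ.+-identityʳ k)))) (≈-sym (+-identityʳ _))
  eval-coefficients (c ∷ cs) a k = begin
    a k
      ≈⟨ eval-coefficients cs a k ⟩
    eval cs a (k ℤ.- + r) +K sumF r (λ i → coefficient cs (toℕ i) *K b (toℕ i))
      ≈⟨ +-cong (≈-trans (reflexive (cong (eval cs a) (move k (+ r)))) (≈-sym (Unit.eval-shift cs a (k ℤ.- + suc r))))
                (sumF-cong r (λ i → *-congʳ (reflexive (cong (if_then - c else coefficient cs (toℕ i)) (sym (dec-false (toℕ i ℕ.≟ r) (earlier i))))))) ⟩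
    E +K Σr
      ≈⟨ solve 4 (λ e s c b → e :+ s := (e :+ c :* b) :+ (s :+ (:- c) :* b)) ≈-refl E Σr c (b r) ⟩
    (E +K c *K b r) +K (Σr +K (- c) *K b r)
      ≈⟨ +-congˡ (+-congˡ (*-congʳ (reflexive (cong (if_then - c else coefficient cs r) (dec-true (r ℕ.≟ r) refl))))) ⟨
    (E +K c *K b r) +K (Σr +K f r)
      ≈⟨ +-congˡ (sumF-last r f) ⟨
    (E +K c *K b r) +K sumF (suc r) (f ∘ toℕ) ∎
    where
    r : ℕ
    r = length cs
    b f : ℕ → K
    b i = a (k ℤ.- + suc i)
    f i = coefficient (c ∷ cs) i *K b i
    E Σr : K
    E  = eval cs (λ i → a (ℤ.suc i)) (k ℤ.- + suc r)
    Σr = sumF r (f ∘ toℕ)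
    earlier : ∀ (i : Fin r) → toℕ i ≢ r
    earlier i e = ℕₚ.<-irrefl e (Finₚ.toℕ<n i)
    move : ∀ k r → k ℤ.- r ≡ ℤ.suc (k ℤ.- ℤ.suc r)
    move = S.solve 2 (λ k r → k S.:- r S.:= S.con 1ℤ S.:+ (k S.:- (S.con 1ℤ S.:+ r))) refl
      where module S = ℤSolver.+-*-Solver

  recurrence-from-eval : ∀ cs a → (∀ k → eval cs a k ≈ 0#) → ∀ k →
    a k ≈ sumF (length cs) (λ i → coefficient cs (toℕ i) *K a (k ℤ.- + suc (toℕ i)))
  recurrence-from-eval cs a z k = ≈-trans (eval-coefficients cs a k) (≈-trans (+-congʳ (z (k ℤ.- + length cs))) (+-identityˡ _))

module _ {N : ℕ} where
  open FunctionField N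
  open Recurrences 𝔽
  open Polynomials {N} using (coefficients; coefficientwise)

  -- Forgetting the proofs of nonzero denominators respects the operations literally, which brings
  -- the recurrence back to `Frac`.
  proj₁-sumF : ∀ r (f : Fin r → 𝔽.Carrier) → proj₁ (sumF r f) ≡ ΣF r (proj₁ ∘ f)
  proj₁-sumF zero    f = refl
  proj₁-sumF (suc r) f = cong (proj₁ (f Fin.zero) +F_) (proj₁-sumF r (f ∘ Fin.suc))

  linearizable : ∀ (a : ℤ → 𝔽.Carrier) cs → (∀ k → Unit.eval cs a k 𝔽.≈ 𝔽.0#) → Linearizable (λ k → proj₁ (a k)) (length cs)
  linearizable a cs z = (λ i → proj₁ (coefficient cs (toℕ i)))
    , (λ i n → proj₂ (coefficient cs (toℕ i)) (coefficientwise n))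
    , λ k → subst (λ s → proj₁ (a k) ≈F s) (proj₁-sumF (length cs) (λ i → coefficient cs (toℕ i) 𝔽.* a (k ℤ.- + suc (toℕ i))))
        (coefficients (Fractions._≃_.uncross (recurrence-from-eval cs a z k)))

evenᵇ-2* : ∀ n → evenᵇ (2 * n) ≡ true
evenᵇ-2* zero    = refl
evenᵇ-2* (suc n) = trans (cong (λ k → evenᵇ (suc k)) (ℕₚ.+-suc n (n + 0))) (evenᵇ-2* n)

mainTheorem2 : (m n : ℕ) → m ≥ 1 → n ≥ 1 →
    (j : ℕ) → 1 ≤ j → j ≤ m →
    (q : Fin m) → (suc (toℕ q) ≡ j ⊎ m ∸ toℕ q ≡ j) →
    (q' : Fin (2 * n)) →
    Linearizable (λ k → μPow (pathA m) (cycleA n) k (combine q q'))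
                 (n * ((m + 1) C j))
mainTheorem2 m (suc n) _ _ j _ _ q end q' =
  -- In this clause the number n of the statement is `suc n`. Stretching a polynomial in the (n +
  -- 1)-st power of the time shift to one in the shift itself multiplies its degree by n + 1.
  subst (Linearizable (λ k → proj₁ (X k (combine q q')))) order
    (linearizable (λ k → X k (combine q q')) (stretch n cs)
      (λ k → 𝔽.trans (𝔽.sym (eval-stretch n cs (λ k → X k (combine q q')) k)) (proj₂ (proj₂ rec) k)))
  where
  p : ℕ
  p = n + suc (n + 0)
  p-odd : evenᵇ p ≡ false
  p-odd = trans (sym (Boolₚ.not-involutive _)) (cong not (trans (sym (evenᵇ-suc p)) (evenᵇ-2* (suc n))))
  open Belts m p p-odd
  module FF = FunctionField N
  module 𝔽 = FF.𝔽
  open Recurrences FF.𝔽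
  rec : ∃ λ cs → length cs ≡ suc m C suc (toℕ q)
      × (∀ k → AnnihilatingPolynomial.eval FF.𝔽 {ℤ} (ℤ._+ + suc n) cs (λ k → X k (combine q q')) k 𝔽.≈ 𝔽.0#)
  rec = orbit-recurrence (+ suc n) (cong (λ k → + suc (n + suc k)) (ℕₚ.+-identityʳ n)) q q'
  cs : List 𝔽.Carrier
  cs = proj₁ rec
  binomial : suc m C suc (toℕ q) ≡ (m + 1) C j
  binomial = trans (from-end end) (cong (_C j) (ℕₚ.+-comm 1 m))
    where
    from-end : suc (toℕ q) ≡ j ⊎ m ∸ toℕ q ≡ j → suc m C suc (toℕ q) ≡ suc m C j
    from-end (inj₁ e) = cong (suc m C_) e
    -- Counted from the other end, q is number m - q, and `suc m ∸ suc (toℕ q)` computes to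
    -- `m ∸ toℕ q`.
    from-end (inj₂ e) = trans (nCk≡nC[n∸k] (s≤s (ℕₚ.<⇒≤ (Finₚ.toℕ<n q)))) (cong (suc m C_) e)
  order : length (stretch n cs) ≡ suc n * ((m + 1) C j)
  order = trans (length-stretch n cs) (cong (suc n *_) (trans (proj₁ (proj₂ rec)) binomial))
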